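{- A digraph $\Gamma$ is a primitive weakly distance-regular circulant digraph if and only if $\Gamma$ is isomorphic to one of the following: (i) the Paley digraph of order $p$, where $p$ is a prime with $p\equiv 3\pmod 4$; (ii) the directed circuit of length $p$, where $p$ is a prime; (iii) $\mathrm{Cay}(\mathbb{Z}_{13},\{1,3,9\})$.
   Context: Digraphs are finite, simple, and not undirected. For vertices $x,y$, $\partial(x,y)$ is the (directed) distance from $x$ to $y$ and $\tilde\partial(x,y)=(\partial(x,y),\partial(y,x))$. A strongly connected digraph $\Gamma$ is weakly distance-regular if $\mathfrak{X}(\Gamma)=(V\Gamma,\{\Gamma_{\tilde i}\}_{\tilde i\in\tilde\partial(\Gamma)})$ is an association scheme, where $\tilde\partial(\Gamma)=\{\tilde\partial(x,y)\mid x,y\in V\Gamma\}$ and $\Gamma_{\tilde i}=\{(x,y)\mid\tilde\partial(x,y)=\tilde i\}$; $\Gamma$ is primitive if this scheme is primitive, i.e. every non-diagonal relation generates the scheme (a relation generates if the smallest set $F$ of relations containing it with $R_{i^*}R_j\subseteq F$ for all $R_i,R_j\in F$ is the set of all relations, where $R_iR_j$ is the set of relations $R_l$ with nonzero intersection number $p^l_{i,j}$). For a group $H$ and a generating set $S\subseteq H\setminus\{e\}$ containing some $s$ with $s^{ -1}\notin S$, the Cayley digraph $\mathrm{Cay}(H,S)$ has vertex set $H$ and arcs $x\to y$ whenever $yx^{ -1}\in S$; a circulant digraph is one isomorphic to a Cayley digraph of a cyclic group. For a prime power $q\equiv 3\pmod 4$ with primitive element $\alpha$, the Paley digraph of order $q$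 has vertex set $\mathrm{GF}(q)$ and arcs $(x,y)$ with $x-y\in\alpha\langle\alpha^2\rangle$. -}

module Defs where

open import Data.Nat using (ℕ; zero; suc; _+_; _*_; _^_; _<_)
open import Data.Bool using (Bool; true; false; _∧_; not; if_then_else_)
open import Data.Fin using (Fin; toℕ; #_) renaming (_≟_ to _≟F_)
open import Data.Fin.Subset using (Subset; _∈_; _∉_; ⁅_⁆; _∪_)
open import Data.List using (List; allFin; upTo)
open import Data.Bool.ListAction using (any)
open import Data.Product using (Σ; ∃; ∃₂; _×_; _,_)
open import Relation.Binary.PropositionalEquality using (_≡_; _≢_)
open import Relation.Nullary using (¬_)
open import Relation.Nullary.Decidable using (isYes)
open import Function.Bundles using (_↔_; _⇔_; Inverse)

Cong : ℕ → ℕ → ℕ → Set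
Cong m a b = ∃₂ λ k l → a + k * m ≡ b + l * m

IsDigraph : (n : ℕ) → (Fin n → Fin n → Bool) → Set
IsDigraph n adj =
  (∀ x → adj x x ≡ false) ×
  (∃₂ λ x y → adj x y ≡ true × adj y x ≡ false)

countB : {n : ℕ} → (Fin n → Bool) → ℕ
countB {zero}  f = 0
countB {suc n} f = (if f Fin.zero then 1 else 0) + countB (λ i → f (Fin.suc i))

module _ {n : ℕ} (adj : Fin n → Fin n → Bool) where

  walk : ℕ → Fin n → Fin n → Bool
  walk zero    x y = isYes (x ≟F y)
  walk (suc k) x y = any (λ z → adj x z ∧ walk k z y) (allFin n)

  isDist : Fin n → Fin n → ℕ → Bool
  isDist x y d = walk d x y ∧ not (any (λ k → walk k x y) (upTo d))

  StronglyConnected : Set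
  StronglyConnected = ∀ x y → ∃ λ d → walk d x y ≡ true

  isTDist : Fin n → Fin n → ℕ × ℕ → Bool
  isTDist x y (i , j) = isDist x y i ∧ isDist y x j

  TDist : Fin n → Fin n → ℕ × ℕ → Set
  TDist x y h = isTDist x y h ≡ true

  InTDistSet : ℕ × ℕ → Set
  InTDistSet h = ∃₂ λ x y → TDist x y h

  _* : ℕ × ℕ → ℕ × ℕ
  (i , j) * = (j , i)

  interCount : Fin n → Fin n → ℕ × ℕ → ℕ × ℕ → ℕ
  interCount x y a b = countB (λ z → isTDist x z a ∧ isTDist z y b)

  -- The axioms of an association scheme for the configuration
  -- (VΓ , {Γ_ĩ}_{ĩ ∈ ∂̃(Γ)}); the relations Γ_ĩ (ĩ ∈ ∂̃(Γ)) are nonempty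
  -- and, Γ being strongly connected, partition VΓ × VΓ.
  IsAssociationScheme : Set
  IsAssociationScheme =
    (∀ x y → (x ≡ y → TDist x y (0 , 0)) × (TDist x y (0 , 0) → x ≡ y)) ×
    (∀ x y h → TDist x y h → TDist y x (h *)) ×
    (∀ h a b x y x' y' → TDist x y h → TDist x' y' h →
       interCount x y a b ≡ interCount x' y' a b)

  WeaklyDistanceRegular : Set
  WeaklyDistanceRegular = StronglyConnected × IsAssociationScheme

  NonzeroIntersection : ℕ × ℕ → ℕ × ℕ → ℕ × ℕ → Set
  NonzeroIntersection l a b =
    ∃₂ λ x y → ∃ λ z → TDist x y l × TDist x z a × TDist z y b

  data Generated (i : ℕ × ℕ) : ℕ × ℕ → Set where
    gen-base : Generated i i
    gen-step : ∀ {a b l} → Generated i a → Generated i b →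
               NonzeroIntersection l (a *) b → Generated i l

  Primitive : Set
  Primitive = ∀ i → InTDistSet i → i ≢ (0 , 0) →
              ∀ l → InTDistSet l → Generated i l

IsoTo : {n : ℕ} → (Fin n → Fin n → Bool) →
        (m : ℕ) → (Fin m → Fin m → Set) → Set
IsoTo {n} adj m R =
  Σ (Fin n ↔ Fin m) λ f →
    ∀ x y → (adj x y ≡ true) ⇔ R (Inverse.to f x) (Inverse.to f y)

CayArc : (m : ℕ) → Subset m → Fin m → Fin m → Set
CayArc m S x y = ∃ λ s → s ∈ S × Cong m (toℕ s + toℕ x) (toℕ y)

data ⟨_⟩ {m : ℕ} (S : Subset m) : Fin m → Set where
  sg-zero : ∀ z → toℕ z ≡ 0 → ⟨ S ⟩ z
  sg-elem : ∀ s → s ∈ S → ⟨ S ⟩ s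
  sg-sub  : ∀ a b c → ⟨ S ⟩ a → ⟨ S ⟩ b →
            Cong m (toℕ c + toℕ b) (toℕ a) → ⟨ S ⟩ c

IsCayleySet : (m : ℕ) → Subset m → Set
IsCayleySet m S =
  (∀ s → s ∈ S → ¬ Cong m (toℕ s) 0) ×
  (∀ g → ⟨ S ⟩ g) ×
  (∃ λ s → s ∈ S × (∀ t → t ∈ S → ¬ Cong m (toℕ s + toℕ t) 0))

Circulant : {n : ℕ} → (Fin n → Fin n → Bool) → Set
Circulant adj = ∃ λ m → ∃ λ S → IsCayleySet m S × IsoTo adj m (CayArc m S)

IsPrimitiveElement : ℕ → ℕ → Set
IsPrimitiveElement p α =
  ¬ Cong p α 0 ×
  (∀ (x : Fin p) → ¬ Cong p (toℕ x) 0 → ∃ λ k → Cong p (α ^ k) (toℕ x))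

-- Paley digraph of order p w.r.t. α: arc x → y iff x - y ∈ α⟨α²⟩,
-- i.e. x ≡ y + α^(2k+1) for some k
PaleyArc : (p α : ℕ) → Fin p → Fin p → Set
PaleyArc p α x y = ∃ λ k → Cong p (toℕ y + α ^ (2 * k + 1)) (toℕ x)

CircuitArc : (p : ℕ) → Fin p → Fin p → Set
CircuitArc p x y = Cong p (toℕ x + 1) (toℕ y)

S13 : Subset 13
S13 = ⁅ # 1 ⁆ ∪ (⁅ # 3 ⁆ ∪ ⁅ # 9 ⁆)

{-# OPTIONS --safe #-}
-- Let d x be the distance from 0 to x in a Cayley digraph of ℤ/m and τ x = (d x , d (- x)), so that the level sets of
-- τ are the classes of a scheme. Modulo a prime q, the q-th convolution power of the indicator of a class counts q-th
-- multiples (Schur). For q a proper divisor of m this makes a class T of arcs a union of cosets of the subgroup P of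
-- order q, apart from T ∩ P; counting differences then contradicts primitivity. So m is a prime p, and for q ≠ p it
-- follows that multiplication by units permutes the classes: after rescaling, the class K of 1 is a multiplicative
-- subgroup, and d x ≠ d (- x) for x ≠ 0.
--
-- Let X = {x | d x ≤ d (- x)}. An arc of the digraph leaves X as often as it returns, and the two counts can only
-- agree if both meet their obvious bounds with equality. One consequence is that K consists of all arcs. Let
-- h = d (- 1). Then h ≠ 3; if h ≥ 4, then all steps of a shortest closed walk are equal, so K = {1} and the digraph is
-- a directed circuit. If h = 2 and no element has type (2 , 3), then every nonzero element lies in K or - K, whence K
-- is the group of squares and the digraph is a Paley digraph. If h = 2 and such elements exist, comparing additive
-- energies of the classes gives |K| ≤ 3; then K = {1, u, u²}, and (1 - u)² = - 3 u leads to p ∣ 28 or p ∣ 91, so p = 13.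
module Submission where

open import Defs hiding (_*)
open import Data.Nat as ℕ using (ℕ; zero; suc; NonZero; _≤_; _<_; z≤n; s≤s)
import Data.Nat.Properties as ℕ
open import Algebra.Bundles using (CommutativeRing; RawRing; CommutativeSemiring)
open import Algebra.Solver.Ring.AlmostCommutativeRing using (fromCommutativeRing; _-Raw-AlmostCommutative⟶_)
open import Algebra.Structures using (IsCommutativeRing)
open import Data.Bool as Bool using (Bool; true; false; _∧_; not)
open import Data.Bool.ListAction using (any)
open import Data.Bool.Properties using (T-≡; not-¬; ¬-not)
open import Data.Empty using (⊥; ⊥-elim)
open import Data.Fin as Fin using (Fin; toℕ; zero; suc; fromℕ; inject₁; fromℕ<; #_)
open import Data.Fin.Permutation using (permutation)
open import Data.Fin.Properties using (toℕ-fromℕ<; toℕ-injective; toℕ<n; toℕ-fromℕ; toℕ-inject₁) renaming (_≟_ to _≟F_; any? to anyF?; suc-injective to sucF-injective; all? to allF?)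
open import Data.Fin.Subset using (Subset; _∈_; inside)
open import Data.Fin.Subset.Properties using (_∈?_)
open import Data.List using (List; allFin; upTo; []; _∷_)
open import Data.List.Membership.Propositional using (lose; find) renaming (_∈_ to _∈L_)
open import Data.List.Membership.Propositional.Properties using (∈-upTo⁺; ∈-upTo⁻; ∈-allFin)
open import Data.List.Relation.Unary.All as All using (All; []; _∷_)
open import Data.List.Relation.Unary.AllPairs using (AllPairs; []; _∷_)
open import Data.List.Relation.Unary.Any using (Any; here; there)
open import Data.List.Relation.Unary.Any.Properties using (any⁺; any⁻)
open import Data.Maybe using (Maybe; just; nothing)
open import Data.Nat.Combinatorics using (_C_; nCn≡1; nCk≡n!/k![n-k]!; k![n∸k]!∣n!)
open import Data.Nat.Coprimality using (prime⇒coprime; coprime-Bézout; Coprime; coprime-divisor) renaming (sym to coprime-sym)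
open import Data.Nat.DivMod using (_%_; _mod_; m%n<n; %-distribˡ-+; %-distribˡ-*; m<n⇒m%n≡m; n%n≡0; m≡m%n+[m/n]*n; [m+kn]%n≡m%n; _/_; m<n*o⇒m/o<n; m/n*n≡m; m%n≤m)
open import Data.Nat.Divisibility using (_∣_; divides; ∣-refl; ∣⇒≤; m∣m*n; m%n≡0⇒n∣m; *-cancelˡ-∣; ∣m+n∣m⇒∣n; n∣m*n; ∣m∣n⇒∣m+n; ∣-trans; _∣?_; 1∣_; *-monoʳ-∣)
open import Data.Nat.GCD using (module Bézout)
open import Data.Nat.ListAction using (product)
open import Data.Nat.ListAction.Properties using (product≢0)
open import Data.Nat.Primality using (Prime; euclidsLemma; prime⇒nonZero; prime⇒nonTrivial; prime?; prime⇒irreducible)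
open import Data.Nat.Primality.Factorisation using (PrimeFactorisation; factorise)
open import Data.Nat.Solver using (module +-*-Solver)
open import Data.Product using (∃; ∃₂; _×_; _,_; proj₁; proj₂; swap)
open import Data.Product.Properties using (≡-dec)
open import Data.Sum as Sum using (_⊎_; inj₁; inj₂; [_,_]′)
open import Data.Unit using (⊤; tt)
open import Data.Vec using (tabulate; lookup; []; _∷_)
open import Data.Vec.Properties using (lookup∘tabulate; []=⇒lookup; lookup⇒[]=)
open import Function using (_∘_)
open import Function.Bundles using (_↔_; _⇔_; Inverse; Equivalence; mk⇔; mk↔ₛ′)
open import Level using (0ℓ)
open import Relation.Binary using (IsEquivalence)
open import Relation.Binary.PropositionalEquality using (_≡_; _≢_; refl; sym; trans; cong; cong₂; subst; isEquivalence; module ≡-Reasoning; _≗_; subst₂)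
open import Relation.Nullary using (yes; no; Dec; ¬_; contradiction; does)
open import Relation.Nullary.Decidable using (_×-dec_; _⊎-dec_; ¬?; isYes; decidable-stable; from-yes; _→-dec_)
open import Relation.Unary using (Decidable)
import Algebra.Solver.Ring
import Algebra.Properties.Ring
import Algebra.Properties.AbelianGroup
open import Algebra.Properties.Semiring.Sum ℕ.+-*-semiring using (sum; sum-cong-≗; ∑-distrib-+; ∑-comm; sum-permute; *-distribˡ-sum; *-distribʳ-sum; sum-replicate-zero)
open +-*-Solver using () renaming (solve to solveℕ; _:+_ to _:+ℕ_; _:*_ to _:*ℕ_; _:=_ to _:=ℕ_; con to conℕ)

-- Schur's congruence acts in two ways. The fibres of multiplication by q are the cosets of its
-- kernel. If q properly divides m, a class meets a fibre over a nonzero point in a multiple of q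
-- elements, that is in the whole coset or not at all. If q is prime to m, a fibre is a single
-- point, and the congruence says that multiplication by q respects the partition into classes. Once
-- all units respect it, every class of nonzero elements is a coset of K. Classes then have equal
-- size and intersection numbers can be rescaled, so each later statement becomes a count inside K.
-- The flow argument squeezes one number from both sides: v ↦ (1 - v) / v embeds the v with 1 - v ∼
-- v into K, while each element of K yields a step back into X. The divisors 28 and 91 arise from 1
-- - u = ± e t with t³ = 1 and e equal to 1 or 2: taking sixth powers makes e⁶ + 27 vanish modulo p.

module ZMod (m : ℕ) .{{_ : NonZero m}} where

  F : Set
  F = Fin m

  infixl 7 _*_
  infixl 6 _+_
  infix 8 -_

  -- Kept opaque so that goals stay in the language of rings instead of unfolding to `mod`; only the
  -- laws proved in this block are visible later.
  abstract
    ⟦_⟧ : ℕ → F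
    ⟦ n ⟧ = n mod m

    toℕ-⟦⟧ : ∀ n → toℕ ⟦ n ⟧ ≡ n % m
    toℕ-⟦⟧ n = toℕ-fromℕ< (m%n<n n m)

    ⟦⟧-%-cong : ∀ a b → a % m ≡ b % m → ⟦ a ⟧ ≡ ⟦ b ⟧
    ⟦⟧-%-cong a b e = toℕ-injective (trans (toℕ-⟦⟧ a) (trans e (sym (toℕ-⟦⟧ b))))

    _+_ _*_ : F → F → F
    x + y = ⟦ toℕ x ℕ.+ toℕ y ⟧
    x * y = ⟦ toℕ x ℕ.* toℕ y ⟧

    -_ : F → F
    - x = ⟦ m ℕ.∸ toℕ x ⟧

    ⟦toℕ⟧ : ∀ x → ⟦ toℕ x ⟧ ≡ x
    ⟦toℕ⟧ x = toℕ-injective (trans (toℕ-⟦⟧ (toℕ x)) (m<n⇒m%n≡m (toℕ<n x)))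

    +-homo : ∀ a b → ⟦ a ℕ.+ b ⟧ ≡ ⟦ a ⟧ + ⟦ b ⟧
    +-homo a b = ⟦⟧-%-cong _ _ (trans (%-distribˡ-+ a b m)
      (cong₂ (λ u v → (u ℕ.+ v) % m) (sym (toℕ-⟦⟧ a)) (sym (toℕ-⟦⟧ b))))

    *-homo : ∀ a b → ⟦ a ℕ.* b ⟧ ≡ ⟦ a ⟧ * ⟦ b ⟧
    *-homo a b = ⟦⟧-%-cong _ _ (trans (%-distribˡ-* a b m)
      (cong₂ (λ u v → (u ℕ.* v) % m) (sym (toℕ-⟦⟧ a)) (sym (toℕ-⟦⟧ b))))

    x+-x≡0 : ∀ x → x + - x ≡ ⟦ 0 ⟧
    x+-x≡0 x = begin
      x + - x                       ≡⟨ cong (_+ - x) (sym (⟦toℕ⟧ x)) ⟩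
      ⟦ toℕ x ⟧ + ⟦ m ℕ.∸ toℕ x ⟧   ≡⟨ +-homo (toℕ x) (m ℕ.∸ toℕ x) ⟨
      ⟦ toℕ x ℕ.+ (m ℕ.∸ toℕ x) ⟧   ≡⟨ cong ⟦_⟧ (ℕ.m+[n∸m]≡n (ℕ.<⇒≤ (toℕ<n x))) ⟩
      ⟦ m ⟧                         ≡⟨ ⟦⟧-%-cong _ _ (trans (n%n≡0 m) (sym (m<n⇒m%n≡m (ℕ.>-nonZero⁻¹ m)))) ⟩
      ⟦ 0 ⟧ ∎
      where open ≡-Reasoning

  0# 1# : F
  0# = ⟦ 0 ⟧
  1# = ⟦ 1 ⟧

  ⟦⟧-cong : ∀ {a b} → Cong m a b → ⟦ a ⟧ ≡ ⟦ b ⟧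
  ⟦⟧-cong {a} {b} (k , l , e) = ⟦⟧-%-cong a b
    (trans (sym ([m+kn]%n≡m%n a k m)) (trans (cong (_% m) e) ([m+kn]%n≡m%n b l m)))

  ⟦⟧-cong⁻ : ∀ {a b} → ⟦ a ⟧ ≡ ⟦ b ⟧ → Cong m a b
  -- Each side receives the quotient of the other, so both become the common remainder plus
  -- `(a / m + b / m) * m`.
  ⟦⟧-cong⁻ {a} {b} e = b / m , a / m , (begin
    a ℕ.+ b / m ℕ.* m                              ≡⟨ cong (ℕ._+ b / m ℕ.* m) (m≡m%n+[m/n]*n a m) ⟩
    a % m ℕ.+ a / m ℕ.* m ℕ.+ b / m ℕ.* m    ≡⟨ cong (λ r → r ℕ.+ a / m ℕ.* m ℕ.+ b / m ℕ.* m) a%≡b% ⟩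
    b % m ℕ.+ a / m ℕ.* m ℕ.+ b / m ℕ.* m    ≡⟨ ℕ.+-assoc (b % m) _ _ ⟩
    b % m ℕ.+ (a / m ℕ.* m ℕ.+ b / m ℕ.* m)  ≡⟨ cong (b % m ℕ.+_) (ℕ.+-comm (a / m ℕ.* m) _) ⟩
    b % m ℕ.+ (b / m ℕ.* m ℕ.+ a / m ℕ.* m)  ≡⟨ ℕ.+-assoc (b % m) _ _ ⟨
    b % m ℕ.+ b / m ℕ.* m ℕ.+ a / m ℕ.* m    ≡⟨ cong (ℕ._+ a / m ℕ.* m) (m≡m%n+[m/n]*n b m) ⟨
    b ℕ.+ a / m ℕ.* m ∎)
    where
    open ≡-Reasoning
    a%≡b% : a % m ≡ b % m
    a%≡b% = trans (sym (toℕ-⟦⟧ a)) (trans (cong toℕ e) (toℕ-⟦⟧ b))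

  private
    -- Since `⟦_⟧` is surjective, the semiring laws descend from ℕ; nesting handles several
    -- variables.
    op₁ : {P : F → Set} → (∀ n → P ⟦ n ⟧) → ∀ x → P x
    op₁ {P} f x = subst P (⟦toℕ⟧ x) (f (toℕ x))

    +-assoc : ∀ x y z → (x + y) + z ≡ x + (y + z)
    +-assoc = op₁ λ a → op₁ λ b → op₁ λ c → begin
      (⟦ a ⟧ + ⟦ b ⟧) + ⟦ c ⟧  ≡⟨ cong (_+ ⟦ c ⟧) (+-homo a b) ⟨
      ⟦ a ℕ.+ b ⟧ + ⟦ c ⟧      ≡⟨ +-homo (a ℕ.+ b) c ⟨
      ⟦ a ℕ.+ b ℕ.+ c ⟧        ≡⟨ cong ⟦_⟧ (ℕ.+-assoc a b c) ⟩
      ⟦ a ℕ.+ (b ℕ.+ c) ⟧      ≡⟨ +-homo a (b ℕ.+ c) ⟩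
      ⟦ a ⟧ + ⟦ b ℕ.+ c ⟧      ≡⟨ cong (⟦ a ⟧ +_) (+-homo b c) ⟩
      ⟦ a ⟧ + (⟦ b ⟧ + ⟦ c ⟧)  ∎
      where open ≡-Reasoning

    *-assoc : ∀ x y z → (x * y) * z ≡ x * (y * z)
    *-assoc = op₁ λ a → op₁ λ b → op₁ λ c → begin
      (⟦ a ⟧ * ⟦ b ⟧) * ⟦ c ⟧  ≡⟨ cong (_* ⟦ c ⟧) (*-homo a b) ⟨
      ⟦ a ℕ.* b ⟧ * ⟦ c ⟧      ≡⟨ *-homo (a ℕ.* b) c ⟨
      ⟦ a ℕ.* b ℕ.* c ⟧        ≡⟨ cong ⟦_⟧ (ℕ.*-assoc a b c) ⟩
      ⟦ a ℕ.* (b ℕ.* c) ⟧      ≡⟨ *-homo a (b ℕ.* c) ⟩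
      ⟦ a ⟧ * ⟦ b ℕ.* c ⟧      ≡⟨ cong (⟦ a ⟧ *_) (*-homo b c) ⟩
      ⟦ a ⟧ * (⟦ b ⟧ * ⟦ c ⟧)  ∎
      where open ≡-Reasoning

    +-comm : ∀ x y → x + y ≡ y + x
    +-comm = op₁ λ a → op₁ λ b →
      trans (sym (+-homo a b)) (trans (cong ⟦_⟧ (ℕ.+-comm a b)) (+-homo b a))

    *-comm : ∀ x y → x * y ≡ y * x
    *-comm = op₁ λ a → op₁ λ b →
      trans (sym (*-homo a b)) (trans (cong ⟦_⟧ (ℕ.*-comm a b)) (*-homo b a))

    +-identityˡ : ∀ x → 0# + x ≡ x
    +-identityˡ = op₁ λ a → sym (+-homo 0 a)

    *-identityˡ : ∀ x → 1# * x ≡ x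
    *-identityˡ = op₁ λ a → trans (sym (*-homo 1 a)) (cong ⟦_⟧ (ℕ.*-identityˡ a))

    *-distribˡ-+ : ∀ x y z → x * (y + z) ≡ x * y + x * z
    *-distribˡ-+ = op₁ λ a → op₁ λ b → op₁ λ c → begin
      ⟦ a ⟧ * (⟦ b ⟧ + ⟦ c ⟧)      ≡⟨ cong (⟦ a ⟧ *_) (+-homo b c) ⟨
      ⟦ a ⟧ * ⟦ b ℕ.+ c ⟧          ≡⟨ *-homo a (b ℕ.+ c) ⟨
      ⟦ a ℕ.* (b ℕ.+ c) ⟧          ≡⟨ cong ⟦_⟧ (ℕ.*-distribˡ-+ a b c) ⟩
      ⟦ a ℕ.* b ℕ.+ a ℕ.* c ⟧    ≡⟨ +-homo (a ℕ.* b) (a ℕ.* c) ⟩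
      ⟦ a ℕ.* b ⟧ + ⟦ a ℕ.* c ⟧    ≡⟨ cong₂ _+_ (*-homo a b) (*-homo a c) ⟩
      ⟦ a ⟧ * ⟦ b ⟧ + ⟦ a ⟧ * ⟦ c ⟧ ∎
      where open ≡-Reasoning

    via-comm : ∀ {_∙_ : F → F → F} → (∀ x y → x ∙ y ≡ y ∙ x) →
               ∀ {x y z} → y ∙ x ≡ z → x ∙ y ≡ z
    via-comm c e = trans (c _ _) e

  isCommutativeRing : IsCommutativeRing _≡_ _+_ _*_ -_ 0# 1#
  isCommutativeRing = record
    { isRing = record
      { +-isAbelianGroup = record
        { isGroup = record
          { isMonoid = record
            { isSemigroup = record
              { isMagma = record { isEquivalence = isEquivalence ; ∙-cong = cong₂ _+_ }
              ; assoc = +-assoc }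
            ; identity = +-identityˡ , λ x → via-comm +-comm (+-identityˡ x) }
          ; inverse = (λ x → via-comm +-comm (x+-x≡0 x)) , x+-x≡0
          ; ⁻¹-cong = cong -_ }
        ; comm = +-comm }
      ; *-cong = cong₂ _*_
      ; *-assoc = *-assoc
      ; *-identity = *-identityˡ , λ x → via-comm *-comm (*-identityˡ x)
      ; distrib = *-distribˡ-+ , λ x y z → via-comm *-comm
          (trans (*-distribˡ-+ x y z) (cong₂ _+_ (*-comm x y) (*-comm x z)))
      }
    ; *-comm = *-comm }

  commutativeRing : CommutativeRing 0ℓ 0ℓ
  commutativeRing = record { isCommutativeRing = isCommutativeRing }

  infixl 6 _-_
  _-_ : F → F → F
  x - y = x + - y

-- The coefficients are integers, represented as formal differences of naturals.
module IntSolver (R : CommutativeRing 0ℓ 0ℓ) where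
  open CommutativeRing R renaming (refl to ≈-refl; sym to ≈-sym; trans to ≈-trans) hiding (isEquivalence; zero)
  open Algebra.Properties.Ring ring using (-‿distribˡ-*; -‿distribʳ-*; -‿involutive; -0#≈0#)
  open import Algebra.Properties.AbelianGroup +-abelianGroup using (⁻¹-∙-comm)
  open import Algebra.Properties.Semiring.Mult semiring renaming (_×_ to _·_)
  open import Algebra.Properties.CommutativeSemigroup +-commutativeSemigroup using (interchange)
  open import Relation.Binary.Reasoning.Setoid setoid

  private
    -- Cancelling the common part keeps coefficients small and makes zero appear as `(0 , 0)`.
    norm : ℕ → ℕ → ℕ × ℕ
    norm zero b = zero , b
    norm (suc a) zero = suc a , zero
    norm (suc a) (suc b) = norm a b

    Diff : RawRing 0ℓ 0ℓ
    Diff = record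
      { Carrier = ℕ × ℕ
      ; _≈_ = λ where (a , b) (c , d) → a ℕ.+ d ≡ c ℕ.+ b
      ; _+_ = λ where (a , b) (c , d) → norm (a ℕ.+ c) (b ℕ.+ d)
      ; _*_ = λ where (a , b) (c , d) → norm (a ℕ.* c ℕ.+ b ℕ.* d) (a ℕ.* d ℕ.+ b ℕ.* c)
      ; -_ = λ where (a , b) → b , a
      ; 0# = 0 , 0
      ; 1# = 1 , 0 }

    ι : ℕ × ℕ → Carrier
    ι (a , b) = a · 1# - b · 1#

    difference : ∀ w x y z → (w + x) - (y + z) ≈ (w - y) + (x - z)
    difference w x y z = ≈-trans (+-congˡ (≈-sym (⁻¹-∙-comm y z))) (interchange w x (- y) (- z))

    *-differences : ∀ w x y z → (w * y + x * z) - (w * z + x * y) ≈ (w - x) * (y - z)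
    *-differences w x y z = begin
      (w * y + x * z) - (w * z + x * y)          ≈⟨ difference _ _ _ _ ⟩
      (w * y - w * z) + (x * z - x * y)          ≈⟨ +-cong (left w y z) (≈-trans (≈-sym (flip y z)) (-‿distribˡ-* x (y - z))) ⟩
      w * (y - z) + (- x) * (y - z)              ≈⟨ distribʳ _ _ _ ⟨
      (w - x) * (y - z) ∎
      where
      left : ∀ w y z → w * y - w * z ≈ w * (y - z)
      left w y z = ≈-trans (+-congˡ (-‿distribʳ-* w z)) (≈-sym (distribˡ w y (- z)))
      flip : ∀ y z → - (x * (y - z)) ≈ x * z - x * y
      flip y z = begin
        - (x * (y - z))     ≈⟨ -‿distribʳ-* x (y - z) ⟩
        x * - (y - z)       ≈⟨ *-congˡ (≈-trans (≈-sym (⁻¹-∙-comm y (- z))) (≈-trans (+-comm _ _) (+-congʳ (-‿involutive z)))) ⟩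
        x * (z - y)         ≈⟨ left x z y ⟨
        x * z - x * y       ∎

    -- Agrees with ι, but 0 and 1 evaluate to 0# and 1# on the nose.
    ι′ : ℕ × ℕ → Carrier
    ι′ (0 , 0) = 0#
    ι′ (1 , 0) = 1#
    ι′ x = ι x

    ι′≈ι : ∀ x → ι′ x ≈ ι x
    ι′≈ι (0 , 0) = ≈-sym (-‿inverseʳ 0#)
    ι′≈ι (1 , 0) = ≈-sym (≈-trans (+-cong (+-identityʳ 1#) -0#≈0#) (+-identityʳ 1#))
    ι′≈ι (0 , suc b) = ≈-refl
    ι′≈ι (1 , suc b) = ≈-refl
    ι′≈ι (suc (suc a) , b) = ≈-refl

    ι-norm : ∀ a b → ι (norm a b) ≈ ι (a , b)
    ι-norm zero b = ≈-refl
    ι-norm (suc a) zero = ≈-refl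
    ι-norm (suc a) (suc b) = ≈-trans (ι-norm a b) (≈-sym
      (≈-trans (difference 1# (a · 1#) 1# (b · 1#)) (≈-trans (+-congʳ (-‿inverseʳ 1#)) (+-identityˡ _))))

    morphism : Diff -Raw-AlmostCommutative⟶ fromCommutativeRing R
    morphism = record
      { ⟦_⟧ = ι′
      ; +-homo = λ where
          x@(a , b) y@(c , d) → ≈-trans (≈-trans (ι′≈ι (norm (a ℕ.+ c) (b ℕ.+ d))) (ι-norm (a ℕ.+ c) (b ℕ.+ d))) (≈-trans
            (≈-trans (+-cong (×-homo-+ 1# a c) (-‿cong (×-homo-+ 1# b d))) (difference _ _ _ _))
            (≈-sym (+-cong (ι′≈ι x) (ι′≈ι y))))
      ; *-homo = λ where
          x@(a , b) y@(c , d) → ≈-trans (≈-trans (ι′≈ι (norm (a ℕ.* c ℕ.+ b ℕ.* d) (a ℕ.* d ℕ.+ b ℕ.* c)))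
            (ι-norm (a ℕ.* c ℕ.+ b ℕ.* d) (a ℕ.* d ℕ.+ b ℕ.* c))) (≈-trans (≈-trans (+-cong
            (≈-trans (×-homo-+ 1# (a ℕ.* c) (b ℕ.* d)) (+-cong (×1-homo-* a c) (×1-homo-* b d)))
            (-‿cong (≈-trans (×-homo-+ 1# (a ℕ.* d) (b ℕ.* c)) (+-cong (×1-homo-* a d) (×1-homo-* b c)))))
            (*-differences _ _ _ _))
            (≈-sym (*-cong (ι′≈ι x) (ι′≈ι y))))
      ; -‿homo = λ where
          x@(a , b) → ≈-trans (ι′≈ι (b , a)) (≈-trans
            (≈-trans (+-comm _ _) (≈-trans (+-congˡ (≈-sym (-‿involutive _))) (⁻¹-∙-comm _ _)))
            (-‿cong (≈-sym (ι′≈ι x))))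
      ; 0-homo = ≈-refl
      ; 1-homo = ≈-refl }

    coeff≟ : ∀ x y → Maybe (ι′ x ≈ ι′ y)
    coeff≟ (a , b) (c , d) with a ℕ.+ d ℕ.≟ c ℕ.+ b
    ... | no _ = nothing
    ... | yes e = just (begin
      ι′ (a , b)                                        ≈⟨ ι′≈ι (a , b) ⟩
      a · 1# - b · 1#                                   ≈⟨ shift (a · 1#) (b · 1#) (d · 1#) ⟩
      (a · 1# + d · 1#) - (b · 1# + d · 1#)             ≈⟨ +-cong (≈-sym (×-homo-+ 1# a d)) ≈-refl ⟩
      (a ℕ.+ d) · 1# - (b · 1# + d · 1#)              ≈⟨ +-cong (×-congˡ e) (-‿cong (+-comm _ _)) ⟩
      (c ℕ.+ b) · 1# - (d · 1# + b · 1#)              ≈⟨ +-cong (×-homo-+ 1# c b) ≈-refl ⟩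
      (c · 1# + b · 1#) - (d · 1# + b · 1#)             ≈⟨ shift (c · 1#) (d · 1#) (b · 1#) ⟨
      c · 1# - d · 1#                                   ≈⟨ ι′≈ι (c , d) ⟨
      ι′ (c , d)                                        ∎)
      where
      shift : ∀ w x y → w - x ≈ (w + y) - (x + y)
      shift w x y = ≈-sym (≈-trans (difference w y x y) (≈-trans (+-congˡ (-‿inverseʳ y)) (+-identityʳ _)))

  open Algebra.Solver.Ring Diff (fromCommutativeRing R) morphism coeff≟ public
    using (solve; _:=_; _:+_; _:*_; _:-_; :-_; con; Polynomial)

  nat : ∀ {n} → ℕ → Polynomial n
  nat k = con (k , 0)

-- Counting in finite sets

module Counting where
  private variable
    A B : Set
    m n : ℕ

  χ : Dec A → ℕ
  χ (yes _) = 1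
  χ (no _) = 0

  χ-yes : (d : Dec A) → A → χ d ≡ 1
  χ-yes (yes _) a = refl
  χ-yes (no ¬a) a = contradiction a ¬a

  χ-no : (d : Dec A) → ¬ A → χ d ≡ 0
  χ-no (yes a) ¬a = contradiction a ¬a
  χ-no (no _) ¬a = refl

  χ>0 : (d : Dec A) → 0 < χ d → A
  χ>0 (yes a) _ = a

  χ-mono : (d : Dec A) (e : Dec B) → (A → B) → χ d ≤ χ e
  χ-mono (no _) e f = z≤n
  χ-mono (yes a) e f = ℕ.≤-reflexive (sym (χ-yes e (f a)))

  χ-cong : (d : Dec A) (e : Dec B) → (A → B) → (B → A) → χ d ≡ χ e
  χ-cong d e f g = ℕ.≤-antisym (χ-mono d e f) (χ-mono e d g)

  χ-× : (d : Dec A) (e : Dec B) → χ (d ×-dec e) ≡ χ d ℕ.* χ e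
  χ-× (yes _) (yes _) = refl
  χ-× (yes _) (no _) = refl
  χ-× (no _) e = refl

  sum-mono : {f g : Fin n → ℕ} → (∀ i → f i ≤ g i) → sum f ≤ sum g
  sum-mono {zero} h = z≤n
  sum-mono {suc n} h = ℕ.+-mono-≤ (h zero) (sum-mono (h ∘ suc))

  sum-zero : {f : Fin n → ℕ} → (∀ i → f i ≡ 0) → sum f ≡ 0
  sum-zero {n = n} h = trans (sum-cong-≗ h) (sum-replicate-zero n)

  sum-single : {f : Fin n → ℕ} (i : Fin n) → (∀ j → j ≢ i → f j ≡ 0) → sum f ≡ f i
  sum-single {f = f} zero h = trans (cong (f zero ℕ.+_) (sum-zero (λ j → h (suc j) λ ()))) (ℕ.+-identityʳ _)
  sum-single {f = f} (suc i) h = cong₂ ℕ._+_ (h zero λ ()) (sum-single i (λ j j≢i → h (suc j) (j≢i ∘ sucF-injective)))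

  term≤sum : (f : Fin n → ℕ) (i : Fin n) → f i ≤ sum f
  term≤sum f zero = ℕ.m≤m+n _ _
  term≤sum f (suc i) = ℕ.≤-trans (term≤sum (f ∘ suc) i) (ℕ.m≤n+m _ _)

  sum-tight : {f g : Fin n → ℕ} → (∀ i → f i ≤ g i) → sum g ≤ sum f → ∀ i → f i ≡ g i
  sum-tight {suc n} {f} {g} h e = λ where
      zero → ℕ.≤-antisym (h zero)
        (ℕ.+-cancelʳ-≤ (sum (g ∘ suc)) _ _ (ℕ.≤-trans e (ℕ.+-monoʳ-≤ (f zero) (sum-mono (h ∘ suc)))))
      (suc i) → sum-tight (h ∘ suc)
        (ℕ.+-cancelˡ-≤ (g zero) _ _ (ℕ.≤-trans e (ℕ.+-monoˡ-≤ _ (h zero)))) i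

  sum>0 : (f : Fin n → ℕ) → 0 < sum f → ∃ λ i → 0 < f i
  sum>0 {suc n} f h with f zero in e
  ... | suc _ = zero , subst (0 <_) (sym e) (s≤s z≤n)
  ... | zero with sum>0 (f ∘ suc) h
  ...   | i , q = suc i , q

  sum-bij : (f : Fin m → Fin n) (g : Fin n → Fin m) → (∀ x → g (f x) ≡ x) → (∀ y → f (g y) ≡ y) →
            (t : Fin n → ℕ) → sum (t ∘ f) ≡ sum t
  sum-bij f g gf fg t = sym (sum-permute t (permutation f g fg gf))

  count : {P : Fin n → Set} → Decidable P → ℕ
  count P? = sum (λ x → χ (P? x))

  module _ {P Q : Fin n → Set} (P? : Decidable P) (Q? : Decidable Q) where

    count-mono : (∀ x → P x → Q x) → count P? ≤ count Q?
    count-mono h = sum-mono λ x → χ-mono (P? x) (Q? x) (h x)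

    count-cong : (∀ x → P x → Q x) → (∀ x → Q x → P x) → count P? ≡ count Q?
    count-cong h k = ℕ.≤-antisym (count-mono h) (sum-mono λ x → χ-mono (Q? x) (P? x) (k x))

    -- The form in which matching bounds are exploited below: cardinalities are compared in order to
    -- learn that a given element belongs to the smaller set.
    count-tight : (∀ x → P x → Q x) → count Q? ≤ count P? → ∀ x → Q x → P x
    count-tight h e x q = χ>0 (P? x) (ℕ.≤-reflexive (sym
      (trans (sum-tight (λ y → χ-mono (P? y) (Q? y) (h y)) e x) (χ-yes (Q? x) q))))

    count-split : count P? ≡ count (λ x → P? x ×-dec Q? x) ℕ.+ count (λ x → P? x ×-dec ¬? (Q? x))
    count-split = trans (sum-cong-≗ λ x → go (P? x) (Q? x))
      (∑-distrib-+ (λ x → χ (P? x ×-dec Q? x)) (λ x → χ (P? x ×-dec ¬? (Q? x))))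
      where
      go : (d : Dec A) (e : Dec B) → χ d ≡ χ (d ×-dec e) ℕ.+ χ (d ×-dec ¬? e)
      go (yes _) (yes _) = refl
      go (yes _) (no _) = refl
      go (no _) e = refl

    count-incl-excl : count P? ℕ.+ count Q? ≡ count (λ x → P? x ⊎-dec Q? x) ℕ.+ count (λ x → P? x ×-dec Q? x)
    count-incl-excl = trans (sym (∑-distrib-+ (λ x → χ (P? x)) (λ x → χ (Q? x))))
      (trans (sum-cong-≗ λ x → go (P? x) (Q? x))
        (∑-distrib-+ (λ x → χ (P? x ⊎-dec Q? x)) (λ x → χ (P? x ×-dec Q? x))))
      where
      go : (d : Dec A) (e : Dec B) → χ d ℕ.+ χ e ≡ χ (d ⊎-dec e) ℕ.+ χ (d ×-dec e)
      go (yes _) (yes _) = refl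
      go (yes _) (no _) = refl
      go (no _) (yes _) = refl
      go (no _) (no _) = refl

  module _ {P : Fin n → Set} (P? : Decidable P) where

    count-none : (∀ x → ¬ P x) → count P? ≡ 0
    count-none h = sum-zero λ x → χ-no (P? x) (h x)

    count-single : ∀ x → P x → (∀ y → P y → y ≡ x) → count P? ≡ 1
    count-single x p h = trans (sum-single x λ y y≢x → χ-no (P? y) (y≢x ∘ h y)) (χ-yes (P? x) p)

    count-unique : (∀ x y → P x → P y → x ≡ y) → count P? ≤ 1
    count-unique h with anyF? P?
    ... | yes (x , p) = ℕ.≤-reflexive (count-single x p λ y q → h y x q p)
    ... | no ¬p = ℕ.≤-trans (ℕ.≤-reflexive (count-none λ x p → ¬p (x , p))) z≤n

    count>0 : ∀ x → P x → 0 < count P?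
    count>0 x p = ℕ.≤-trans (ℕ.≤-reflexive (sym (χ-yes (P? x) p))) (term≤sum _ x)

    count>0⁻ : 0 < count P? → ∃ P
    count>0⁻ h with sum>0 _ h
    ... | x , q = x , χ>0 (P? x) q

    count-bij : (f : Fin m → Fin n) (g : Fin n → Fin m) → (∀ x → g (f x) ≡ x) → (∀ y → f (g y) ≡ y) →
                count (P? ∘ f) ≡ count P?
    count-bij f g gf fg = sum-bij f g gf fg (λ x → χ (P? x))

  module _ {P : Fin m → Set} {Q : Fin n → Set} (P? : Decidable P) (Q? : Decidable Q) where

    -- Double counting of the pairs (x , f x): each x of `P` lies on one pair, each y of `Q` on at
    -- most one.
    count-inj : (f : Fin m → Fin n) → (∀ x → P x → Q (f x)) →
                (∀ x y → P x → P y → f x ≡ f y → x ≡ y) → count P? ≤ count Q?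
    count-inj f pq inj = begin
      count P?                                           ≡⟨ sum-cong-≗ (λ x → sym (fibre x)) ⟩
      sum (λ x → count (λ y → P? x ×-dec (f x ≟F y)))    ≡⟨ ∑-comm (λ x y → χ (P? x ×-dec (f x ≟F y))) ⟩
      sum (λ y → count (λ x → P? x ×-dec (f x ≟F y)))    ≤⟨ sum-mono fibre≤ ⟩
      count Q?                                           ∎
      where
      open ℕ.≤-Reasoning
      fibre : ∀ x → count (λ y → P? x ×-dec (f x ≟F y)) ≡ χ (P? x)
      fibre x with P? x
      ... | yes p = count-single (λ y → yes p ×-dec (f x ≟F y)) (f x) (p , refl) λ y → sym ∘ proj₂
      ... | no ¬p = count-none (λ y → no ¬p ×-dec (f x ≟F y)) λ y → ¬p ∘ proj₁
      fibre≤ : ∀ y → count (λ x → P? x ×-dec (f x ≟F y)) ≤ χ (Q? y)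
      fibre≤ y with Q? y
      ... | yes q = count-unique (λ x → P? x ×-dec (f x ≟F y)) λ where
                      x x' (p , e) (p' , e') → inj x x' p p' (trans e (sym e'))
      ... | no ¬q = ℕ.≤-reflexive (count-none (λ x → P? x ×-dec (f x ≟F y)) λ where x (p , refl) → ¬q (pq x p))

  count-strict : {P Q : Fin n → Set} (P? : Decidable P) (Q? : Decidable Q) → (∀ x → P x → Q x) →
                 ∀ x → Q x → ¬ P x → count P? < count Q?
  count-strict P? Q? h x q ¬p = ℕ.≰⇒> λ e → ¬p (count-tight P? Q? h e x q)

  count-remove : {P : Fin n → Set} (P? : Decidable P) → ∀ x → P x → count P? ≡ suc (count (λ y → P? y ×-dec ¬? (y ≟F x)))
  count-remove P? x p = trans (count-split P? (_≟F x)) (cong (ℕ._+ count (λ y → P? y ×-dec ¬? (y ≟F x)))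
    (count-single (λ y → P? y ×-dec (y ≟F x)) x (p , refl) λ y → proj₂))

  -- A fourth element would survive the removal of x, y and z.
  exhaust₃ : {P : Fin n → Set} (P? : Decidable P) → count P? ≤ 3 → ∀ {x y z} → P x → P y → P z →
             y ≢ x → z ≢ x → z ≢ y → ∀ w → P w → w ≡ x ⊎ w ≡ y ⊎ w ≡ z
  exhaust₃ P? c≤3 {x} {y} {z} px py pz y≢x z≢x z≢y w pw with w ≟F x | w ≟F y | w ≟F z
  ... | yes e | _ | _ = inj₁ e
  ... | no _ | yes e | _ = inj₂ (inj₁ e)
  ... | no _ | no _ | yes e = inj₂ (inj₂ e)
  ... | no w≢x | no w≢y | no w≢z = contradiction (ℕ.≤-trans (ℕ.≤-reflexive (sym (trans (count-remove P? x px)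
        (cong suc (trans (count-remove P₁? y (py , y≢x)) (cong suc (count-remove P₂? z ((pz , z≢x) , z≢y)))))))) c≤3)
        λ where (s≤s (s≤s (s≤s h))) → ℕ.<⇒≱ (count>0 P₃? w (((pw , w≢x) , w≢y) , w≢z)) h
    where
    P₁? = λ v → P? v ×-dec ¬? (v ≟F x)
    P₂? = λ v → P₁? v ×-dec ¬? (v ≟F y)
    P₃? = λ v → P₂? v ×-dec ¬? (v ≟F z)

open Counting

-- Convolution on ℤ/m

-- q divides q! = C(q,k) k! (q-k)! but none of the factorials of smaller numbers.
prime∣binomial : ∀ {q} → Prime q → ∀ {k} → 0 < k → k < q → q ∣ q C k
prime∣binomial {q@(suc q-1)} pr {k} 0<k k<q =
  [ (λ h → h) , (λ h → contradiction h (∤k![q-k]!)) ]′ (euclidsLemma (q C k) d pr (subst (q ∣_) (sym q!-split) (m∣m*n (q-1 ℕ.!))))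
  where
  d = k ℕ.! ℕ.* (q ℕ.∸ k) ℕ.!
  instance
    _ = k ℕ.!* (q ℕ.∸ k) !≢0
  q!-split : (q C k) ℕ.* d ≡ q ℕ.!
  q!-split = trans (cong (ℕ._* d) (nCk≡n!/k![n-k]! (ℕ.<⇒≤ k<q))) (m/n*n≡m (k![n∸k]!∣n! (ℕ.<⇒≤ k<q)))
    where open import Data.Nat.DivMod using (m/n*n≡m)
  ∤! : ∀ j → j < q → ¬ q ∣ j ℕ.!
  ∤! zero _ h = ℕ.<⇒≱ (ℕ.nonTrivial⇒n>1 q {{prime⇒nonTrivial pr}}) (∣⇒≤ h)
  ∤! (suc j) j<q h with euclidsLemma (suc j) (j ℕ.!) pr h
  ... | inj₁ h′ = ℕ.<⇒≱ j<q (∣⇒≤ h′)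
  ... | inj₂ h′ = ∤! j (ℕ.<-trans (ℕ.n<1+n j) j<q) h′
  ∤k![q-k]! : ¬ q ∣ d
  ∤k![q-k]! h with euclidsLemma (k ℕ.!) _ pr h
  ... | inj₁ h′ = ∤! k k<q h′
  ... | inj₂ h′ = ∤! (q ℕ.∸ k) (ℕ.∸-monoʳ-< 0<k (ℕ.<⇒≤ k<q)) h′

module Freshman (S : CommutativeSemiring 0ℓ 0ℓ) (q : ℕ) (pr : Prime q) where
  open CommutativeSemiring S renaming (refl to ≈-refl; sym to ≈-sym; trans to ≈-trans)
  open import Algebra.Properties.Semiring.Mult semiring renaming (_×_ to _·_)
  open import Algebra.Properties.Semiring.Exp semiring
  open import Algebra.Properties.CommutativeSemiring.Binomial S
  open import Algebra.Properties.Semiring.Sum semiring using (sum-init-last; sum-cong-≋) renaming (sum to Σ; sum-replicate-zero to Σ-replicate-zero)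
  open import Relation.Binary.Reasoning.Setoid setoid

  module _ (char : q · 1# ≈ 0#) where

    private
      char-∣ : ∀ {c} x → q ∣ c → c · x ≈ 0#
      char-∣ {c} x (divides k refl) = begin
        (k ℕ.* q) · x           ≈⟨ ×-congʳ (k ℕ.* q) (*-identityˡ x) ⟨
        (k ℕ.* q) · (1# * x)    ≈⟨ ×-assoc-* (k ℕ.* q) 1# x ⟨
        ((k ℕ.* q) · 1#) * x    ≈⟨ *-congʳ (≈-trans (≈-sym (×-assocˡ 1# k q)) (×-congʳ k char)) ⟩
        (k · 0#) * x            ≈⟨ ×-assoc-* k 0# x ⟩
        k · (0# * x)            ≈⟨ ×-congʳ k (zeroˡ x) ⟩
        k · 0#                  ≈⟨ ×-zeroʳ k ⟩
        0#                      ∎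
        where
        ×-zeroʳ : ∀ k → k · 0# ≈ 0#
        ×-zeroʳ zero = ≈-refl
        ×-zeroʳ (suc k) = ≈-trans (+-identityˡ _) (×-zeroʳ k)

    -- All binomial coefficients except the outer two are divisible by q and so act as zero. This is
    -- used for functions under convolution modulo q and, in ℤ/p, for Fermat's theorem.
    freshman : ∀ x y → (x + y) ^ q ≈ x ^ q + y ^ q
    freshman x y = go q refl where
      go : ∀ n → n ≡ q → (x + y) ^ n ≈ x ^ n + y ^ n
      go zero e = contradiction e (λ h → ℕ.≢-nonZero⁻¹ q {{prime⇒nonZero pr}} (sym h))
      go (suc n) e = begin
        (x + y) ^ suc n                                                  ≈⟨ theorem (suc n) x y ⟩
        term Fin.zero + Σ (term ∘ Fin.suc)                                    ≈⟨ +-congˡ (sum-init-last (term ∘ Fin.suc)) ⟩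
        term Fin.zero + (Σ (term ∘ Fin.suc ∘ inject₁) + term (fromℕ (suc n)))    ≈⟨ +-cong first (+-cong middle last) ⟩
        y ^ suc n + (0# + x ^ suc n)                                     ≈⟨ ≈-trans (+-congˡ (+-identityˡ _)) (+-comm _ _) ⟩
        x ^ suc n + y ^ suc n                                            ∎
        where
        term : Fin (suc (suc n)) → Carrier
        term = binomialTerm x y (suc n)
        first : term Fin.zero ≈ y ^ suc n
        first = ≈-trans (+-identityʳ _) (*-identityˡ _)
        middle : Σ (term ∘ Fin.suc ∘ inject₁) ≈ 0#
        middle = ≈-trans (sum-cong-≋ λ i → char-∣ _ (subst (_∣ (suc n C suc (toℕ (inject₁ i)))) e
          (prime∣binomial (subst Prime (sym e) pr) (s≤s z≤n) (s≤s (ℕ.<-≤-trans (ℕ.≤-reflexive (cong suc (toℕ-inject₁ i))) (toℕ<n i))))))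
          (Σ-replicate-zero n)
        last : term (fromℕ (suc n)) ≈ x ^ suc n
        last rewrite toℕ-fromℕ n | nCn≡1 (suc n) | ℕ.n∸n≡0 n = ≈-trans (+-identityʳ _) (*-identityʳ _)

module Convolution (m : ℕ) .{{_ : NonZero m}} where
  open ZMod m
  open CommutativeRing commutativeRing using (+-identityʳ; -‿inverseʳ)
  open IntSolver commutativeRing

  sum-reflect : ∀ z (h : F → ℕ) → sum (λ w → h (z - w)) ≡ sum h
  sum-reflect z h = sum-bij (λ w → z - w) (λ w → z - w) inv inv h
    where
    inv : ∀ w → z - (z - w) ≡ w
    inv w = solve 2 (λ z w → z :- (z :- w) := w) refl z w

  sum-translate : ∀ a (h : F → ℕ) → sum (λ w → h (w + a)) ≡ sum h
  sum-translate a h = sum-bij (_+ a) (λ w → w - a)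
    (λ w → solve 2 (λ w a → (w :+ a) :- a := w) refl w a)
    (λ w → solve 2 (λ w a → (w :- a) :+ a := w) refl w a) h

  sum-negate : ∀ (h : F → ℕ) → sum (λ w → h (- w)) ≡ sum h
  sum-negate h = sum-bij (λ w → - w) (λ w → - w) inv inv h
    where
    inv : ∀ w → - - w ≡ w
    inv w = solve 1 (λ w → :- (:- w) := w) refl w

  infixl 7 _⋆_
  _⋆_ : (F → ℕ) → (F → ℕ) → F → ℕ
  (f ⋆ g) z = sum λ w → f w ℕ.* g (z - w)

  δ : F → F → ℕ
  δ a x = χ (a ≟F x)

  ⋆-cong : ∀ {f f′ g g′} → (∀ x → f x ≡ f′ x) → (∀ x → g x ≡ g′ x) → ∀ z → (f ⋆ g) z ≡ (f′ ⋆ g′) z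
  ⋆-cong ff gg z = sum-cong-≗ λ w → cong₂ ℕ._*_ (ff w) (gg (z - w))

  ⋆-comm : ∀ f g z → (f ⋆ g) z ≡ (g ⋆ f) z
  ⋆-comm f g z = trans (sym (sum-reflect z (λ w → f w ℕ.* g (z - w))))
    (sum-cong-≗ λ w → trans (ℕ.*-comm (f (z - w)) _)
      (cong (λ v → g v ℕ.* f (z - w)) (solve 2 (λ z w → z :- (z :- w) := w) refl z w)))

  ⋆-assoc : ∀ f g h z → ((f ⋆ g) ⋆ h) z ≡ (f ⋆ (g ⋆ h)) z
  ⋆-assoc f g h z = begin
    sum (λ y → sum (λ w → f w ℕ.* g (y - w)) ℕ.* h (z - y))
      ≡⟨ sum-cong-≗ (λ y → *-distribʳ-sum (h (z - y)) (λ w → f w ℕ.* g (y - w))) ⟩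
    sum (λ y → sum (λ w → f w ℕ.* g (y - w) ℕ.* h (z - y)))
      ≡⟨ ∑-comm (λ y w → f w ℕ.* g (y - w) ℕ.* h (z - y)) ⟩
    sum (λ w → sum (λ y → f w ℕ.* g (y - w) ℕ.* h (z - y)))
      ≡⟨ sum-cong-≗ inner ⟩
    sum (λ w → f w ℕ.* (g ⋆ h) (z - w)) ∎
    where
    open ≡-Reasoning
    inner : ∀ w → sum (λ y → f w ℕ.* g (y - w) ℕ.* h (z - y)) ≡ f w ℕ.* (g ⋆ h) (z - w)
    inner w = begin
      sum (λ y → f w ℕ.* g (y - w) ℕ.* h (z - y))
        ≡⟨ sum-translate w (λ y → f w ℕ.* g (y - w) ℕ.* h (z - y)) ⟨
      sum (λ y → f w ℕ.* g (y + w - w) ℕ.* h (z - (y + w)))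
        ≡⟨ sum-cong-≗ (λ y → trans (cong₂ (λ u v → f w ℕ.* g u ℕ.* h v)
             (solve 2 (λ w y → (y :+ w) :- w := y) refl w y)
             (solve 3 (λ z w y → z :- (y :+ w) := (z :- w) :- y) refl z w y)) (ℕ.*-assoc (f w) _ _)) ⟩
      sum (λ y → f w ℕ.* (g y ℕ.* h (z - w - y)))
        ≡⟨ *-distribˡ-sum (f w) (λ y → g y ℕ.* h (z - w - y)) ⟨
      f w ℕ.* (g ⋆ h) (z - w) ∎

  ⋆-identityˡ : ∀ f z → (δ 0# ⋆ f) z ≡ f z
  ⋆-identityˡ f z = begin
    sum (λ w → δ 0# w ℕ.* f (z - w))
      ≡⟨ sum-single 0# (λ w w≢0 → cong (ℕ._* f (z - w)) (χ-no (0# ≟F w) (w≢0 ∘ sym))) ⟩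
    δ 0# 0# ℕ.* f (z - 0#)
      ≡⟨ cong₂ ℕ._*_ (χ-yes (0# ≟F 0#) refl) (cong f (solve 1 (λ z → z :- nat 0 := z) refl z)) ⟩
    1 ℕ.* f z
      ≡⟨ ℕ.*-identityˡ _ ⟩
    f z ∎
    where open ≡-Reasoning

  ⋆-distribˡ : ∀ f g h z → (f ⋆ (λ x → g x ℕ.+ h x)) z ≡ (f ⋆ g) z ℕ.+ (f ⋆ h) z
  ⋆-distribˡ f g h z = trans (sum-cong-≗ λ w → ℕ.*-distribˡ-+ (f w) _ _)
    (∑-distrib-+ (λ w → f w ℕ.* g (z - w)) (λ w → f w ℕ.* h (z - w)))

  ⋆-zeroˡ : ∀ f z → ((λ _ → 0) ⋆ f) z ≡ 0
  ⋆-zeroˡ f z = sum-zero {m} λ w → refl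

  δ-⋆ : ∀ a b z → (δ a ⋆ δ b) z ≡ δ (a + b) z
  δ-⋆ a b z = begin
    sum (λ w → δ a w ℕ.* δ b (z - w))
      ≡⟨ sum-single a (λ w w≢a → cong (ℕ._* δ b (z - w)) (χ-no (a ≟F w) (w≢a ∘ sym))) ⟩
    δ a a ℕ.* δ b (z - a)
      ≡⟨ cong (ℕ._* δ b (z - a)) (χ-yes (a ≟F a) refl) ⟩
    1 ℕ.* δ b (z - a)
      ≡⟨ ℕ.*-identityˡ _ ⟩
    δ b (z - a)
      ≡⟨ χ-cong (b ≟F z - a) (a + b ≟F z)
           (λ e → trans (cong (a +_) e) (solve 2 (λ z a → a :+ (z :- a) := z) refl z a))
           (λ e → trans (solve 2 (λ a b → b := (a :+ b) :- a) refl a b) (cong (λ v → v - a) e)) ⟩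
    δ (a + b) z ∎
    where open ≡-Reasoning

  ⋆-interchange : ∀ f g h l z → ((f ⋆ g) ⋆ (h ⋆ l)) z ≡ ((f ⋆ h) ⋆ (g ⋆ l)) z
  ⋆-interchange = interchange (record
    { Carrier = F → ℕ ; _≈_ = _≗_ ; _∙_ = _⋆_
    ; isCommutativeSemigroup = record
      { isSemigroup = record
        { isMagma = record
          { isEquivalence = record { refl = λ _ → refl ; sym = λ e x → sym (e x) ; trans = λ e e′ x → trans (e x) (e′ x) }
          ; ∙-cong = ⋆-cong }
        ; assoc = ⋆-assoc }
      ; comm = ⋆-comm } })
    where open import Algebra.Properties.CommutativeSemigroup using (interchange)

  reflect : (F → ℕ) → F → ℕ
  reflect f x = f (- x)

  ⟨_∙_⟩ : (F → ℕ) → (F → ℕ) → ℕ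
  ⟨ f ∙ g ⟩ = sum λ z → f z ℕ.* g z

  reflect-⋆ : ∀ f g z → reflect (f ⋆ g) z ≡ (reflect f ⋆ reflect g) z
  reflect-⋆ f g z = trans (sym (sum-negate (λ w → f w ℕ.* g (- z - w))))
    (sum-cong-≗ λ w → cong (λ v → f (- w) ℕ.* g v) (solve 2 (λ z w → (:- z) :- (:- w) := :- (z :- w)) refl z w))

  inner≡⋆ : ∀ f g → ⟨ f ∙ g ⟩ ≡ (f ⋆ reflect g) 0#
  inner≡⋆ f g = sum-cong-≗ λ w → cong (λ v → f w ℕ.* g v) (solve 1 (λ w → w := :- (nat 0 :- w)) refl w)

  -- Both sides count the solutions of a + b = c + d, that is of a - c = - b + d.
  exchange : ∀ f g h l → ⟨ f ⋆ g ∙ h ⋆ l ⟩ ≡ ⟨ f ⋆ reflect h ∙ reflect g ⋆ l ⟩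
  exchange f g h l = begin
    ⟨ f ⋆ g ∙ h ⋆ l ⟩                                 ≡⟨ inner≡⋆ (f ⋆ g) (h ⋆ l) ⟩
    ((f ⋆ g) ⋆ reflect (h ⋆ l)) 0#                     ≡⟨ ⋆-cong {f ⋆ g} (λ _ → refl) (reflect-⋆ h l) 0# ⟩
    ((f ⋆ g) ⋆ (reflect h ⋆ reflect l)) 0#             ≡⟨ ⋆-interchange f g (reflect h) (reflect l) 0# ⟩
    ((f ⋆ reflect h) ⋆ (g ⋆ reflect l)) 0#             ≡⟨ ⋆-cong {f ⋆ reflect h} (λ _ → refl) unreflect 0# ⟩
    ((f ⋆ reflect h) ⋆ reflect (reflect g ⋆ l)) 0#     ≡⟨ inner≡⋆ (f ⋆ reflect h) (reflect g ⋆ l) ⟨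
    ⟨ f ⋆ reflect h ∙ reflect g ⋆ l ⟩                 ∎
    where
    open ≡-Reasoning
    unreflect : ∀ z → (g ⋆ reflect l) z ≡ reflect (reflect g ⋆ l) z
    unreflect z = trans (⋆-cong {g} {reflect (reflect g)} {reflect l} {reflect l} (λ x → cong g (solve 1 (λ x → x := :- (:- x)) refl x)) (λ _ → refl) z)
      (sym (reflect-⋆ (reflect g) l z))

  sum-⋆ : ∀ f g → sum (f ⋆ g) ≡ sum f ℕ.* sum g
  sum-⋆ f g = begin
    sum (λ z → sum (λ w → f w ℕ.* g (z - w)))   ≡⟨ ∑-comm (λ z w → f w ℕ.* g (z - w)) ⟩
    sum (λ w → sum (λ z → f w ℕ.* g (z - w)))   ≡⟨ sum-cong-≗ (λ w → trans (sym (*-distribˡ-sum (f w) (λ z → g (z - w)))) (cong (f w ℕ.*_) (sum-translate (- w) g))) ⟩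
    sum (λ w → f w ℕ.* sum g)                     ≡⟨ *-distribʳ-sum (sum g) f ⟨
    sum f ℕ.* sum g                               ∎
    where open ≡-Reasoning

  -- The group ring of ℤ/m modulo q. Only equality is reduced modulo q; the operations remain those
  -- on functions to ℕ, so the exact identities above carry over through `cong (_% q)`.
  convSemiring : (q : ℕ) .{{_ : NonZero q}} → CommutativeSemiring 0ℓ 0ℓ
  convSemiring q = record
    { Carrier = F → ℕ
    ; _≈_ = _≈_
    ; _+_ = λ f g x → f x ℕ.+ g x
    ; _*_ = _⋆_
    ; 0# = λ _ → 0
    ; 1# = δ 0#
    ; isCommutativeSemiring = record
      { isSemiring = record
        { isSemiringWithoutAnnihilatingZero = record
          { +-isCommutativeMonoid = record
            { isMonoid = record
              { isSemigroup = record
                { isMagma = record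
                  { isEquivalence = ≈-equiv
                  ; ∙-cong = λ ff gg x → +-cong-% (ff x) (gg x) }
                ; assoc = λ f g h x → cong (_% q) (ℕ.+-assoc (f x) (g x) (h x)) }
              ; identity = (λ f x → refl) , λ f x → cong (_% q) (ℕ.+-identityʳ (f x)) }
            ; comm = λ f g x → cong (_% q) (ℕ.+-comm (f x) (g x)) }
          ; *-cong = λ {f} {f′} {g} {g′} ff gg z → sum-cong-% λ w → *-cong-% (ff w) (gg (z - w))
          ; *-assoc = λ f g h z → cong (_% q) (⋆-assoc f g h z)
          ; *-identity = (λ f z → cong (_% q) (⋆-identityˡ f z)) ,
                         λ f z → cong (_% q) (trans (⋆-comm f (δ 0#) z) (⋆-identityˡ f z))
          ; distrib = (λ f g h z → cong (_% q) (⋆-distribˡ f g h z)) ,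
                      λ f g h z → cong (_% q) (trans (⋆-comm (λ x → g x ℕ.+ h x) f z)
                        (trans (⋆-distribˡ f g h z) (cong₂ ℕ._+_ (⋆-comm f g z) (⋆-comm f h z)))) }
        ; zero = (λ f z → cong (_% q) (⋆-zeroˡ f z)) ,
                 λ f z → cong (_% q) (trans (⋆-comm f (λ _ → 0) z) (⋆-zeroˡ f z)) }
      ; *-comm = λ f g z → cong (_% q) (⋆-comm f g z) }
    }
    where
    _≈_ : (F → ℕ) → (F → ℕ) → Set
    f ≈ g = ∀ x → f x % q ≡ g x % q
    ≈-equiv : IsEquivalence _≈_
    ≈-equiv = record { refl = λ x → refl ; sym = λ e x → sym (e x) ; trans = λ e e′ x → trans (e x) (e′ x) }
    +-cong-% : ∀ {a a′ b b′} → a % q ≡ a′ % q → b % q ≡ b′ % q → (a ℕ.+ b) % q ≡ (a′ ℕ.+ b′) % q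
    +-cong-% {a} {a′} {b} {b′} e e′ = trans (%-distribˡ-+ a b q)
      (trans (cong₂ (λ u v → (u ℕ.+ v) % q) e e′) (sym (%-distribˡ-+ a′ b′ q)))
    *-cong-% : ∀ {a a′ b b′} → a % q ≡ a′ % q → b % q ≡ b′ % q → (a ℕ.* b) % q ≡ (a′ ℕ.* b′) % q
    *-cong-% {a} {a′} {b} {b′} e e′ = trans (%-distribˡ-* a b q)
      (trans (cong₂ (λ u v → (u ℕ.* v) % q) e e′) (sym (%-distribˡ-* a′ b′ q)))
    sum-cong-% : ∀ {n} {s t : Fin n → ℕ} → (∀ i → s i % q ≡ t i % q) → sum s % q ≡ sum t % q
    sum-cong-% {zero} e = refl
    sum-cong-% {suc n} {s} {t} e = +-cong-% {s Fin.zero} (e Fin.zero) (sum-cong-% {n} (e ∘ Fin.suc))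

  infixr 8 _⋆^_
  _⋆^_ : (F → ℕ) → ℕ → F → ℕ
  f ⋆^ zero = δ 0#
  f ⋆^ suc n = f ⋆ f ⋆^ n

  infixr 7 _·_
  _·_ : ℕ → F → F
  zero · x = 0#
  suc n · x = x + n · x

  -- The q-th convolution power of an indicator counts q-th multiples modulo q.
  frobenius : ∀ {q} (pr : Prime q) .{{_ : NonZero q}} {T : F → Set} (T? : ∀ x → Dec (T x)) → ∀ z →
    ((λ x → χ (T? x)) ⋆^ q) z % q ≡ count (λ a → T? a ×-dec (q · a ≟F z)) % q
  frobenius {q} pr {T} T? z = begin
    (t ⋆^ q) z % q                                  ≡⟨ ⋆^≡^ t q z ⟩
    (t ^ q) z % q                                   ≡⟨ ^-congˡ q (λ x → cong (_% q) (expand x)) z ⟩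
    (Σ (λ a → t a ⟨·⟩ δ a) ^ q) z % q               ≡⟨ power (λ a → t a ⟨·⟩ δ a) z ⟩
    Σ (λ a → (t a ⟨·⟩ δ a) ^ q) z % q               ≡⟨ Σ-cong (λ a → term a) z ⟩
    Σ (λ a → t a ⟨·⟩ δ (q · a)) z % q               ≡⟨ cong (_% q) (Σ-apply (λ a → t a ⟨·⟩ δ (q · a)) z) ⟩
    sum (λ a → t a ℕ.* δ (q · a) z) % q             ≡⟨ cong (_% q) (sum-cong-≗ λ a → sym (χ-× (T? a) (q · a ≟F z))) ⟩
    count (λ a → T? a ×-dec (q · a ≟F z)) % q ∎
    where
    open ≡-Reasoning
    S = convSemiring q
    module S = CommutativeSemiring S
    open import Algebra.Properties.Semiring.Exp S.semiring using (_^_; ^-congˡ)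
    open import Algebra.Properties.Semiring.Sum S.semiring using () renaming (sum to Σ; sum-cong-≋ to Σ-cong)
    open import Algebra.Properties.Semiring.Mult S.semiring using () renaming (_×_ to _·ᶠ_)
    t : F → ℕ
    t x = χ (T? x)
    _⟨·⟩_ : ℕ → (F → ℕ) → F → ℕ
    (c ⟨·⟩ f) x = c ℕ.* f x
    ⋆^≡^ : ∀ f n → (f ⋆^ n) S.≈ (f ^ n)
    ⋆^≡^ f zero = S.refl {δ 0#}
    ⋆^≡^ f (suc n) = S.*-cong {f} {f} {f ⋆^ n} {f ^ n} (S.refl {f}) (⋆^≡^ f n)
    Σ-apply : ∀ {n} (f : Fin n → F → ℕ) x → Σ f x ≡ sum (λ i → f i x)
    Σ-apply {zero} f x = refl
    Σ-apply {suc n} f x = cong (f Fin.zero x ℕ.+_) (Σ-apply (f ∘ Fin.suc) x)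
    expand : ∀ x → t x ≡ Σ (λ a → t a ⟨·⟩ δ a) x
    expand x = sym (trans (Σ-apply (λ a → t a ⟨·⟩ δ a) x)
      (trans (sum-single x λ a a≢x → trans (cong (t a ℕ.*_) (χ-no (a ≟F x) a≢x)) (ℕ.*-zeroʳ (t a)))
        (trans (cong (t x ℕ.*_) (χ-yes (x ≟F x) refl)) (ℕ.*-identityʳ (t x)))))
    char : (q ·ᶠ δ 0#) S.≈ (λ _ → 0)
    char x = trans (cong (_% q) (apply q)) (trans (cong (_% q) (ℕ.*-comm q (δ 0# x))) (kq% (δ 0# x)))
      where
      open import Data.Nat.DivMod using (m*n%n≡0)
      apply : ∀ n → (n ·ᶠ δ 0#) x ≡ n ℕ.* δ 0# x
      apply zero = refl
      apply (suc n) = cong (δ 0# x ℕ.+_) (apply n)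
      kq% : ∀ k → (k ℕ.* q) % q ≡ 0 % q
      kq% k = trans (m*n%n≡0 k q) (sym (m<n⇒m%n≡m (ℕ.>-nonZero⁻¹ q)))
    zero-power : ∀ n → n ≢ 0 → ((λ _ → 0) ^ n) S.≈ (λ _ → 0)
    zero-power zero h = contradiction refl h
    zero-power (suc n) _ = S.zeroˡ ((λ _ → 0) ^ n)
    q≢0 : q ≢ 0
    q≢0 = ℕ.≢-nonZero⁻¹ q
    power : ∀ {n} (f : Fin n → F → ℕ) → (Σ f ^ q) S.≈ Σ (λ i → f i ^ q)
    power {zero} f = zero-power q q≢0
    power {suc n} f = S.trans {Σ f ^ q} {λ x → (f Fin.zero ^ q) x ℕ.+ (Σ (f ∘ Fin.suc) ^ q) x}
      (Freshman.freshman S q pr char (f Fin.zero) (Σ (f ∘ Fin.suc)))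
      (S.+-cong {f Fin.zero ^ q} (S.refl {f Fin.zero ^ q}) (power (f ∘ Fin.suc)))
    δ-power : ∀ a n → (δ a ^ n) S.≈ δ (n · a)
    δ-power a zero = S.refl {δ 0#}
    δ-power a (suc n) = S.trans {δ a ⋆ (δ a ^ n)} {δ a ⋆ δ (n · a)}
      (S.*-cong {δ a} (S.refl {δ a}) (δ-power a n)) (λ z → cong (_% q) (δ-⋆ a (n · a) z))
    -- The coefficient is 0 or 1 and equals its own q-th power; only the point mass moves, from a to
    -- `q · a`.
    term : ∀ a → ((t a ⟨·⟩ δ a) ^ q) S.≈ (t a ⟨·⟩ δ (q · a))
    term a with T? a
    ... | yes _ = S.trans {(1 ⟨·⟩ δ a) ^ q} {δ a ^ q} (^-congˡ q (λ x → cong (_% q) (ℕ.*-identityˡ (δ a x))))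
                    (S.trans {δ a ^ q} (δ-power a q) λ x → cong (_% q) (sym (ℕ.*-identityˡ (δ (q · a) x))))
    ... | no _ = zero-power q q≢0

-- Two-way distances

∧-true⁺ : ∀ {a b} → a ≡ true → b ≡ true → a ∧ b ≡ true
∧-true⁺ refl refl = refl

∧-true⁻ : ∀ {a b} → a ∧ b ≡ true → a ≡ true × b ≡ true
∧-true⁻ {true} {true} _ = refl , refl

module _ {A : Set} (p : A → Bool) where
  any-true⁺ : ∀ {x xs} → x ∈L xs → p x ≡ true → any p xs ≡ true
  any-true⁺ x∈xs e = Equivalence.to T-≡ (any⁺ p (lose x∈xs (Equivalence.from T-≡ e)))

  any-true⁻ : ∀ xs → any p xs ≡ true → ∃ λ x → x ∈L xs × p x ≡ true
  any-true⁻ xs e with find (any⁻ p xs (Equivalence.from T-≡ e))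
  ... | x , x∈xs , t = x , x∈xs , Equivalence.to T-≡ t

isYes-true⁺ : ∀ {A : Set} (d : Dec A) → A → isYes d ≡ true
isYes-true⁺ (yes _) a = refl
isYes-true⁺ (no ¬a) a = contradiction a ¬a

isYes-true⁻ : ∀ {A : Set} (d : Dec A) → isYes d ≡ true → A
isYes-true⁻ (yes a) _ = a

countB≡count : ∀ {n} (f : Fin n → Bool) → countB f ≡ count (λ x → f x Bool.≟ true)
countB≡count {zero} f = refl
countB≡count {suc n} f = cong₂ ℕ._+_ (go (f Fin.zero)) (countB≡count (f ∘ Fin.suc))
  where
  go : ∀ b → (Bool.if b then 1 else 0) ≡ χ (b Bool.≟ true)
  go true = refl
  go false = refl

leastTrue : (P : ℕ → Bool) → ∀ k → P k ≡ true → ∃ λ j → P j ≡ true × (∀ i → P i ≡ true → j ≤ i)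
leastTrue P k h with P zero in e
... | true = zero , e , λ _ _ → z≤n
leastTrue P zero h | false = contradiction (trans (sym e) h) λ ()
leastTrue P (suc k) h | false with leastTrue (P ∘ suc) k h
... | j , pj , least = suc j , pj , λ where
  zero p → contradiction (trans (sym e) p) λ ()
  (suc i) p → s≤s (least i p)

module Distance (m : ℕ) .{{_ : NonZero m}} where
  open ZMod m
  open CommutativeRing commutativeRing using (-‿inverseʳ; +-identityˡ; +-identityʳ; +-comm; +-assoc)
  open IntSolver commutativeRing

  -- Characterises word length over `S`: `d-step` bounds it from above and `d-pred` supplies a
  -- geodesic. As `d` has a natural value everywhere, strong connectivity is included.
  record IsDistance (S : F → Set) (d : F → ℕ) : Set where
    field
      d0 : d 0# ≡ 0
      d≡0 : ∀ x → d x ≡ 0 → x ≡ 0#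
      d-step : ∀ s x → S s → d (s + x) ≤ suc (d x)
      d-pred : ∀ x n → d x ≡ suc n → ∃₂ λ s z → S s × d z ≡ n × x ≡ s + z

    triangle : ∀ x y → d (x + y) ≤ d x ℕ.+ d y
    triangle x y = go (d x) x refl
      where
      go : ∀ n x → d x ≡ n → d (x + y) ≤ n ℕ.+ d y
      go zero x e = ℕ.≤-reflexive (cong d (trans (cong (_+ y) (d≡0 x e)) (+-identityˡ y)))
      go (suc n) x e with d-pred x n e
      ... | s , z , Ss , dz , refl = ℕ.≤-trans
        (ℕ.≤-reflexive (cong d (+-assoc s z y))) (ℕ.≤-trans (d-step s (z + y) Ss) (s≤s (go n z dz)))

    d≡1⇒S : ∀ s → d s ≡ 1 → S s
    d≡1⇒S s e with d-pred s 0 e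
    ... | s′ , z , Ss , dz , refl = subst S (trans (sym (+-identityʳ s′)) (cong (s′ +_) (sym (d≡0 z dz)))) Ss

    S⇒d≡1 : ∀ s → ¬ S 0# → S s → d s ≡ 1
    S⇒d≡1 s ¬S0 Ss with d s in e
    ... | zero = contradiction (subst S (d≡0 s e) Ss) ¬S0
    ... | suc zero = refl
    ... | suc (suc k) = contradiction
      (ℕ.≤-trans (ℕ.≤-reflexive (trans (sym e) (cong d (sym (+-identityʳ s))))) (ℕ.≤-trans (d-step s 0# Ss) (s≤s (ℕ.≤-reflexive d0))))
      λ where (s≤s ())

  module TwoWay (d : F → ℕ) where
    τ : F → ℕ × ℕ
    τ x = d x , d (- x)

    infix 4 _≟τ_
    _≟τ_ : (a b : ℕ × ℕ) → Dec (a ≡ b)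
    _≟τ_ = ≡-dec ℕ._≟_ ℕ._≟_

    inter : F → ℕ × ℕ → ℕ × ℕ → ℕ
    inter z a b = count (λ w → (τ w ≟τ a) ×-dec (τ (z - w) ≟τ b))

    -- By translation invariance a pair of vertices matters only through its difference, so the
    -- axiom on intersection numbers shrinks to a condition on `τ z`.
    record IsScheme : Set where
      field
        d0 : d 0# ≡ 0
        d≡0 : ∀ x → d x ≡ 0 → x ≡ 0#
        scheme : ∀ z z′ a b → τ z ≡ τ z′ → inter z a b ≡ inter z′ a b

    -- The setting in prime order, after an arc without reverse has been rescaled to 1. Arcs are the
    -- elements with `d x ≡ 1`, and `mult` is the multiplier theorem, which from there on takes the
    -- place of the scheme axiom.
    record IsSkew : Set where
      field
        d0 : d 0# ≡ 0
        d≡0 : ∀ x → d x ≡ 0 → x ≡ 0#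
        triangle : ∀ x y → d (x + y) ≤ d x ℕ.+ d y
        d-pred : ∀ x n → d x ≡ suc n → ∃₂ λ s z → d s ≡ 1 × d z ≡ n × x ≡ s + z
        mult : ∀ x y v → v ≢ 0# → τ x ≡ τ y → τ (v * x) ≡ τ (v * y)
        d1 : d 1# ≡ 1
        d-1 : d (- 1#) ≢ 1

  module Transport {n : ℕ} (adj : Fin n → Fin n → Bool) (f : Fin n ↔ F) (S : F → Set)
    (arc : ∀ x y → (adj x y ≡ true) ⇔ S (Inverse.to f y - Inverse.to f x)) where

    private
      to = Inverse.to f
      from = Inverse.from f

      to-from : ∀ x → to (from x) ≡ x
      to-from x = Inverse.inverseˡ f refl

      from-to : ∀ x → from (to x) ≡ x
      from-to x = Inverse.inverseʳ f refl

      to-injective : ∀ {x y} → to x ≡ to y → x ≡ y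
      to-injective {x} {y} e = trans (sym (from-to x)) (trans (cong from e) (from-to y))

    infix 9 _⟶_
    _⟶_ : Fin n → Fin n → F
    x ⟶ y = to y - to x

    private
      ⟶-trans : ∀ x y z → x ⟶ y + y ⟶ z ≡ x ⟶ z
      ⟶-trans x y z = solve 3 (λ x y z → (y :- x) :+ (z :- y) := z :- x) refl (to x) (to y) (to z)

      ⟶-neg : ∀ x y → y ⟶ x ≡ - (x ⟶ y)
      ⟶-neg x y = solve 2 (λ x y → x :- y := :- (y :- x)) refl (to x) (to y)

      ⟶-refl : ∀ x → x ⟶ x ≡ 0#
      ⟶-refl x = -‿inverseʳ (to x)

      ⟶-zero : ∀ x y → x ⟶ y ≡ 0# → x ≡ y
      ⟶-zero x y e = to-injective (trans (solve 2 (λ x y → x := y :- (y :- x)) refl (to x) (to y))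
        (trans (cong (λ v → to y - v) e) (solve 1 (λ y → y :- nat 0 := y) refl (to y))))

      head : Fin n → F → Fin n
      head x s = from (to x + s)

      ⟶-head : ∀ x s → x ⟶ head x s ≡ s
      ⟶-head x s = trans (cong (_- to x) (to-from (to x + s))) (solve 2 (λ x s → (x :+ s) :- x := s) refl (to x) s)

      tail : ∀ x y {s z} → x ⟶ y ≡ s + z → head x s ⟶ y ≡ z
      tail x y {s} {z} e = trans (cong (λ v → to y - v) (to-from (to x + s)))
        (trans (solve 3 (λ x y s → y :- (x :+ s) := (y :- x) :- s) refl (to x) (to y) s)
          (trans (cong (_- s) e) (solve 2 (λ s z → (s :+ z) :- s := z) refl s z)))

    module _ {d : F → ℕ} (isDistance : IsDistance S d) where
      open IsDistance isDistance
      open TwoWay d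

      walk⇒d≤ : ∀ k x y → walk adj k x y ≡ true → d (x ⟶ y) ≤ k
      walk⇒d≤ zero x y e with refl ← isYes-true⁻ (x ≟F y) e = ℕ.≤-reflexive (trans (cong d (⟶-refl x)) d0)
      walk⇒d≤ (suc k) x y e with any-true⁻ (λ z → adj x z ∧ walk adj k z y) (allFin n) e
      ... | z , _ , t with ∧-true⁻ {adj x z} t
      ...   | xz , zy = ℕ.≤-trans (ℕ.≤-reflexive (cong d (sym (⟶-trans x z y))))
        (ℕ.≤-trans (d-step _ _ (Equivalence.to (arc x z) xz)) (s≤s (walk⇒d≤ k z y zy)))

      walk-d : ∀ k x y → d (x ⟶ y) ≡ k → walk adj k x y ≡ true
      walk-d zero x y e = isYes-true⁺ (x ≟F y) (⟶-zero x y (d≡0 _ e))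
      walk-d (suc k) x y e with d-pred _ k e
      ... | s , z , Ss , dz , eq = any-true⁺ (λ v → adj x v ∧ walk adj k v y) (∈-allFin (head x s))
        (∧-true⁺ (Equivalence.from (arc x (head x s)) (subst S (sym (⟶-head x s)) Ss))
          (walk-d k (head x s) y (trans (cong d (tail x y eq)) dz)))

      isDist⁺ : ∀ x y → isDist adj x y (d (x ⟶ y)) ≡ true
      isDist⁺ x y = ∧-true⁺ (walk-d _ x y refl) (cong not (¬-not λ e → absurd (any-true⁻ (λ k → walk adj k x y) _ e)))
        where
        absurd : ¬ ∃ λ k → k ∈L upTo (d (x ⟶ y)) × walk adj k x y ≡ true
        absurd (k , k∈ , w) = ℕ.<⇒≱ (∈-upTo⁻ k∈) (walk⇒d≤ k x y w)

      isDist⁻ : ∀ x y i → isDist adj x y i ≡ true → i ≡ d (x ⟶ y)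
      isDist⁻ x y i e with ∧-true⁻ {walk adj i x y} e
      ... | w , no-shorter with ℕ.m≤n⇒m<n∨m≡n (walk⇒d≤ i x y w)
      ...   | inj₂ eq = sym eq
      ...   | inj₁ lt = contradiction (any-true⁺ (λ k → walk adj k x y) (∈-upTo⁺ lt) (walk-d _ x y refl))
                (not-¬ (no-shorter′ no-shorter))
        where
        no-shorter′ : ∀ {b} → not b ≡ true → b ≡ false
        no-shorter′ {false} _ = refl

      TDist⁺ : ∀ x y → TDist adj x y (τ (x ⟶ y))
      TDist⁺ x y = ∧-true⁺ (isDist⁺ x y) (subst (λ v → isDist adj y x (d v) ≡ true) (⟶-neg x y) (isDist⁺ y x))

      TDist⁻ : ∀ x y h → TDist adj x y h → h ≡ τ (x ⟶ y)
      TDist⁻ x y (i , j) e with ∧-true⁻ {isDist adj x y i} e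
      ... | p , q = cong₂ _,_ (isDist⁻ x y i p) (trans (isDist⁻ y x j q) (cong d (⟶-neg x y)))

      TDist-≡ : ∀ x y {h} → τ (x ⟶ y) ≡ h → TDist adj x y h
      TDist-≡ x y refl = TDist⁺ x y

      interCount≡inter : ∀ x y a b → interCount adj x y a b ≡ inter (x ⟶ y) a b
      interCount≡inter x y a b = begin
        interCount adj x y a b
          ≡⟨ countB≡count (λ z → isTDist adj x z a ∧ isTDist adj z y b) ⟩
        count (λ z → (isTDist adj x z a ∧ isTDist adj z y b) Bool.≟ true)
          ≡⟨ count-cong (λ z → (isTDist adj x z a ∧ isTDist adj z y b) Bool.≟ true) (λ z → Q? (x ⟶ z))
               (λ z e → let p , q = ∧-true⁻ {isTDist adj x z a} e in
                 sym (TDist⁻ x z a p) , trans (cong τ (sym (rest z))) (sym (TDist⁻ z y b q)))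
               (λ z (p , q) → ∧-true⁺ (TDist-≡ x z p) (TDist-≡ z y (trans (cong τ (rest z)) q))) ⟩
        count (λ z → Q? (x ⟶ z))
          ≡⟨ count-bij Q? (x ⟶_) (head x)
               (λ z → to-injective (trans (to-from _) (solve 2 (λ x z → x :+ (z :- x) := z) refl (to x) (to z))))
               (⟶-head x) ⟩
        inter (x ⟶ y) a b ∎
        where
        open ≡-Reasoning
        Q? : ∀ w → Dec (τ w ≡ a × τ (x ⟶ y - w) ≡ b)
        Q? w = (τ w ≟τ a) ×-dec (τ (x ⟶ y - w) ≟τ b)
        rest : ∀ z → z ⟶ y ≡ x ⟶ y - x ⟶ z
        rest z = solve 3 (λ x y z → y :- z := (y :- x) :- (z :- x)) refl (to x) (to y) (to z)

      τ-swap : ∀ x → τ (- x) ≡ (d (- x) , d x)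
      τ-swap x = cong (λ v → d (- x) , d v) (solve 1 (λ x → :- (:- x) := x) refl x)

      τ-involutive : ∀ x {i j} → τ x ≡ (i , j) → τ (- x) ≡ (j , i)
      τ-involutive x refl = τ-swap x

      stronglyConnected : StronglyConnected adj
      stronglyConnected x y = d (x ⟶ y) , walk-d _ x y refl

      associationScheme : (∀ z z′ a b → τ z ≡ τ z′ → inter z a b ≡ inter z′ a b) → IsAssociationScheme adj
      associationScheme scheme =
        (λ x y → (λ where refl → TDist-≡ x x {0 , 0} (trans (cong τ (⟶-refl x)) τ0)) ,
                 λ t → ⟶-zero x y (d≡0 _ (sym (cong proj₁ (TDist⁻ x y (0 , 0) t))))) ,
        (λ x y (i , j) t → TDist-≡ y x {j , i} (trans (cong τ (⟶-neg x y)) (τ-involutive (x ⟶ y) (sym (TDist⁻ x y (i , j) t))))) ,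
        λ h a b x y x′ y′ t t′ → trans (interCount≡inter x y a b) (trans
          (scheme _ _ a b (trans (sym (TDist⁻ x y h t)) (TDist⁻ x′ y′ h t′)))
          (sym (interCount≡inter x′ y′ a b)))
        where
        τ0 : τ 0# ≡ (0 , 0)
        τ0 = cong₂ _,_ d0 (trans (cong d (solve 0 (:- nat 0 := nat 0) refl)) d0)

      -- The generation rule combines the reverse of one relation with another. On differences this
      -- is subtraction: the step - y′ followed by the step y.
      primitiveScheme : Fin n → (∀ x z → x ≢ 0# → (Q : F → Set) → (∀ y y′ → Q y → Q y′ → Q (y - y′)) → Q x → Q z) → Primitive adj
      primitiveScheme o generates i (x₀ , x₁ , ti) i≢0 l (y₀ , y₁ , tl) =
        subst (Generated adj i) (sym (TDist⁻ y₀ y₁ l tl))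
          (generates x (y₀ ⟶ y₁) x≢0 (λ y → Generated adj i (τ y)) closed
            (subst (Generated adj i) (TDist⁻ x₀ x₁ i ti) gen-base))
        where
        x = x₀ ⟶ x₁
        x≢0 : x ≢ 0#
        x≢0 e = i≢0 (trans (TDist⁻ x₀ x₁ i ti) (trans (cong τ e)
          (cong₂ _,_ d0 (trans (cong d (solve 0 (:- nat 0 := nat 0) refl)) d0))))
        closed : ∀ y y′ → Generated adj i (τ y) → Generated adj i (τ y′) → Generated adj i (τ (y - y′))
        closed y y′ g g′ = gen-step g′ g (o , head o (y - y′) , head o (- y′) ,
          TDist-≡ _ _ (cong τ (⟶-head o (y - y′))) ,
          TDist-≡ _ _ (trans (cong τ (⟶-head o (- y′))) (τ-swap y′)) ,
          TDist-≡ _ _ (cong τ (tail o _ (trans (⟶-head o (y - y′)) (+-comm y (- y′))))))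

    module _ (sc : StronglyConnected adj) where

      private
        o = from 0#

        o⟶ : ∀ z → o ⟶ from z ≡ z
        o⟶ z = trans (cong₂ (λ u v → u - v) (to-from z) (to-from 0#)) (solve 1 (λ z → z :- nat 0 := z) refl z)

        -- Walks can be translated, so distances from the one vertex over 0 determine all others.
        walk-invariant : ∀ k x y x′ y′ → x ⟶ y ≡ x′ ⟶ y′ → walk adj k x y ≡ true → walk adj k x′ y′ ≡ true
        walk-invariant zero x y x′ y′ e w with refl ← isYes-true⁻ (x ≟F y) w =
          isYes-true⁺ (x′ ≟F y′) (⟶-zero x′ y′ (trans (sym e) (⟶-refl x)))
        walk-invariant (suc k) x y x′ y′ e w with any-true⁻ (λ z → adj x z ∧ walk adj k z y) (allFin n) w
        ... | z , _ , t with ∧-true⁻ {adj x z} t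
        ...   | xz , zy = any-true⁺ (λ v → adj x′ v ∧ walk adj k v y′) (∈-allFin (head x′ (x ⟶ z)))
          (∧-true⁺ (Equivalence.from (arc x′ (head x′ (x ⟶ z))) (subst S (sym (⟶-head x′ (x ⟶ z))) (Equivalence.to (arc x z) xz)))
            (walk-invariant k z y _ y′ (sym (tail x′ y′ (trans (sym e) (sym (⟶-trans x z y))))) zy))

        shortest : ∀ z → ∃ λ j → walk adj j o (from z) ≡ true × (∀ i → walk adj i o (from z) ≡ true → j ≤ i)
        shortest z = leastTrue (λ k → walk adj k o (from z)) (proj₁ (sc o (from z))) (proj₂ (sc o (from z)))

      dist : F → ℕ
      dist z = proj₁ (shortest z)

      private
        dist-walk : ∀ z → walk adj (dist z) o (from z) ≡ true
        dist-walk z = proj₁ (proj₂ (shortest z))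

        dist-least : ∀ z {i} → walk adj i o (from z) ≡ true → dist z ≤ i
        dist-least z = proj₂ (proj₂ (shortest z)) _

        step : ∀ s x → S s → dist (s + x) ≤ suc (dist x)
        step s x Ss = dist-least (s + x) (any-true⁺ (λ v → adj o v ∧ walk adj (dist x) v (from (s + x))) (∈-allFin (head o s))
          (∧-true⁺ (Equivalence.from (arc o (head o s)) (subst S (sym (⟶-head o s)) Ss))
            (walk-invariant (dist x) o (from x) _ _ (trans (o⟶ x) (sym (tail o _ (o⟶ (s + x))))) (dist-walk x))))

      dist-isDistance : IsDistance S dist
      dist-isDistance = record
        { d0 = ℕ.n≤0⇒n≡0 (dist-least 0# (isYes-true⁺ (o ≟F o) refl))
        ; d≡0 = λ x e → trans (sym (o⟶ x)) (trans (cong (o ⟶_) (sym (isYes-true⁻ (o ≟F from x)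
            (subst (λ k → walk adj k o (from x) ≡ true) e (dist-walk x))))) (⟶-refl o))
        ; d-step = step
        ; d-pred = pred }
        where
        pred : ∀ x n → dist x ≡ suc n → ∃₂ λ s z → S s × dist z ≡ n × x ≡ s + z
        pred x k e with any-true⁻ (λ z → adj o z ∧ walk adj k z (from x)) (allFin n) (subst (λ k → walk adj k o (from x) ≡ true) e (dist-walk x))
        ... | v , _ , t with ∧-true⁻ {adj o v} t
        ...   | ov , vx = o ⟶ v , v ⟶ from x , So , ℕ.≤-antisym
                  (dist-least _ (walk-invariant k v (from x) o _ (sym (o⟶ (v ⟶ from x))) vx))
                  (ℕ.≤-pred (ℕ.≤-trans (ℕ.≤-reflexive (trans (sym e) (cong dist x≡))) (step _ _ So))) , x≡
          where
          So = Equivalence.to (arc o v) ov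
          x≡ : x ≡ o ⟶ v + v ⟶ from x
          x≡ = trans (sym (o⟶ x)) (sym (⟶-trans o v (from x)))

      open TwoWay dist

      dist-scheme : IsAssociationScheme adj → ∀ z z′ a b → τ z ≡ τ z′ → inter z a b ≡ inter z′ a b
      dist-scheme (_ , _ , scheme) z z′ a b e = begin
        inter z a b                       ≡⟨ cong (λ v → inter v a b) (o⟶ z) ⟨
        inter (o ⟶ from z) a b            ≡⟨ interCount≡inter dist-isDistance o (from z) a b ⟨
        interCount adj o (from z) a b     ≡⟨ scheme (τ z) a b o (from z) o (from z′)
                                               (TDist-≡ dist-isDistance o (from z) (cong τ (o⟶ z)))
                                               (TDist-≡ dist-isDistance o (from z′) (trans (cong τ (o⟶ z′)) (sym e))) ⟩
        interCount adj o (from z′) a b    ≡⟨ interCount≡inter dist-isDistance o (from z′) a b ⟩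
        inter (o ⟶ from z′) a b           ≡⟨ cong (λ v → inter v a b) (o⟶ z′) ⟩
        inter z′ a b                      ∎
        where open ≡-Reasoning

      -- Primitivity as an induction principle for predicates closed under subtraction. Induction on
      -- `Generated` shows that `Q` holds on entire classes.
      dist-primitive : IsAssociationScheme adj → Primitive adj →
        (Q : F → Set) → (∀ x y → Q x → Q y → Q (x - y)) → ∀ x → x ≢ 0# → (∀ y → τ y ≡ τ x → Q y) → ∀ z → Q z
      dist-primitive as prim Q closed x x≢0 classx z = generated (τ z)
        (prim (τ x) (o , from x , TDist-≡ dist-isDistance o (from x) (cong τ (o⟶ x)))
          (λ e → x≢0 (IsDistance.d≡0 dist-isDistance x (cong proj₁ e)))
          (τ z) (o , from z , TDist-≡ dist-isDistance o (from z) (cong τ (o⟶ z)))) z refl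
        where
        generated : ∀ l → Generated adj (τ x) l → ∀ z → τ z ≡ l → Q z
        generated .(τ x) gen-base z e = classx z e
        generated l (gen-step {a} {b} ga gb (u , v , w , tl , ta , tb)) z e =
          let w′ , ea , eb = count>0⁻ (λ w → (τ w ≟τ swap a) ×-dec (τ (z - w) ≟τ b)) positive in
          subst Q (solve 2 (λ z w → (z :- w) :- (:- w) := z) refl z w′)
            (closed _ _ (generated b gb (z - w′) eb) (generated a ga (- w′) (τ-involutive dist-isDistance w′ ea)))
          where
          -- The rule provides a single pair of type l; the scheme axiom carries its nonzero
          -- intersection number over to z.
          positive : 0 < inter z (swap a) b
          positive = subst (0 <_)
            (dist-scheme as (u ⟶ v) z (swap a) b (trans (sym (TDist⁻ dist-isDistance u v l tl)) (sym e)))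
            (count>0 (λ w → (τ w ≟τ swap a) ×-dec (τ (u ⟶ v - w) ≟τ b)) (u ⟶ w)
              (sym (TDist⁻ dist-isDistance u w _ ta) ,
               trans (cong τ (solve 3 (λ u v w → (v :- u) :- (w :- u) := v :- w) refl (to u) (to v) (to w)))
                 (sym (TDist⁻ dist-isDistance w v b tb))))

-- Schemes of composite order

count-⊤ : ∀ n → count {n} (λ _ → yes tt) ≡ n
count-⊤ zero = refl
count-⊤ (suc n) = cong suc (count-⊤ n)

module Multiples (m : ℕ) .{{_ : NonZero m}} where
  open ZMod m
  open CommutativeRing commutativeRing using (zeroˡ)
  open IntSolver commutativeRing
  open Convolution m using (_·_)

  ·≡* : ∀ n x → n · x ≡ ⟦ n ⟧ * x
  ·≡* zero x = sym (zeroˡ x)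
  ·≡* (suc n) x = trans (cong (x +_) (·≡* n x))
    (trans (solve 2 (λ x y → x :+ y :* x := (nat 1 :+ y) :* x) refl x ⟦ n ⟧) (cong (_* x) (sym (+-homo 1 n))))

  ⟦⟧≡0⇒∣ : ∀ {n} → ⟦ n ⟧ ≡ 0# → m ∣ n
  ⟦⟧≡0⇒∣ {n} e with ⟦⟧-cong⁻ {n} {0} e
  ... | k , l , eq = ∣m+n∣m⇒∣n (subst (m ∣_) (trans (sym eq) (ℕ.+-comm n _)) (n∣m*n l)) (n∣m*n k)

  ∣⇒⟦⟧≡0 : ∀ {n} → m ∣ n → ⟦ n ⟧ ≡ 0#
  ∣⇒⟦⟧≡0 (divides k refl) = ⟦⟧-cong (0 , k , ℕ.+-identityʳ _)

  toℕ-⟦⟧-< : ∀ {n} → n < m → toℕ ⟦ n ⟧ ≡ n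
  toℕ-⟦⟧-< {n} n<m = trans (toℕ-⟦⟧ n) (m<n⇒m%n≡m n<m)

module SchurRing (m : ℕ) .{{_ : NonZero m}} (d : ZMod.F m → ℕ) (isScheme : Distance.TwoWay.IsScheme m d) where
  open ZMod m
  open Distance m
  open TwoWay d
  open IsScheme isScheme
  open CommutativeRing commutativeRing using (+-identityʳ; +-identityˡ; -‿inverseʳ; distribˡ; zeroʳ; *-identityʳ)
  open IntSolver commutativeRing
  open Convolution m
  open Multiples m

  ClassFunction : (F → ℕ) → Set
  ClassFunction f = ∀ x y → τ x ≡ τ y → f x ≡ f y

  private
    -- A representative of each class, found by search. Testing `rep v ≟F v` picks one v per class,
    -- so sums over classes become sums over `F`.
    repτ : ℕ × ℕ → F
    repτ h with anyF? (λ v → τ v ≟τ h)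
    ... | yes (v , _) = v
    ... | no _ = 0#

    τ-repτ : ∀ y → τ (repτ (τ y)) ≡ τ y
    τ-repτ y with anyF? (λ v → τ v ≟τ τ y)
    ... | yes (v , e) = e
    ... | no h = contradiction (y , refl) h

    rep : F → F
    rep y = repτ (τ y)

    expand : ∀ {f} → ClassFunction f → ∀ y →
      f y ≡ sum (λ v → χ (rep v ≟F v) ℕ.* f v ℕ.* χ (τ y ≟τ τ v))
    expand {f} cf y = sym (trans (sum-single (rep y) zeros) value)
      where
      zeros : ∀ v → v ≢ rep y → χ (rep v ≟F v) ℕ.* f v ℕ.* χ (τ y ≟τ τ v) ≡ 0
      zeros v v≢ with rep v ≟F v | τ y ≟τ τ v
      ... | no _ | _ = refl
      ... | yes _ | no _ = ℕ.*-zeroʳ (1 ℕ.* f v)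
      ... | yes e | yes e′ = contradiction (trans (sym e) (cong repτ (sym e′))) v≢
      value : χ (rep (rep y) ≟F rep y) ℕ.* f (rep y) ℕ.* χ (τ y ≟τ τ (rep y)) ≡ f y
      value = trans (cong₂ (λ a b → a ℕ.* f (rep y) ℕ.* b)
          (χ-yes (rep (rep y) ≟F rep y) (cong repτ (τ-repτ y))) (χ-yes (τ y ≟τ τ (rep y)) (sym (τ-repτ y))))
        (trans (ℕ.*-identityʳ _) (trans (ℕ.*-identityˡ _) (cf _ y (τ-repτ y))))

  class : ℕ × ℕ → F → ℕ
  class c x = χ (τ x ≟τ c)

  -- By `expand` a class function is a combination of class indicators, and for these the claim is
  -- the scheme axiom.
  class⋆ : ∀ c {f} → ClassFunction f → ClassFunction (class c ⋆ f)
  class⋆ c {f} cf z z′ e = trans (formula z) (trans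
      (sum-cong-≗ λ v → cong (χ (rep v ≟F v) ℕ.* f v ℕ.*_) (scheme z z′ c (τ v) e)) (sym (formula z′)))
    where
    open ≡-Reasoning
    formula : ∀ z → (class c ⋆ f) z ≡ sum (λ v → χ (rep v ≟F v) ℕ.* f v ℕ.* inter z c (τ v))
    formula z = begin
      sum (λ w → class c w ℕ.* f (z - w))
        ≡⟨ sum-cong-≗ (λ w → trans (cong (class c w ℕ.*_) (expand cf (z - w))) (*-distribˡ-sum (class c w) (λ v → k v ℕ.* χ (τ (z - w) ≟τ τ v)))) ⟩
      sum (λ w → sum (λ v → class c w ℕ.* (k v ℕ.* χ (τ (z - w) ≟τ τ v))))
        ≡⟨ ∑-comm (λ w v → class c w ℕ.* (k v ℕ.* χ (τ (z - w) ≟τ τ v))) ⟩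
      sum (λ v → sum (λ w → class c w ℕ.* (k v ℕ.* χ (τ (z - w) ≟τ τ v))))
        ≡⟨ sum-cong-≗ (λ v → trans (sum-cong-≗ λ w → trans (x∙yz≈y∙xz (class c w) (k v) _)
             (cong (k v ℕ.*_) (sym (χ-× (τ w ≟τ c) (τ (z - w) ≟τ τ v)))))
             (sym (*-distribˡ-sum (k v) (λ w → χ ((τ w ≟τ c) ×-dec (τ (z - w) ≟τ τ v)))))) ⟩
      sum (λ v → k v ℕ.* inter z c (τ v)) ∎
      where
      open import Algebra.Properties.CommutativeSemigroup ℕ.*-commutativeSemigroup using (x∙yz≈y∙xz)
      k : F → ℕ
      k v = χ (rep v ≟F v) ℕ.* f v

  class⋆^ : ∀ c n → ClassFunction (class c ⋆^ n)
  class⋆^ c zero x y e = χ-cong (0# ≟F x) (0# ≟F y) (zero-class x y e) (zero-class y x (sym e))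
    where
    zero-class : ∀ x y → τ x ≡ τ y → 0# ≡ x → 0# ≡ y
    zero-class x y e refl = sym (d≡0 y (trans (sym (cong proj₁ e)) d0))
  class⋆^ c (suc n) = class⋆ c (class⋆^ c n)

  roots : ℕ → ℕ × ℕ → F → ℕ
  roots q c x = count (λ a → (τ a ≟τ c) ×-dec (q · a ≟F x))

  -- The group ring element of the q-th multiples of a class is a class function modulo q (Schur).
  roots-class : ∀ {q} (pr : Prime q) .{{_ : NonZero q}} → ∀ c x y → τ x ≡ τ y → roots q c x % q ≡ roots q c y % q
  roots-class {q} pr c x y e = trans (sym (frobenius pr (λ v → τ v ≟τ c) x))
    (trans (cong (_% q) (class⋆^ c q x y e)) (frobenius pr (λ v → τ v ≟τ c) y))

  autocorrelation : ℕ × ℕ → F → ℕ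
  autocorrelation c x = count (λ b → (τ b ≟τ c) ×-dec (τ (b + x) ≟τ c))

  τ-neg : ∀ x → τ (- x) ≡ swap (τ x)
  τ-neg x = cong (λ v → d (- x) , d v) (solve 1 (λ x → :- (:- x) := x) refl x)

  -- With w = - b this is the intersection number of the reversed class and the class itself.
  autocorrelation-class : ∀ c → ClassFunction (autocorrelation c)
  autocorrelation-class c x y e = trans (formula x) (trans (scheme x y (swap c) c e) (sym (formula y)))
    where
    formula : ∀ x → autocorrelation c x ≡ inter x (swap c) c
    formula x = trans (count-cong (λ b → (τ b ≟τ c) ×-dec (τ (b + x) ≟τ c)) (λ b → R? (- b))
        (λ b (p , q) → trans (τ-neg b) (cong swap p) , trans (cong τ (flip b)) q)
        (λ b (p , q) → cong swap (trans (sym (τ-neg b)) p) , trans (cong τ (sym (flip b))) q))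
      (count-bij R? (λ b → - b) (λ b → - b) inv inv)
      where
      R? : Decidable (λ w → τ w ≡ swap c × τ (x - w) ≡ c)
      R? w = (τ w ≟τ swap c) ×-dec (τ (x - w) ≟τ c)
      inv : ∀ b → - - b ≡ b
      inv b = solve 1 (λ b → :- (:- b) := b) refl b
      flip : ∀ b → x - - b ≡ b + x
      flip b = solve 2 (λ b x → x :- (:- b) := b :+ x) refl b x

  module _ (generates : (Q : F → Set) → (∀ x y → Q x → Q y → Q (x - y)) →
              ∀ x → x ≢ 0# → (∀ y → τ y ≡ τ x → Q y) → ∀ z → Q z)
           (s : F) (ds : d s ≡ 1) (d-s : d (- s) ≢ 1)
           (q e : ℕ) (pr : Prime q) (1<e : 1 < e) (m≡qe : m ≡ q ℕ.* e) where

    private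
      instance
        q≢0 : NonZero q
        q≢0 = prime⇒nonZero pr
        e≢0 : NonZero e
        e≢0 = ℕ.>-nonZero (ℕ.<-trans (s≤s z≤n) 1<e)

      1<q : 1 < q
      1<q = ℕ.nonTrivial⇒n>1 q {{prime⇒nonTrivial pr}}

      -- `T` is a class of arcs, `P` the subgroup of order q, which is the kernel of multiplication
      -- by q.
      T P : F → Set
      T x = τ x ≡ τ s
      P x = q · x ≡ 0#

      T? : Decidable T
      T? x = τ x ≟τ τ s
      P? : Decidable P
      P? x = q · x ≟F 0#

      ·-distrib-+ : ∀ x y → q · (x + y) ≡ q · x + q · y
      ·-distrib-+ x y = trans (·≡* q (x + y)) (trans (distribˡ ⟦ q ⟧ x y) (sym (cong₂ _+_ (·≡* q x) (·≡* q y))))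

      ·-neg : ∀ x → q · (- x) ≡ - (q · x)
      ·-neg x = trans (·≡* q (- x)) (trans (solve 2 (λ q x → q :* (:- x) := :- (q :* x)) refl ⟦ q ⟧ x) (cong (λ v → - v) (sym (·≡* q x))))

      -0≡0 : - 0# ≡ 0#
      -0≡0 = solve 0 (:- nat 0 := nat 0) refl

      P-+ : ∀ {x y} → P x → P y → P (x + y)
      P-+ {x} {y} px py = trans (·-distrib-+ x y) (trans (cong₂ _+_ px py) (+-identityʳ 0#))

      P-neg : ∀ {x} → P x → P (- x)
      P-neg {x} px = trans (·-neg x) (trans (cong (λ v → - v) px) -0≡0)

      ¬T0 : ¬ T 0#
      ¬T0 t0 = contradiction (trans (sym ds) (trans (sym (cong proj₁ t0)) d0)) λ ()

      ¬T-s : ¬ T (- s)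
      ¬T-s t = d-s (trans (cong proj₁ t) ds)

      T-neg : ∀ {x} → T x → τ (- x) ≡ τ (- s)
      T-neg {x} t = trans (τ-neg x) (trans (cong swap t) (sym (τ-neg s)))

      P⇒e∣ : ∀ x → P x → e ∣ toℕ x
      P⇒e∣ x px = *-cancelˡ-∣ q (subst (_∣ q ℕ.* toℕ x) m≡qe (⟦⟧≡0⇒∣
        (trans (*-homo q (toℕ x)) (trans (cong (⟦ q ⟧ *_) (⟦toℕ⟧ x)) (trans (sym (·≡* q x)) px)))))

      e∣⇒P : ∀ j → P ⟦ e ℕ.* j ⟧
      e∣⇒P j = trans (·≡* q _) (trans (sym (*-homo q (e ℕ.* j))) (∣⇒⟦⟧≡0 (subst (m ∣_)
        (trans (cong (ℕ._* j) m≡qe) (ℕ.*-assoc q e j)) (m∣m*n j))))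

      |P|≤q : count P? ≤ q
      |P|≤q = ℕ.≤-trans (count-inj P? (λ _ → yes tt) quotient (λ _ _ → tt) inj) (ℕ.≤-reflexive (count-⊤ q))
        where
        bound : ∀ (x : F) → toℕ x / e < q
        bound x = m<n*o⇒m/o<n (subst (toℕ x <_) m≡qe (toℕ<n x))
        quotient : F → Fin q
        quotient x = fromℕ< (bound x)
        inj : ∀ x y → P x → P y → quotient x ≡ quotient y → x ≡ y
        inj x y px py h = toℕ-injective (trans (sym (m/n*n≡m (P⇒e∣ x px)))
          (trans (cong (ℕ._* e) (trans (sym (toℕ-fromℕ< (bound x))) (trans (cong toℕ h) (toℕ-fromℕ< (bound y)))))
            (m/n*n≡m (P⇒e∣ y py))))

      q≤|P| : q ≤ count P?
      q≤|P| = ℕ.≤-trans (ℕ.≤-reflexive (sym (count-⊤ q)))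
        (count-inj (λ (_ : Fin q) → yes tt) P? (λ j → ⟦ e ℕ.* toℕ j ⟧) (λ j _ → e∣⇒P (toℕ j)) inj)
        where
        small : ∀ (j : Fin q) → e ℕ.* toℕ j < m
        small j = subst (e ℕ.* toℕ j <_) (trans (ℕ.*-comm e q) (sym m≡qe)) (ℕ.*-monoʳ-< e (toℕ<n j))
        inj : ∀ i j → ⊤ → ⊤ → ⟦ e ℕ.* toℕ i ⟧ ≡ ⟦ e ℕ.* toℕ j ⟧ → i ≡ j
        inj i j _ _ h = toℕ-injective (ℕ.*-cancelˡ-≡ _ _ e
          (trans (sym (toℕ-⟦⟧-< (small i))) (trans (cong toℕ h) (toℕ-⟦⟧-< (small j)))))

      g : F
      g = ⟦ e ℕ.* 1 ⟧

      Pg : P g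
      Pg = e∣⇒P 1

      g≢0 : g ≢ 0#
      g≢0 h = ℕ.<⇒≱ (subst (e <_) (trans (ℕ.*-comm e q) (sym m≡qe)) (ℕ.m<m*n e q 1<q))
        (∣⇒≤ (subst (m ∣_) (ℕ.*-identityʳ e) (⟦⟧≡0⇒∣ h)))

      -- As q divides m, divisibility by q is well defined in ℤ/m.
      1∉qF : ¬ ∃ λ y → 1# ≡ q · y
      1∉qF (y , h) with ⟦⟧-cong⁻ {1} {q ℕ.* toℕ y} (trans h (trans (·≡* q y) (trans (cong (⟦ q ⟧ *_) (sym (⟦toℕ⟧ y))) (sym (*-homo q (toℕ y))))))
      ... | k , l , eq = ℕ.<⇒≱ 1<q (∣⇒≤ (∣m+n∣m⇒∣n (subst (q ∣_) (trans (sym eq) (ℕ.+-comm 1 _))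
              (∣m∣n⇒∣m+n (m∣m*n (toℕ y)) (∣-trans q∣m (n∣m*n l)))) (∣-trans q∣m (n∣m*n k))))
        where
        q∣m : q ∣ m
        q∣m = subst (q ∣_) (sym m≡qe) (m∣m*n e)

      -- Otherwise the support of the q-th multiples of T would contain a class inside the proper subgroup qF.
      roots-T≡0 : ∀ x → x ≢ 0# → roots q (τ s) x % q ≡ 0
      roots-T≡0 x x≢0 = decidable-stable (roots q (τ s) x % q ℕ.≟ 0) λ h →
        1∉qF (generates (λ z → ∃ λ y → z ≡ q · y)
          (λ u u′ (y , e) (y′ , e′) → y - y′ , trans (cong₂ (λ a b → a - b) e e′) (sym (trans (·-distrib-+ y (- y′)) (cong (q · y +_) (·-neg y′)))))
          x x≢0 (λ z z∼x → root z (λ c0 → h (trans (roots-class pr (τ s) x z (sym z∼x)) (trans (cong (_% q) c0) (m<n⇒m%n≡m (ℕ.>-nonZero⁻¹ q)))))) 1#)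
        where
        root : ∀ z → roots q (τ s) z ≢ 0 → ∃ λ y → z ≡ q · y
        root z c≢0 = let a , _ , e = count>0⁻ (λ a → T? a ×-dec (q · a ≟F z)) (ℕ.n≢0⇒n>0 c≢0) in a , sym e

      -- Since `q · a` is nonzero, the number of elements of `T` in the coset of a is a positive
      -- multiple of q, and the coset has at most q elements.
      T-periodic : ∀ {a y} → T a → ¬ P a → P y → T (a + y)
      T-periodic {a} {y} ta ¬pa py = proj₁ (count-tight (λ b → T? b ×-dec (q · b ≟F q · a)) (λ b → q · b ≟F q · a)
          (λ b → proj₂) fibre≤ (a + y) (trans (·-distrib-+ a y) (trans (cong (q · a +_) py) (+-identityʳ _))))
        where
        q≤roots : q ≤ roots q (τ s) (q · a)
        q≤roots = ∣⇒≤ {{ℕ.>-nonZero (count>0 (λ b → T? b ×-dec (q · b ≟F q · a)) a (ta , refl))}}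
          (m%n≡0⇒n∣m _ q (roots-T≡0 (q · a) ¬pa))
        fibre≤ : count (λ b → q · b ≟F q · a) ≤ roots q (τ s) (q · a)
        fibre≤ = ℕ.≤-trans (ℕ.≤-trans (count-inj (λ b → q · b ≟F q · a) P? (λ b → b - a)
            (λ b e → trans (·-distrib-+ b (- a)) (trans (cong₂ _+_ e (·-neg a)) (-‿inverseʳ _)))
            (λ b b′ _ _ h → trans (solve 2 (λ a b → b := (b :- a) :+ a) refl a b)
              (trans (cong (_+ a) h) (solve 2 (λ a b → (b :- a) :+ a := b) refl a b′)))) |P|≤q) q≤roots

      Stabilises : F → Set
      Stabilises y = ∀ a → T a → T (a + y)

      -- An element stabilises `T` exactly when the autocorrelation there equals the size of `T`,
      -- and the autocorrelation depends only on the class.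
      stabilises-class : ∀ y y′ → τ y ≡ τ y′ → Stabilises y → Stabilises y′
      stabilises-class y y′ e st a ta = proj₂ (count-tight (λ b → T? b ×-dec T? (b + y′)) T? (λ b → proj₁)
        (ℕ.≤-trans (ℕ.≤-reflexive (count-cong T? (λ b → T? b ×-dec T? (b + y)) (λ b tb → tb , st b tb) (λ b → proj₁)))
          (ℕ.≤-reflexive (autocorrelation-class (τ s) y y′ e))) a ta)

      -- Otherwise `T` is a union of cosets and `P` stabilises it. Stabilising spreads over classes,
      -- and together with the same property of the negatives it is closed under subtraction. So
      -- everything would stabilise `T`, and s - s = 0 would lie in `T`.
      T-meets-P : ∃ λ y → T y × P y
      T-meets-P with anyF? (λ y → T? y ×-dec P? y)
      ... | yes h = h
      ... | no h = contradiction (subst T (-‿inverseʳ s) (proj₁ (all (- s)) s refl)) ¬T0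
        where
        P-stabilises : ∀ {y} → P y → Stabilises y
        P-stabilises py a ta = T-periodic ta (λ pa → h (a , ta , pa)) py
        all : ∀ z → Stabilises z × Stabilises (- z)
        all = generates (λ y → Stabilises y × Stabilises (- y))
          (λ x y (sx , s-x) (sy , s-y) →
            (λ a ta → subst T (solve 3 (λ a x y → (a :+ x) :+ (:- y) := a :+ (x :- y)) refl a x y) (s-y _ (sx a ta))) ,
            (λ a ta → subst T (solve 3 (λ a x y → (a :+ (:- x)) :+ y := a :+ (:- (x :- y))) refl a x y) (sy _ (s-x a ta))))
          g g≢0 (λ y y∼g → stabilises-class g y (sym y∼g) (P-stabilises Pg) ,
                  stabilises-class (- g) (- y) (sym (trans (τ-neg y) (trans (cong swap y∼g) (sym (τ-neg g))))) (P-stabilises (P-neg Pg)))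

      -- A class inside a proper subgroup cannot generate.
      T⊈P : ∃ λ z → T z × ¬ P z
      T⊈P with anyF? (λ z → T? z ×-dec ¬? (P? z))
      ... | yes h = h
      ... | no h = contradiction (generates P (λ x y px py → P-+ px (P-neg py)) s s≢0
              (λ y ty → decidable-stable (P? y) λ ¬py → h (y , ty , ¬py)) 1#)
            λ p1 → ℕ.<⇒≱ (subst (q <_) (sym m≡qe) (ℕ.m<m*n q e 1<e))
              (∣⇒≤ (⟦⟧≡0⇒∣ (trans (sym (*-identityʳ ⟦ q ⟧)) (trans (sym (·≡* q 1#)) p1))))
        where
        s≢0 : s ≢ 0#
        s≢0 e = ¬T0 (cong τ (sym e))

    -- The autocorrelation of `T` agrees at y, inside `P`, and at z, outside it. Periodicity
    -- evaluates both except for the counts `A₁` and `B₂`, and comparing them leaves `A₁ + G ≡ τ₀`.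
    -- The set counted by `G` is a union of cosets, so `G` is 0 or at least q, while `τ₀ < q`
    -- because 0 is not in `T`. But `G ≡ 0` would close the intersection of `T` and `P` under adding
    -- y, and repeated addition reaches q · y = 0.
    composite-impossible : ⊥
    composite-impossible = ℕ.<⇒≱ τ₀<q (ℕ.≤-trans q≤G (ℕ.≤-trans (ℕ.m≤n+m G A₁) (ℕ.≤-reflexive A₁+G≡τ₀)))
      where
      y = proj₁ T-meets-P
      Ty = proj₁ (proj₂ T-meets-P)
      Py = proj₂ (proj₂ T-meets-P)
      z = proj₁ T⊈P
      Tz = proj₁ (proj₂ T⊈P)
      ¬Pz = proj₂ (proj₂ T⊈P)

      T∩P? : Decidable (λ b → T b × P b)
      T∩P? b = T? b ×-dec P? b
      T∖P? : Decidable (λ b → T b × ¬ P b)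
      T∖P? b = T? b ×-dec ¬? (P? b)
      both? : ∀ x → Decidable (λ b → T b × T (b + x))
      both? x b = T? b ×-dec T? (b + x)
      leave? : Decidable (λ b → (T b × ¬ P b) × ¬ (T (b + z) × ¬ P (b + z)))
      leave? b = T∖P? b ×-dec ¬? (T∖P? (b + z))

      τ₀ = count T∩P?
      M = count T∖P?
      A₁ = count (λ b → both? y b ×-dec P? b)
      B₂ = count (λ b → T∖P? b ×-dec T∖P? (b + z))
      G = count leave?

      λy : autocorrelation (τ s) y ≡ A₁ ℕ.+ M
      λy = trans (count-split (both? y) P?) (cong (A₁ ℕ.+_)
        (count-cong (λ b → both? y b ×-dec ¬? (P? b)) T∖P?
          (λ b ((tb , _) , ¬pb) → tb , ¬pb) (λ b (tb , ¬pb) → (tb , T-periodic tb ¬pb Py) , ¬pb)))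

      -- If b + z were in `P`, periodicity would put b - (b + z) = - z into `T`, although - z has
      -- the type of - s.
      b+z∉P : ∀ b → T b → ¬ P b → ¬ P (b + z)
      b+z∉P b tb ¬pb p = ¬T-s (trans (sym (T-neg Tz))
        (subst T (solve 2 (λ b z → b :+ (:- (b :+ z)) := :- z) refl b z) (T-periodic tb ¬pb (P-neg p))))

      λz : autocorrelation (τ s) z ≡ τ₀ ℕ.+ B₂
      λz = trans (count-split (both? z) P?) (cong₂ ℕ._+_
        (count-cong (λ b → both? z b ×-dec P? b) T∩P?
          (λ b ((tb , _) , pb) → tb , pb)
          (λ b (tb , pb) → (tb , subst T (solve 2 (λ z b → z :+ b := b :+ z) refl z b) (T-periodic Tz ¬Pz pb)) , pb))
        (count-cong (λ b → both? z b ×-dec ¬? (P? b)) (λ b → T∖P? b ×-dec T∖P? (b + z))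
          (λ b ((tb , tbz) , ¬pb) → (tb , ¬pb) , tbz , b+z∉P b tb ¬pb)
          (λ b ((tb , ¬pb) , tbz , _) → (tb , tbz) , ¬pb)))

      A₁+G≡τ₀ : A₁ ℕ.+ G ≡ τ₀
      A₁+G≡τ₀ = ℕ.+-cancelʳ-≡ B₂ _ _ (begin
        A₁ ℕ.+ G ℕ.+ B₂     ≡⟨ ℕ.+-assoc A₁ G B₂ ⟩
        A₁ ℕ.+ (G ℕ.+ B₂)   ≡⟨ cong (A₁ ℕ.+_) (ℕ.+-comm G B₂) ⟩
        A₁ ℕ.+ (B₂ ℕ.+ G)   ≡⟨ cong (A₁ ℕ.+_) (count-split T∖P? (λ b → T∖P? (b + z))) ⟨
        A₁ ℕ.+ M            ≡⟨ λy ⟨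
        autocorrelation (τ s) y  ≡⟨ autocorrelation-class (τ s) y z (trans Ty (sym Tz)) ⟩
        autocorrelation (τ s) z  ≡⟨ λz ⟩
        τ₀ ℕ.+ B₂ ∎)
        where open ≡-Reasoning

      τ₀<q : τ₀ < q
      τ₀<q = ℕ.≤∧≢⇒< (ℕ.≤-trans (count-mono T∩P? P? λ b → proj₂) |P|≤q)
        λ eq → ¬T0 (proj₁ (count-tight T∩P? P? (λ b → proj₂)
          (ℕ.≤-trans |P|≤q (ℕ.≤-reflexive (sym eq))) 0# (trans (·≡* q 0#) (zeroʳ ⟦ q ⟧))))

      A₁<τ₀ : A₁ < τ₀
      A₁<τ₀ = ℕ.≰⇒> λ τ₀≤A₁ → orbit (λ b tb pb →
          proj₂ (proj₁ (count-tight (λ b → both? y b ×-dec P? b) T∩P? (λ b ((tb , _) , pb) → tb , pb) τ₀≤A₁ b (tb , pb))))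
        where
        orbit : (∀ b → T b → P b → T (b + y)) → ⊥
        orbit closed = end q refl
          where
          go : ∀ n → T (y + n · y) × P (y + n · y)
          go zero = subst (λ v → T v × P v) (sym (+-identityʳ y)) (Ty , Py)
          go (suc n) = let t , p = go n in
            subst (λ v → T v × P v) (solve 2 (λ y u → (y :+ u) :+ y := y :+ (y :+ u)) refl y (n · y))
              (closed _ t p , P-+ p Py)
          end : ∀ n → n ≡ q → ⊥
          end zero h = ℕ.≢-nonZero⁻¹ q (sym h)
          end (suc n) refl = ¬T0 (subst T Py (proj₁ (go n)))

      q≤G : q ≤ G
      q≤G = let b , (tb , ¬pb) , leaves = count>0⁻ leave? G>0 in
        ℕ.≤-trans q≤|P| (count-inj P? leave? (b +_)
          (λ v pv → (T-periodic tb ¬pb pv , ¬P-+ pv ¬pb) , λ (t , ¬p) → leaves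
            (subst (λ u → T u × ¬ P u) (solve 3 (λ b v z → ((b :+ v) :+ z) :+ (:- v) := b :+ z) refl b v z)
              (T-periodic t ¬p (P-neg pv) , ¬P-+ (P-neg pv) ¬p)))
          (λ v v′ _ _ h → trans (solve 2 (λ b v → v := (b :+ v) :- b) refl b v)
            (trans (cong (λ u → u - b) h) (solve 2 (λ b v → (b :+ v) :- b := v) refl b v′))))
        where
        G>0 : 0 < G
        G>0 = ℕ.n≢0⇒n>0 λ G≡0 → ℕ.<⇒≢ A₁<τ₀ (trans (sym (ℕ.+-identityʳ A₁)) (trans (cong (A₁ ℕ.+_) (sym G≡0)) A₁+G≡τ₀))
        ¬P-+ : ∀ {b v} → P v → ¬ P b → ¬ P (b + v)
        ¬P-+ {b} {v} pv ¬pb p = ¬pb (subst P (solve 2 (λ b v → (b :+ v) :+ (:- v) := b) refl b v) (P-+ p (P-neg pv)))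

-- A numerical inequality for additive energies

module EnergyBound where
  open import Data.Nat
  open import Data.Nat.Properties
  open +-*-Solver

  -- With b = 1 + t: g ≥ 2 a + b, for otherwise (a + b)² + b ≤ (2 a + b) b; then the second bound reduces
  -- to 2 a² + 4 a t + 4 t + 3 t² ≤ 0.
  energy-bound : ∀ a t g k → let y = a + suc t in
    a * g + y * y ≤ g * y → y * y + g * g + y * y ≤ k + (2 * (a * y) + 2 * (a * y)) → k ≤ 1 + 2 * a + 2 * y → k ≤ 3
  energy-bound a t g k h₁ h₂ h₃ = ≤-trans h₃ (≤-reflexive (cong₂ (λ a t → 1 + 2 * a + 2 * (a + suc t)) a≡0 t≡0))
    where
    open ≤-Reasoning
    y²≤gb : (a + suc t) * (a + suc t) ≤ g * suc t
    y²≤gb = +-cancelˡ-≤ (a * g) _ _ (≤-trans h₁ (≤-reflexive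
      (solve 3 (λ a t g → g :* (a :+ (con 1 :+ t)) := a :* g :+ g :* (con 1 :+ t)) refl a t g)))
    g≥ : 2 * a + suc t ≤ g
    g≥ = ≮⇒≥ λ g< → contradiction (begin-strict
      (a + suc t) * (a + suc t) + suc t        ≤⟨ +-monoˡ-≤ (suc t) y²≤gb ⟩
      g * suc t + suc t                        ≡⟨ +-comm (g * suc t) (suc t) ⟩
      suc g * suc t                            ≤⟨ *-monoˡ-≤ (suc t) g< ⟩
      (2 * a + suc t) * suc t                  <⟨ m<m+n _ {a * a + suc t} (≤-trans (s≤s z≤n) (m≤n+m (suc t) (a * a))) ⟩
      (2 * a + suc t) * suc t + (a * a + suc t)  ≡⟨ solve 2 (λ a t → (con 2 :* a :+ (con 1 :+ t)) :* (con 1 :+ t) :+ (a :* a :+ (con 1 :+ t))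
                                                     := (a :+ (con 1 :+ t)) :* (a :+ (con 1 :+ t)) :+ (con 1 :+ t)) refl a t ⟩
      (a + suc t) * (a + suc t) + suc t        ∎) (<-irrefl refl)
    rest = 2 * (a * a) + 4 * (a * t) + 4 * t + 3 * (t * t)
    rest≤0 : rest ≤ 0
    rest≤0 = +-cancelˡ-≤ (1 + 2 * a + 2 * (a + suc t) + (2 * (a * (a + suc t)) + 2 * (a * (a + suc t)))) _ _ (begin
      1 + 2 * a + 2 * (a + suc t) + (2 * (a * (a + suc t)) + 2 * (a * (a + suc t))) + rest
        ≡⟨ solve 2 (λ a t → let y = a :+ (con 1 :+ t) in
             con 1 :+ con 2 :* a :+ con 2 :* y :+ (con 2 :* (a :* y) :+ con 2 :* (a :* y))
               :+ (con 2 :* (a :* a) :+ con 4 :* (a :* t) :+ con 4 :* t :+ con 3 :* (t :* t))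
             := y :* y :+ (con 2 :* a :+ (con 1 :+ t)) :* (con 2 :* a :+ (con 1 :+ t)) :+ y :* y) refl a t ⟩
      (a + suc t) * (a + suc t) + (2 * a + suc t) * (2 * a + suc t) + (a + suc t) * (a + suc t)
        ≤⟨ +-monoˡ-≤ _ (+-monoʳ-≤ ((a + suc t) * (a + suc t)) (*-mono-≤ g≥ g≥)) ⟩
      (a + suc t) * (a + suc t) + g * g + (a + suc t) * (a + suc t)
        ≤⟨ h₂ ⟩
      k + (2 * (a * (a + suc t)) + 2 * (a * (a + suc t)))
        ≤⟨ +-monoˡ-≤ _ h₃ ⟩
      1 + 2 * a + 2 * (a + suc t) + (2 * (a * (a + suc t)) + 2 * (a * (a + suc t)))
        ≡⟨ +-identityʳ _ ⟨
      1 + 2 * a + 2 * (a + suc t) + (2 * (a * (a + suc t)) + 2 * (a * (a + suc t))) + 0 ∎)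
    rest≡0 : rest ≡ 0
    rest≡0 = n≤0⇒n≡0 rest≤0
    s₁≡0 : 2 * (a * a) + 4 * (a * t) + 4 * t ≡ 0
    s₁≡0 = m+n≡0⇒m≡0 _ rest≡0
    t≡0 : t ≡ 0
    t≡0 = m+n≡0⇒m≡0 t (m+n≡0⇒n≡0 (2 * (a * a) + 4 * (a * t)) s₁≡0)
    a≡0 : a ≡ 0
    a≡0 with m*n≡0⇒m≡0∨n≡0 a (m+n≡0⇒m≡0 (a * a) (m+n≡0⇒m≡0 (2 * (a * a)) (m+n≡0⇒m≡0 (2 * (a * a) + 4 * (a * t)) s₁≡0)))
    ... | inj₁ e = e
    ... | inj₂ e = e

  -- In the application a and y count the representations of 1 and of c as differences of elements
  -- of K, and g those of c as a sum. If y is positive, the first bound forces a < y, which gives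
  -- the shape `a + suc t`.
  energy-bound′ : ∀ a y g k → a * g + y * y ≤ g * y → y * y + g * g + y * y ≤ k + (2 * (a * y) + 2 * (a * y)) →
    k ≤ 1 + 2 * a + 2 * y → 1 ≤ g → k ≤ 3
  energy-bound′ a zero g k h₁ h₂ h₃ 1≤g with m*n≡0⇒m≡0∨n≡0 a (n≤0⇒n≡0 (≤-trans (m≤m+n (a * g) 0) (≤-trans h₁ (≤-reflexive (*-zeroʳ g)))))
  ... | inj₁ refl = ≤-trans h₃ (s≤s z≤n)
  ... | inj₂ refl = contradiction 1≤g λ ()
  energy-bound′ a y@(suc _) g k h₁ h₂ h₃ 1≤g = shift (m≤n⇒∃[o]m+o≡n (≰⇒> a≱y)) h₁ h₂ h₃
    where
    a≱y : ¬ y ≤ a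
    a≱y y≤a = <-irrefl refl (<-≤-trans (m<m+n (a * g) {y * y} (s≤s z≤n)) (≤-trans h₁ (≤-trans (≤-reflexive (*-comm g y)) (*-monoˡ-≤ g y≤a))))
    shift : ∀ {y} → (∃ λ t → suc a + t ≡ y) → a * g + y * y ≤ g * y →
      y * y + g * g + y * y ≤ k + (2 * (a * y) + 2 * (a * y)) → k ≤ 1 + 2 * a + 2 * y → k ≤ 3
    shift (t , refl) = subst (λ y → a * g + y * y ≤ g * y → y * y + g * g + y * y ≤ k + (2 * (a * y) + 2 * (a * y)) →
      k ≤ 1 + 2 * a + 2 * y → k ≤ 3) (+-suc a t) (energy-bound a t g k)

open EnergyBound

-- Multipliers

module PrimeField (p : ℕ) (pr : Prime p) where
  instance
    p≢0 : NonZero p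
    p≢0 = prime⇒nonZero pr

  open ZMod p public
  open CommutativeRing commutativeRing public
    using (+-assoc; +-comm; +-identityˡ; +-identityʳ; -‿inverseˡ; -‿inverseʳ; *-assoc; *-comm; *-identityˡ; *-identityʳ; distribˡ; distribʳ; zeroˡ; zeroʳ)
  open IntSolver commutativeRing public
  open Convolution p public
  open Multiples p public

  1<p : 1 < p
  1<p = ℕ.nonTrivial⇒n>1 p {{prime⇒nonTrivial pr}}

  ⟦⟧≢0 : ∀ {n} → 0 < n → n < p → ⟦ n ⟧ ≢ 0#
  ⟦⟧≢0 0<n n<p e = ℕ.<⇒≱ n<p (∣⇒≤ {{ℕ.>-nonZero 0<n}} (⟦⟧≡0⇒∣ e))

  1≢0 : 1# ≢ 0#
  1≢0 = ⟦⟧≢0 (s≤s z≤n) 1<p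

  toℕ>0 : ∀ {x} → x ≢ 0# → 0 < toℕ x
  toℕ>0 {x} x≢0 = ℕ.n≢0⇒n>0 λ e → x≢0 (trans (sym (⟦toℕ⟧ x)) (cong ⟦_⟧ e))

  inverse : ∀ x → x ≢ 0# → ∃ λ y → x * y ≡ 1#
  inverse x x≢0 with coprime-Bézout (prime⇒coprime pr {{ℕ.>-nonZero (toℕ>0 x≢0)}} (toℕ<n x))
  ... | Bézout.+- a b e = - ⟦ b ⟧ , (begin
      x * - ⟦ b ⟧                  ≡⟨ solve 2 (λ x b → x :* (:- b) := nat 1 :- (nat 1 :+ b :* x)) refl x ⟦ b ⟧ ⟩
      1# - (1# + ⟦ b ⟧ * x)        ≡⟨ cong (λ v → 1# - (1# + ⟦ b ⟧ * v)) (⟦toℕ⟧ x) ⟨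
      1# - (1# + ⟦ b ⟧ * ⟦ toℕ x ⟧)  ≡⟨ cong (λ v → 1# - v) (trans (cong (1# +_) (sym (*-homo b (toℕ x)))) (sym (+-homo 1 (b ℕ.* toℕ x)))) ⟩
      1# - ⟦ 1 ℕ.+ b ℕ.* toℕ x ⟧   ≡⟨ cong (λ v → 1# - v) (∣⇒⟦⟧≡0 (subst (p ∣_) (sym e) (n∣m*n a))) ⟩
      1# - 0#                      ≡⟨ solve 0 (nat 1 :- nat 0 := nat 1) refl ⟩
      1# ∎)
    where open ≡-Reasoning
  ... | Bézout.-+ a b e = ⟦ b ⟧ , (begin
      x * ⟦ b ⟧                    ≡⟨ *-comm x ⟦ b ⟧ ⟩
      ⟦ b ⟧ * x                    ≡⟨ cong (⟦ b ⟧ *_) (⟦toℕ⟧ x) ⟨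
      ⟦ b ⟧ * ⟦ toℕ x ⟧            ≡⟨ *-homo b (toℕ x) ⟨
      ⟦ b ℕ.* toℕ x ⟧              ≡⟨ cong ⟦_⟧ e ⟨
      ⟦ 1 ℕ.+ a ℕ.* p ⟧            ≡⟨ ⟦⟧-cong (0 , a , ℕ.+-identityʳ _) ⟩
      1# ∎)
    where open ≡-Reasoning

  -- inv 0 = 0
  inv : F → F
  inv x with x ≟F 0#
  ... | yes _ = 0#
  ... | no x≢0 = proj₁ (inverse x x≢0)

  inv-inverseʳ : ∀ {x} → x ≢ 0# → x * inv x ≡ 1#
  inv-inverseʳ {x} x≢0 with x ≟F 0#
  ... | yes e = contradiction e x≢0
  ... | no x≢0′ = proj₂ (inverse x x≢0′)

  inv-cancelʳ : ∀ {x} y → x ≢ 0# → x * (inv x * y) ≡ y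
  inv-cancelʳ {x} y x≢0 = trans (sym (*-assoc x (inv x) y)) (trans (cong (_* y) (inv-inverseʳ x≢0)) (*-identityˡ y))

  inv-cancelˡ : ∀ {x} y → x ≢ 0# → inv x * (x * y) ≡ y
  inv-cancelˡ {x} y x≢0 = trans (solve 3 (λ x i y → i :* (x :* y) := x :* (i :* y)) refl x (inv x) y) (inv-cancelʳ y x≢0)

  *-cancelˡ : ∀ {x y z} → x ≢ 0# → x * y ≡ x * z → y ≡ z
  *-cancelˡ {x} {y} {z} x≢0 e = trans (sym (inv-cancelˡ y x≢0)) (trans (cong (inv x *_) e) (inv-cancelˡ z x≢0))

  x*y≢0 : ∀ {x y} → x ≢ 0# → y ≢ 0# → x * y ≢ 0#
  x*y≢0 {x} x≢0 y≢0 e = y≢0 (*-cancelˡ x≢0 (trans e (sym (zeroʳ x))))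

  inv≢0 : ∀ {x} → x ≢ 0# → inv x ≢ 0#
  inv≢0 {x} x≢0 e = 1≢0 (trans (sym (inv-inverseʳ x≢0)) (trans (cong (x *_) e) (zeroʳ x)))

  -≢0 : ∀ {x} → x ≢ 0# → - x ≢ 0#
  -≢0 {x} x≢0 e = x≢0 (trans (solve 1 (λ x → x := :- (:- x)) refl x) (trans (cong (λ v → - v) e) (solve 0 (:- nat 0 := nat 0) refl)))

  x-y≡0 : ∀ {x y} → x - y ≡ 0# → x ≡ y
  x-y≡0 {x} {y} e = trans (solve 2 (λ x y → x := (x :- y) :+ y) refl x y) (trans (cong (_+ y) e) (+-identityˡ y))

  multiple : ∀ {x} → x ≢ 0# → ∀ z → z ≡ toℕ (z * inv x) · x
  multiple {x} x≢0 z = sym (begin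
    toℕ (z * inv x) · x        ≡⟨ ·≡* _ x ⟩
    ⟦ toℕ (z * inv x) ⟧ * x    ≡⟨ cong (_* x) (⟦toℕ⟧ _) ⟩
    z * inv x * x              ≡⟨ solve 3 (λ x y z → (z :* y) :* x := z :* (x :* y)) refl x (inv x) z ⟩
    z * (x * inv x)            ≡⟨ cong (z *_) (inv-inverseʳ x≢0) ⟩
    z * 1#                     ≡⟨ *-identityʳ z ⟩
    z ∎)
    where open ≡-Reasoning

  generate : ∀ {Q : F → Set} → (∀ x y → Q x → Q y → Q (x + y)) → ∀ {x} → x ≢ 0# → Q x → ∀ z → Q z
  generate {Q} closed {x} x≢0 qx z = subst Q (sym (multiple x≢0 z)) (go (toℕ (z * inv x)))
    where
    go⁺ : ∀ n → Q (suc n · x)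
    go⁺ zero = subst Q (sym (+-identityʳ x)) qx
    go⁺ (suc n) = closed _ _ qx (go⁺ n)
    go : ∀ n → Q (n · x)
    -- `Q 0#` is not assumed; zero is reached as the positive multiple `p · x`.
    go zero = subst Q (trans (go-p (ℕ.pred p) (ℕ.suc-pred p)) (∣⇒⟦⟧≡0-mul)) (go⁺ (ℕ.pred p))
      where
      go-p : ∀ n → suc n ≡ p → suc n · x ≡ p · x
      go-p n e = cong (_· x) e
      ∣⇒⟦⟧≡0-mul : p · x ≡ 0#
      ∣⇒⟦⟧≡0-mul = trans (·≡* p x) (trans (cong (_* x) (∣⇒⟦⟧≡0 (divides 1 (sym (ℕ.*-identityˡ p))))) (zeroˡ x))
    go (suc n) = go⁺ n

  module Multipliers (d : F → ℕ) (isScheme : Distance.TwoWay.IsScheme p d) where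
    open Distance p
    open TwoWay d
    open SchurRing p d isScheme

    private
      Good : ℕ → Set
      Good n = ∀ x y → τ (⟦ n ⟧ * x) ≡ τ (⟦ n ⟧ * y) → τ x ≡ τ y

      -- Multiplication by q is injective, so q · x is the q-th multiple of exactly one element of
      -- the class of x. By the congruence modulo q, q · y is the multiple of at least one, which
      -- can only be y.
      good-prime : ∀ q → Prime q → q < p → Good q
      good-prime q qpr q<p x y e = trans (sym (proj₁ (proj₂ a))) (cong τ (injective _ y (proj₂ (proj₂ a))))
        where
        instance
          q≢0 : NonZero q
          q≢0 = prime⇒nonZero qpr
        injective : ∀ a b → q · a ≡ q · b → a ≡ b
        injective a b h = *-cancelˡ (⟦⟧≢0 (ℕ.>-nonZero⁻¹ q) q<p) (trans (sym (·≡* q a)) (trans h (·≡* q b)))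
        one : roots q (τ x) (q · x) ≡ 1
        one = count-single (λ a → (τ a ≟τ τ x) ×-dec (q · a ≟F q · x)) x (refl , refl) λ a (_ , h) → injective a x h
        1%q : 1 % q ≡ 1
        1%q = m<n⇒m%n≡m (ℕ.nonTrivial⇒n>1 q {{prime⇒nonTrivial qpr}})
        nonzero : roots q (τ x) (q · y) ≢ 0
        nonzero h = contradiction (trans (sym 1%q) (trans (cong (_% q) (sym one))
          (trans (roots-class qpr (τ x) (q · x) (q · y) (subst₂ (λ u v → τ u ≡ τ v) (sym (·≡* q x)) (sym (·≡* q y)) e))
            (trans (cong (_% q) h) (m<n⇒m%n≡m (ℕ.>-nonZero⁻¹ q)))))) λ ()
        a = count>0⁻ (λ a → (τ a ≟τ τ x) ×-dec (q · a ≟F q · y)) (ℕ.n≢0⇒n>0 nonzero)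

      good-product : ∀ qs → All Prime qs → product qs < p → Good (product qs)
      good-product [] [] _ x y e = subst₂ (λ u v → τ u ≡ τ v) (*-identityˡ x) (*-identityˡ y) e
      good-product (q ∷ qs) (qpr ∷ qprs) n<p x y e =
        good-product qs qprs (ℕ.≤-<-trans (∣⇒≤ (n∣m*n q)) n<p) x y
          (good-prime q qpr (ℕ.≤-<-trans (∣⇒≤ (m∣m*n (product qs))) n<p) _ _
            (subst₂ (λ u v → τ u ≡ τ v) (assoc x) (assoc y) e))
        where
        instance
          _ : NonZero (product (q ∷ qs))
          _ = product≢0 (All.map prime⇒nonZero (qpr ∷ qprs))
        assoc : ∀ x → ⟦ product (q ∷ qs) ⟧ * x ≡ ⟦ q ⟧ * (⟦ product qs ⟧ * x)
        assoc x = trans (cong (_* x) (*-homo q (product qs))) (*-assoc _ _ x)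

    -- `Good` cancels a factor, so it is applied to the natural number representing 1 / v, a product
    -- of primes below p.
    multiplier : ∀ x y v → v ≢ 0# → τ x ≡ τ y → τ (v * x) ≡ τ (v * y)
    multiplier x y v v≢0 e = subst Good (sym n≡) (good-product (factors) primes (subst (_< p) n≡ (toℕ<n (inv v)))) _ _
        (subst₂ (λ u w → τ u ≡ τ w) (undo x) (undo y) e)
      where
      n = toℕ (inv v)
      instance
        n≢0 : NonZero n
        n≢0 = ℕ.>-nonZero (toℕ>0 (inv≢0 v≢0))
      factorisation = factorise n
      open PrimeFactorisation factorisation renaming (isFactorisation to n≡; factorsPrime to primes)
      undo : ∀ x → x ≡ ⟦ n ⟧ * (v * x)
      undo x = sym (trans (cong (_* (v * x)) (⟦toℕ⟧ (inv v)))
        (trans (solve 3 (λ v w x → w :* (v :* x) := (v :* w) :* x) refl v (inv v) x)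
          (trans (cong (_* x) (inv-inverseʳ v≢0)) (*-identityˡ x))))

-- Schemes of prime order

module PrimeCore (p : ℕ) (pr : Prime p) where
  open PrimeField p pr

  module SkewDistance (d : F → ℕ) (isSkew : Distance.TwoWay.IsSkew p d) where
    open Distance p
    open TwoWay d
    open IsSkew isSkew

    infix 4 _∼_
    _∼_ : F → F → Set
    x ∼ y = τ x ≡ τ y

    neg-neg : ∀ x → - - x ≡ x
    neg-neg x = solve 1 (λ x → :- (:- x) := x) refl x

    -0≡0 : - 0# ≡ 0#
    -0≡0 = solve 0 (:- nat 0 := nat 0) refl

    τ-neg : ∀ x → τ (- x) ≡ swap (τ x)
    τ-neg x = cong (λ v → d (- x) , d v) (neg-neg x)

    ∼-neg : ∀ {x y} → x ∼ y → - x ∼ - y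
    ∼-neg {x} {y} e = trans (τ-neg x) (trans (cong swap e) (sym (τ-neg y)))

    ∼-neg⁻ : ∀ {x y} → - x ∼ - y → x ∼ y
    ∼-neg⁻ {x} {y} e = subst₂ _∼_ (neg-neg x) (neg-neg y) (∼-neg e)

    ∼0⇒≡0 : ∀ {x} → x ∼ 0# → x ≡ 0#
    ∼0⇒≡0 {x} e = d≡0 x (trans (cong proj₁ e) d0)

    d≡1⇒≢0 : ∀ {x} → d x ≡ 1 → x ≢ 0#
    d≡1⇒≢0 e refl = contradiction (trans (sym e) d0) λ ()

    -- The group K and its cosets

    K : F → Set
    K x = x ∼ 1#

    K? : Decidable K
    K? x = τ x ≟τ τ 1#

    k : ℕ
    k = count K?

    K1 : K 1#
    K1 = refl

    K⇒d≡1 : ∀ {u} → K u → d u ≡ 1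
    K⇒d≡1 Ku = trans (cong proj₁ Ku) d1

    K⇒≢0 : ∀ {u} → K u → u ≢ 0#
    K⇒≢0 Ku = d≡1⇒≢0 (K⇒d≡1 Ku)

    -- `mult` with factor x, applied to u ∼ 1. Hence classes are unions of cosets of `K`;
    -- `quotient∈K` shows that a nonzero class is a single one.
    K-scale : ∀ {u} x → K u → u * x ∼ x
    K-scale {u} x Ku with x ≟F 0#
    ... | yes refl = cong τ (zeroʳ u)
    ... | no x≢0 = subst₂ _∼_ (*-comm x u) (*-identityʳ x) (mult u 1# x x≢0 Ku)

    K-* : ∀ {u v} → K u → K v → K (u * v)
    K-* {u} {v} Ku Kv = trans (K-scale v Ku) Kv

    K-inv : ∀ {u} → K u → K (inv u)
    K-inv {u} Ku = sym (subst₂ _∼_ (trans (*-comm _ u) (inv-inverseʳ (K⇒≢0 Ku))) (*-identityʳ _)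
      (mult u 1# (inv u) (inv≢0 (K⇒≢0 Ku)) Ku))

    quotient∈K : ∀ {x y} → x ≢ 0# → y ∼ x → K (inv x * y)
    quotient∈K {x} {y} x≢0 e = trans (mult y x (inv x) (inv≢0 x≢0) e)
      (cong τ (trans (*-comm _ x) (inv-inverseʳ x≢0)))

    -- Equality would mean x ∼ - x, and division would put - 1 into `K`, against `d-1`.
    skew : ∀ {x} → x ≢ 0# → d x ≢ d (- x)
    skew {x} x≢0 e = d-1 (trans (cong d -1≡) (K⇒d≡1 (quotient∈K { - x} { x} (-≢0 x≢0) x∼-x)))
      where
      x∼-x : x ∼ - x
      x∼-x = cong₂ _,_ e (trans (sym e) (cong d (sym (neg-neg x))))
      -1≡ : - 1# ≡ inv (- x) * x
      -1≡ = sym (trans (solve 2 (λ i x → i :* x := :- ((:- x) :* i)) refl (inv (- x)) x)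
        (cong (λ v → - v) (inv-inverseʳ (-≢0 x≢0))))

    X Pos : F → Set
    X x = d x ≤ d (- x)
    Pos x = d (- x) < d x

    X? : Decidable X
    X? x = d x ℕ.≤? d (- x)
    Pos? : Decidable Pos
    Pos? x = d (- x) ℕ.<? d x

    X-∼ : ∀ {x y} → x ∼ y → X x → X y
    X-∼ e = subst₂ _≤_ (cong proj₁ e) (cong proj₂ e)

    Pos-∼ : ∀ {x y} → x ∼ y → Pos x → Pos y
    Pos-∼ e = subst₂ _<_ (cong proj₂ e) (cong proj₁ e)

    X⇒¬Pos : ∀ {x} → X x → ¬ Pos x
    X⇒¬Pos = ℕ.≤⇒≯

    ¬X⇒Pos : ∀ {x} → ¬ X x → Pos x
    ¬X⇒Pos = ℕ.≰⇒>

    Pos⇒X-neg : ∀ {x} → Pos x → X (- x)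
    Pos⇒X-neg {x} h = ℕ.≤-trans (ℕ.<⇒≤ h) (ℕ.≤-reflexive (cong d (sym (neg-neg x))))

    Pos-neg : ∀ {s} → d s ≡ 1 → Pos (- s)
    Pos-neg {s} ds = ℕ.≤∧≢⇒< (subst (_≤ d (- s)) (sym (trans (cong d (neg-neg s)) ds))
        (ℕ.n≢0⇒n>0 λ e → -≢0 (d≡1⇒≢0 ds) (d≡0 _ e)))
      λ e → skew (d≡1⇒≢0 ds) (trans (sym (cong d (neg-neg s))) e)

    count-scale : ∀ {P : F → Set} (P? : Decidable P) {v} → v ≢ 0# → count (λ x → P? (v * x)) ≡ count P?
    count-scale P? {v} v≢0 = count-bij P? (v *_) (inv v *_) (λ x → inv-cancelˡ x v≢0) (λ x → inv-cancelʳ x v≢0)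

    count-class : ∀ {x} → x ≢ 0# → count (λ y → τ y ≟τ τ x) ≡ k
    count-class {x} x≢0 = trans (sym (count-scale (λ y → τ y ≟τ τ x) x≢0))
      (count-cong (λ u → τ (x * u) ≟τ τ x) K?
        (λ u e → subst K (inv-cancelˡ u x≢0) (quotient∈K x≢0 e))
        (λ u Ku → subst (_∼ x) (*-comm u x) (K-scale x Ku)))

    V : F → Set
    V v = v ≢ 0# × 1# - v ∼ v

    V? : Decidable V
    V? v = ¬? (v ≟F 0#) ×-dec (τ (1# - v) ≟τ τ v)

    -- The quotient (1 - v) / v lies in `K`, and it determines v because v ((1 - v) / v + 1) = 1.
    |V|≤k : count V? ≤ k
    |V|≤k = count-inj V? K? (λ v → inv v * (1# - v))
      (λ v (v≢0 , e) → quotient∈K v≢0 e)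
      λ v v′ (v≢0 , _) (v′≢0 , _) h → begin
        v                                   ≡⟨ *-identityʳ v ⟨
        v * 1#                              ≡⟨ cong (v *_) (trans (sym (char v′ v′≢0)) (cong (λ w → v′ * (w + 1#)) (sym h))) ⟩
        v * (v′ * (inv v * (1# - v) + 1#))  ≡⟨ solve 3 (λ v v′ w → v :* (v′ :* w) := v′ :* (v :* w)) refl v v′ _ ⟩
        v′ * (v * (inv v * (1# - v) + 1#))  ≡⟨ cong (v′ *_) (char v v≢0) ⟩
        v′ * 1#                             ≡⟨ *-identityʳ v′ ⟩
        v′                                  ∎
      where
      open ≡-Reasoning
      char : ∀ v → v ≢ 0# → v * (inv v * (1# - v) + 1#) ≡ 1#
      char v v≢0 = trans (distribˡ v _ 1#) (trans (cong₂ _+_ (inv-cancelʳ (1# - v) v≢0) (*-identityʳ v))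
        (solve 1 (λ v → (nat 1 :- v) :+ v := nat 1) refl v))

    -- X is the set of x that are no farther from 0 than 0 is from x. A step s leads out of X only from an x with
    -- d (- x) = d x + 1 to an x + s ∼ - x, and then v = - x / s satisfies 1 - v ∼ v and v ∉ K; there are at most
    -- |V| - |V ∩ K| such v. Equally many steps s lead back into X, and those from - s K or into s K are
    -- |V| - |V ∩ K| in number. So both bounds are attained.
    module Flow (s : F) (ds : d s ≡ 1) where

      private
        s≢0 : s ≢ 0#
        s≢0 = d≡1⇒≢0 ds

        -- In the chain d x + 1 ≤ d (- x) ≤ d (- (x + s)) + 1 ≤ d (x + s) ≤ d x + 1 all terms must
        -- agree.
        crossing : ∀ x → X x → Pos (x + s) → d (- x) ≡ suc (d x) × x + s ∼ - x
        crossing x xx pos = d-x≡ , cong₂ _,_ (trans d[x+s]≡ (sym d-x≡)) (trans d[-x-s]≡ (cong d (sym (neg-neg x))))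
          where
          d[x+s]≤ : d (x + s) ≤ suc (d x)
          d[x+s]≤ = ℕ.≤-trans (triangle x s) (ℕ.≤-reflexive (trans (cong (d x ℕ.+_) ds) (ℕ.+-comm (d x) 1)))
          d-x≤ : d (- x) ≤ suc (d (- (x + s)))
          d-x≤ = ℕ.≤-trans (ℕ.≤-reflexive (cong d (solve 2 (λ x s → :- x := s :+ (:- (x :+ s))) refl x s)))
            (ℕ.≤-trans (triangle s (- (x + s))) (ℕ.≤-reflexive (cong (ℕ._+ d (- (x + s))) ds)))
          x≢0 : x ≢ 0#
          x≢0 e = ℕ.<-asym (subst Pos (trans (cong (_+ s) e) (+-identityˡ s)) pos)
            (subst (_< d (- s)) (cong d (neg-neg s)) (Pos-neg ds))
          d-x≥ : suc (d x) ≤ d (- x)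
          d-x≥ = ℕ.≤∧≢⇒< xx (skew x≢0)
          d-x≡ : d (- x) ≡ suc (d x)
          d-x≡ = ℕ.≤-antisym (ℕ.≤-trans d-x≤ (ℕ.≤-trans pos d[x+s]≤)) d-x≥
          d[x+s]≡ : d (x + s) ≡ suc (d x)
          d[x+s]≡ = ℕ.≤-antisym d[x+s]≤ (ℕ.≤-trans d-x≥ (ℕ.≤-trans d-x≤ pos))
          d[-x-s]≡ : d (- (x + s)) ≡ d x
          d[-x-s]≡ = ℕ.≤-antisym (ℕ.≤-pred (ℕ.≤-trans pos d[x+s]≤)) (ℕ.≤-pred (ℕ.≤-trans d-x≥ d-x≤))

        out? : Decidable (λ x → X x × ¬ X (x + s))
        out? x = X? x ×-dec ¬? (X? (x + s))
        in? : Decidable (λ x → X (x + s) × ¬ X x)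
        in? x = X? (x + s) ×-dec ¬? (X? x)

        in≡out : count in? ≡ count out?
        in≡out = ℕ.+-cancelˡ-≡ (count (λ x → X? x ×-dec X? (x + s))) _ _ (begin
          count (λ x → X? x ×-dec X? (x + s)) ℕ.+ count in?
            ≡⟨ cong (ℕ._+ count in?) (count-cong (λ x → X? x ×-dec X? (x + s)) (λ x → X? (x + s) ×-dec X? x) (λ _ → swap) (λ _ → swap)) ⟩
          count (λ x → X? (x + s) ×-dec X? x) ℕ.+ count in?
            ≡⟨ count-split (λ x → X? (x + s)) X? ⟨
          count (λ x → X? (x + s))
            ≡⟨ count-bij X? (_+ s) (λ x → x - s) (λ x → solve 2 (λ x s → (x :+ s) :- s := x) refl x s)
                 (λ x → solve 2 (λ x s → (x :- s) :+ s := x) refl x s) ⟩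
          count X?
            ≡⟨ count-split X? (λ x → X? (x + s)) ⟩
          count (λ x → X? x ×-dec X? (x + s)) ℕ.+ count out? ∎)
          where open ≡-Reasoning

        -- The coordinate v = - x / s, in which the conclusion of `crossing` becomes 1 - v ∼ v.
        pt : F → F
        pt v = - (s * v)

        pt⁻ : F → F
        pt⁻ x = - (inv s * x)

        pt⁻-pt : ∀ v → pt⁻ (pt v) ≡ v
        pt⁻-pt v = trans (solve 3 (λ i s v → :- (i :* (:- (s :* v))) := i :* (s :* v)) refl (inv s) s v) (inv-cancelˡ v s≢0)

        pt-pt⁻ : ∀ x → pt (pt⁻ x) ≡ x
        pt-pt⁻ x = trans (solve 3 (λ i s v → :- (s :* (:- (i :* v))) := s :* (i :* v)) refl (inv s) s x) (inv-cancelʳ x s≢0)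

        V∖K? : Decidable (λ v → V v × ¬ K v)
        V∖K? v = V? v ×-dec ¬? (K? v)
        V∩K? : Decidable (λ v → V v × K v)
        V∩K? v = V? v ×-dec K? v
        a : ℕ
        a = count V∩K?

        pt∼ : ∀ {v} → K v → pt v ∼ - s
        pt∼ {v} Kv = ∼-neg (subst (_∼ s) (*-comm v s) (K-scale s Kv))

        out⇒V∖K : ∀ v → X (pt v) × ¬ X (pt v + s) → V v × ¬ K v
        out⇒V∖K v (xx , ¬x) = (v≢0 , 1-v∼v) , λ Kv → X⇒¬Pos xx (Pos-∼ (sym (pt∼ Kv)) (Pos-neg ds))
          where
          pt+s∼ : pt v + s ∼ - pt v
          pt+s∼ = proj₂ (crossing (pt v) xx (¬X⇒Pos ¬x))
          v≢0 : v ≢ 0#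
          v≢0 refl = s≢0 (trans (solve 1 (λ s → s := (:- (s :* nat 0)) :+ s) refl s) (trans
            (∼0⇒≡0 (subst (pt 0# + s ∼_) (solve 1 (λ s → :- (:- (s :* nat 0)) := nat 0) refl s) pt+s∼)) refl))
          1-v∼v : 1# - v ∼ v
          1-v∼v = subst₂ _∼_
            (trans (cong (inv s *_) (solve 2 (λ s v → (:- (s :* v)) :+ s := s :* (nat 1 :- v)) refl s v)) (inv-cancelˡ _ s≢0))
            (trans (cong (inv s *_) (neg-neg (s * v))) (inv-cancelˡ v s≢0))
            (mult _ _ (inv s) (inv≢0 s≢0) pt+s∼)

        out-pt? : Decidable (λ v → X (pt v) × ¬ X (pt v + s))
        out-pt? v = out? (pt v)

        |out|≡ : count out-pt? ≡ count out?
        |out|≡ = count-bij out? pt pt⁻ pt⁻-pt pt-pt⁻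

        from-s? : Decidable (λ x → x ∼ - s × X (x + s))
        from-s? x = (τ x ≟τ τ (- s)) ×-dec X? (x + s)
        into-s? : Decidable (λ x → ¬ X x × x + s ∼ s)
        into-s? x = ¬? (X? x) ×-dec (τ (x + s) ≟τ τ s)
        either? : Decidable (λ x → (x ∼ - s × X (x + s)) ⊎ (¬ X x × x + s ∼ s))
        either? x = from-s? x ⊎-dec into-s? x

        Xs : X s
        Xs = X-∼ (cong τ (neg-neg s)) (Pos⇒X-neg (Pos-neg ds))

        -- For u in `K` the step s from - s u ends at s - s u. If this lies in `X`, the step starts
        -- in the class of - s. Otherwise s / u - s, which differs from it by a factor in `K`, lies
        -- outside `X`, and the step s takes it to s / u, in the class of s.
        k≤ : k ≤ count from-s? ℕ.+ count into-s?
        k≤ = ℕ.≤-trans (ℕ.≤-reflexive (count-split K? (λ u → X? (pt u + s)))) (ℕ.+-mono-≤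
          (count-inj (λ u → K? u ×-dec X? (pt u + s)) from-s? pt (λ u (Ku , xx) → pt∼ Ku , xx)
            (λ u u′ _ _ h → trans (sym (pt⁻-pt u)) (trans (cong pt⁻ h) (pt⁻-pt u′))))
          (count-inj (λ u → K? u ×-dec ¬? (X? (pt u + s))) into-s? (λ u → s * inv u - s)
            (λ u (Ku , ¬x) → (λ xx → ¬x (X-∼ (sym (flip u Ku)) xx)) ,
              subst (_∼ s) (solve 2 (λ s i → i :* s := (s :* i :- s) :+ s) refl s (inv u)) (K-scale s (K-inv Ku)))
            (λ u u′ (Ku , _) (Ku′ , _) h → inv-injective Ku Ku′ (*-cancelˡ s≢0 (minus-injective h)))))
          where
          minus-injective : ∀ {w w′} → w - s ≡ w′ - s → w ≡ w′
          minus-injective {w} {w′} h = trans (solve 2 (λ s w → w := (w :- s) :+ s) refl s w)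
            (trans (cong (_+ s) h) (solve 2 (λ s w → (w :- s) :+ s := w) refl s w′))
          flip : ∀ u → K u → pt u + s ∼ s * inv u - s
          flip u Ku = trans (cong τ (sym (trans
              (solve 3 (λ s u i → u :* (s :* i :- s) := s :* (u :* i) :- s :* u) refl s u (inv u))
              (trans (cong (λ w → s * w - s * u) (inv-inverseʳ (K⇒≢0 Ku))) (solve 2 (λ s u → s :* nat 1 :- s :* u := (:- (s :* u)) :+ s) refl s u)))))
            (K-scale (s * inv u - s) Ku)
          inv-injective : ∀ {u u′} → K u → K u′ → inv u ≡ inv u′ → u ≡ u′
          inv-injective {u} {u′} Ku Ku′ h = *-cancelˡ (inv≢0 (K⇒≢0 Ku))
            (trans (trans (*-comm _ u) (inv-inverseʳ (K⇒≢0 Ku))) (sym (trans (cong (_* u′) h) (trans (*-comm _ u′) (inv-inverseʳ (K⇒≢0 Ku′))))))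

        -- Such an x is - s v with both v and 1 - v in `K`.
        both≤a : count (λ x → from-s? x ×-dec into-s? x) ≤ a
        both≤a = ℕ.≤-trans (ℕ.≤-reflexive (sym (count-bij (λ x → from-s? x ×-dec into-s? x) pt pt⁻ pt⁻-pt pt-pt⁻)))
          (count-mono (λ v → from-s? (pt v) ×-dec into-s? (pt v)) V∩K? λ v ((e , _) , (_ , e′)) →
            let Kv : K v
                Kv = subst K (inv-cancelˡ v s≢0) (quotient∈K s≢0 (∼-neg⁻ e))
                K1-v : K (1# - v)
                K1-v = subst K (trans (cong (inv s *_) (solve 2 (λ s v → (:- (s :* v)) :+ s := s :* (nat 1 :- v)) refl s v)) (inv-cancelˡ _ s≢0))
                         (quotient∈K s≢0 e′)
            in (K⇒≢0 Kv , trans K1-v (sym Kv)) , Kv)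

        either⇒in : ∀ x → (x ∼ - s × X (x + s)) ⊎ (¬ X x × x + s ∼ s) → X (x + s) × ¬ X x
        either⇒in x (inj₁ (e , xx)) = xx , λ xx′ → X⇒¬Pos xx′ (Pos-∼ (sym e) (Pos-neg ds))
        either⇒in x (inj₂ (¬x , e)) = X-∼ (sym e) Xs , ¬x

        open ℕ.≤-Reasoning

        k≤either+a : k ≤ count either? ℕ.+ a
        k≤either+a = begin
          k                                                                        ≤⟨ k≤ ⟩
          count from-s? ℕ.+ count into-s?                                        ≡⟨ count-incl-excl from-s? into-s? ⟩
          count either? ℕ.+ count (λ x → from-s? x ×-dec into-s? x)              ≤⟨ ℕ.+-monoʳ-≤ _ both≤a ⟩
          count either? ℕ.+ a                                                    ∎

        V≤k : count V∖K? ℕ.+ a ≤ k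
        V≤k = begin
          count V∖K? ℕ.+ a   ≡⟨ ℕ.+-comm (count V∖K?) a ⟩
          a ℕ.+ count V∖K?   ≡⟨ count-split V? K? ⟨
          count V?             ≤⟨ |V|≤k ⟩
          k                    ∎

        out≤V : count out? ≤ count V∖K?
        out≤V = ℕ.≤-trans (ℕ.≤-reflexive (sym |out|≡)) (count-mono out-pt? V∖K? out⇒V∖K)

        -- The bounds form a cycle: out is at most the count of `V∖K?`, which is at most k - a,
        -- which is at most either, which is at most in, and in equals out. This inequality and
        -- `V≤out` are two links read backwards.
        in≤either : count in? ≤ count either?
        in≤either = ℕ.+-cancelʳ-≤ a _ _ (begin
          count in? ℕ.+ a      ≡⟨ cong (ℕ._+ a) in≡out ⟩
          count out? ℕ.+ a     ≤⟨ ℕ.+-monoˡ-≤ a out≤V ⟩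
          count V∖K? ℕ.+ a     ≤⟨ V≤k ⟩
          k                      ≤⟨ k≤either+a ⟩
          count either? ℕ.+ a  ∎)

        V≤out : count V∖K? ≤ count out-pt?
        V≤out = ℕ.+-cancelʳ-≤ a _ _ (begin
          count V∖K? ℕ.+ a     ≤⟨ V≤k ⟩
          k                      ≤⟨ k≤either+a ⟩
          count either? ℕ.+ a  ≤⟨ ℕ.+-monoˡ-≤ a (count-mono either? in? either⇒in) ⟩
          count in? ℕ.+ a      ≡⟨ cong (ℕ._+ a) (trans in≡out (sym |out|≡)) ⟩
          count out-pt? ℕ.+ a  ∎)

      return : ∀ x → Pos x → X (x + s) → x ∼ - s ⊎ x + s ∼ s
      return x pos xx = Sum.map proj₁ proj₂ (count-tight either? in? either⇒in in≤either x (xx , λ xx′ → X⇒¬Pos xx′ pos))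

      departure : ∀ v → V v → ¬ K v → d (s * v) ≡ suc (d (- (s * v)))
      departure v Vv ¬Kv = let xx , ¬x = count-tight out-pt? V∖K? out⇒V∖K V≤out v (Vv , ¬Kv) in
        trans (cong d (sym (neg-neg (s * v)))) (proj₁ (crossing (pt v) xx (¬X⇒Pos ¬x)))

    -- Inversion turns b (1 - w) ∼ z into b (1 - 1 / w) ∼ - z. By `skew` the two conditions exclude
    -- each other, and w = 1 satisfies neither.
    half : ∀ {b z} → b ≢ 0# → z ≢ 0# → let c = count (λ w → K? w ×-dec (τ (b * (1# - w)) ≟τ τ z)) in c ℕ.+ c < k
    half {b} {z} b≢0 z≢0 = ℕ.≤-<-trans (ℕ.+-monoʳ-≤ (count A?) A≤B)
      (ℕ.≤-<-trans (ℕ.≤-reflexive (trans (count-incl-excl A? B?) (trans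
        (cong (count (λ w → A? w ⊎-dec B? w) ℕ.+_) (count-none (λ w → A? w ×-dec B? w)
          λ w ((_ , e) , (_ , e′)) → skew z≢0 (cong proj₁ (trans (sym e) e′)))) (ℕ.+-identityʳ _))))
        (count-strict (λ w → A? w ⊎-dec B? w) K? (λ where w (inj₁ h) → proj₁ h; w (inj₂ h) → proj₁ h) 1# K1
          λ where (inj₁ (_ , e)) → z≢0 (∼0⇒≡0 (trans (sym e) b[1-1]))
                  (inj₂ (_ , e)) → -≢0 z≢0 (∼0⇒≡0 (trans (sym e) b[1-1]))))
      where
      A? : Decidable (λ w → K w × b * (1# - w) ∼ z)
      A? w = K? w ×-dec (τ (b * (1# - w)) ≟τ τ z)
      B? : Decidable (λ w → K w × b * (1# - w) ∼ - z)
      B? w = K? w ×-dec (τ (b * (1# - w)) ≟τ τ (- z))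
      b[1-1] : b * (1# - 1#) ∼ 0#
      b[1-1] = cong τ (solve 1 (λ b → b :* (nat 1 :- nat 1) := nat 0) refl b)
      A≤B : count A? ≤ count B?
      A≤B = count-inj A? B? inv
        (λ w (Kw , e) → K-inv Kw , trans (sym (K-scale (b * (1# - inv w)) Kw)) (trans (cong τ (trans
            (solve 3 (λ b w i → w :* (b :* (nat 1 :- i)) := b :* w :- b :* (w :* i)) refl b w (inv w))
            (trans (cong (λ v → b * w - b * v) (inv-inverseʳ (K⇒≢0 Kw)))
              (solve 2 (λ b w → b :* w :- b :* nat 1 := :- (b :* (nat 1 :- w))) refl b w)))) (∼-neg e)))
        (λ w w′ (Kw , _) (Kw′ , _) h → *-cancelˡ (inv≢0 (K⇒≢0 Kw)) (trans (trans (*-comm _ w) (inv-inverseʳ (K⇒≢0 Kw)))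
          (sym (trans (cong (_* w′) h) (trans (*-comm _ w′) (inv-inverseʳ (K⇒≢0 Kw′)))))))

    -- If b - α′ with α′ ∼ α is not in the class of b, then `return` puts α′ - b into the class of α.
    one-type : ∀ α b → d α ≡ 1 → d b ≡ 1 → α ∼ b
    one-type α b dα db = decidable-stable (τ α ≟τ τ b) impossible
      where
      α≢0 = d≡1⇒≢0 dα
      b≢0 = d≡1⇒≢0 db
      impossible : ¬ ¬ α ∼ b
      -- By `half` each of `c₁` and `c₂` is below k / 2, yet `K` is covered by two sets of at most
      -- these sizes.
      impossible α≁b = ℕ.<⇒≱ (ℕ.+-mono-< (half b≢0 α≢0) (half α≢0 b≢0))
        (ℕ.≤-trans (ℕ.+-mono-≤ k≤ k≤) (ℕ.≤-reflexive (interchange c₁ c₂ c₁ c₂)))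
        where
        open import Algebra.Properties.CommutativeSemigroup ℕ.+-commutativeSemigroup using (interchange)
        c₁ = count (λ w → K? w ×-dec (τ (b * (1# - w)) ≟τ τ α))
        c₂ = count (λ w → K? w ×-dec (τ (α * (1# - w)) ≟τ τ b))
        P₁? : Decidable (λ w → K w × b - α * w ∼ b)
        P₁? w = K? w ×-dec (τ (b - α * w) ≟τ τ b)
        P₂? : Decidable (λ w → K w × α * w - b ∼ α)
        P₂? w = K? w ×-dec (τ (α * w - b) ≟τ τ α)
        cover : ∀ w → K w → (K w × b - α * w ∼ b) ⊎ (K w × α * w - b ∼ α)
        cover w Kw = split (X? (b - α * w))
          where
          αw∼α : α * w ∼ α
          αw∼α = trans (cong τ (*-comm α w)) (K-scale α Kw)
          dαw : d (α * w) ≡ 1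
          dαw = trans (cong proj₁ αw∼α) dα
          split : Dec (X (b - α * w)) → (K w × b - α * w ∼ b) ⊎ (K w × α * w - b ∼ α)
          split (yes xx) = inj₁ (Kw , Sum.[ (λ e → contradiction (trans (sym αw∼α) (∼-neg⁻ e)) α≁b) , trans (cong τ (+-comm b (- (α * w)))) ]
            (Flow.return b db (- (α * w)) (Pos-neg dαw) (X-∼ (cong τ (+-comm b (- (α * w)))) xx)))
          split (no ¬x) = inj₂ (Kw , Sum.[ (λ e → contradiction (trans (sym αw∼α) (sym (∼-neg⁻ e))) α≁b) ,
              (λ e → trans (cong τ (+-comm (α * w) (- b))) (trans e αw∼α)) ]
            (Flow.return (α * w) dαw (- b) (Pos-neg db)
              (X-∼ (cong τ (solve 2 (λ a b → :- (b :- a) := (:- b) :+ a) refl (α * w) b)) (Pos⇒X-neg (¬X⇒Pos ¬x)))))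
        P₁≤ : count P₁? ≤ c₁
        P₁≤ = count-inj P₁? (λ w → K? w ×-dec (τ (b * (1# - w)) ≟τ τ α)) (λ w → inv b * (b - α * w))
          (λ w (Kw , e) → quotient∈K b≢0 e ,
            trans (cong τ (trans (distribˡ b 1# _) (trans (cong₂ _+_ (*-identityʳ b)
                (trans (solve 2 (λ b v → b :* (:- v) := :- (b :* v)) refl b (inv b * (b - α * w))) (cong (λ v → - v) (inv-cancelʳ (b - α * w) b≢0))))
                (solve 3 (λ b α w → b :+ (:- (b :- α :* w)) := w :* α) refl b α w))))
              (K-scale α Kw))
          (λ w w′ _ _ h → *-cancelˡ α≢0 (trans (solve 2 (λ b v → v := b :- (b :- v)) refl b (α * w))
            (trans (cong (λ v → b - v) (*-cancelˡ (inv≢0 b≢0) h)) (solve 2 (λ b v → b :- (b :- v) := v) refl b (α * w′)))))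
        P₂≤ : count P₂? ≤ c₂
        P₂≤ = count-inj P₂? (λ w → K? w ×-dec (τ (α * (1# - w)) ≟τ τ b)) (λ w → 1# - inv (α * w) * b)
          (λ w (Kw , e) → let αw≢0 = x*y≢0 α≢0 (K⇒≢0 Kw) in
            subst K (trans (distribˡ (inv (α * w)) (α * w) (- b)) (trans (cong (_+ inv (α * w) * (- b)) (trans (*-comm _ (α * w)) (inv-inverseʳ αw≢0)))
                (solve 2 (λ i b → nat 1 :+ i :* (:- b) := nat 1 :- i :* b) refl (inv (α * w)) b)))
              (quotient∈K αw≢0 (trans e (sym (trans (cong τ (*-comm α w)) (K-scale α Kw))))) ,
            trans (sym (K-scale _ Kw)) (cong τ (trans
              (solve 4 (λ α w i b → w :* (α :* (nat 1 :- (nat 1 :- i :* b))) := ((α :* w) :* i) :* b) refl α w (inv (α * w)) b)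
              (trans (cong (_* b) (inv-inverseʳ αw≢0)) (*-identityˡ b)))))
          (λ w w′ (Kw , _) (Kw′ , _) h → let αw≢0 = x*y≢0 α≢0 (K⇒≢0 Kw); αw′≢0 = x*y≢0 α≢0 (K⇒≢0 Kw′)
                                             i = inv (α * w); i′ = inv (α * w′) in
            let i≡i′ : i ≡ i′
                i≡i′ = *-cancelˡ b≢0 (trans (solve 2 (λ b i → b :* i := nat 1 :- (nat 1 :- i :* b)) refl b i)
                  (trans (cong (λ v → 1# - v) h) (solve 2 (λ b i → nat 1 :- (nat 1 :- i :* b) := b :* i) refl b i′)))
            in *-cancelˡ α≢0 (*-cancelˡ (inv≢0 αw≢0) (trans (trans (*-comm i _) (inv-inverseʳ αw≢0))
                 (sym (trans (cong (_* (α * w′)) i≡i′) (trans (*-comm i′ _) (inv-inverseʳ αw′≢0)))))))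
        k≤ : k ≤ c₁ ℕ.+ c₂
        k≤ = begin
          k                                                                    ≤⟨ count-mono K? (λ w → P₁? w ⊎-dec P₂? w) cover ⟩
          count (λ w → P₁? w ⊎-dec P₂? w)                                      ≤⟨ ℕ.m≤m+n _ _ ⟩
          count (λ w → P₁? w ⊎-dec P₂? w) ℕ.+ count (λ w → P₁? w ×-dec P₂? w)  ≡⟨ count-incl-excl P₁? P₂? ⟨
          count P₁? ℕ.+ count P₂?                                            ≤⟨ ℕ.+-mono-≤ P₁≤ P₂≤ ⟩
          c₁ ℕ.+ c₂                                                          ∎
          where open ℕ.≤-Reasoning

    d≡1⇒K : ∀ {x} → d x ≡ 1 → K x
    d≡1⇒K {x} e = one-type x 1# e d1

    step : ∀ {u} x → K u → d (u + x) ≤ suc (d x)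
    step {u} x Ku = ℕ.≤-trans (triangle u x) (ℕ.≤-reflexive (cong (ℕ._+ d x) (K⇒d≡1 Ku)))

    K-pred : ∀ {x n} → d x ≡ suc n → ∃₂ λ u z → K u × d z ≡ n × x ≡ u + z
    K-pred {x} {n} e = let u , z , du , dz , eq = d-pred x n e in u , z , d≡1⇒K du , dz , eq

    -- Closed walks and the distance h from 0 to - 1

    h : ℕ
    h = d (- 1#)

    K⇒d-≡h : ∀ {u} → K u → d (- u) ≡ h
    K⇒d-≡h Ku = cong proj₂ Ku

    h≥2 : 2 ≤ h
    h≥2 = subst (λ n → suc n ≤ h) (trans (cong d (neg-neg 1#)) d1) (Pos-neg d1)

    K-sum≢0 : ∀ {u v} → K u → K v → u + v ≢ 0#
    K-sum≢0 {u} {v} Ku Kv e = ℕ.<⇒≢ h≥2 (trans (sym (K⇒d≡1 (subst K v≡-u Kv))) (K⇒d-≡h Ku))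
      where
      v≡-u : v ≡ - u
      v≡-u = trans (solve 2 (λ u v → v := (u :+ v) :- u) refl u v) (trans (cong (λ w → w - u) e) (+-identityˡ (- u)))

    -- -1 = u₁ + u₂ + u₃ would put 1 + u₁ = - (u₂ + u₃) at distance 2 in both directions.
    h≢3 : h ≢ 3
    h≢3 h≡3 = skew x≢0 (trans dx≡2 (sym d-x≡2))
      where
      s₁ = K-pred h≡3
      u₁ = proj₁ s₁
      Ku₁ = proj₁ (proj₂ (proj₂ s₁))
      s₂ = K-pred (proj₁ (proj₂ (proj₂ (proj₂ s₁))))
      u₂ = proj₁ s₂
      u₃ = proj₁ (proj₂ s₂)
      Ku₂ = proj₁ (proj₂ (proj₂ s₂))
      du₃ = proj₁ (proj₂ (proj₂ (proj₂ s₂)))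
      x = 1# + u₁
      -x≡ : - x ≡ u₂ + u₃
      -x≡ = trans (solve 2 (λ o u → :- (o :+ u) := (:- o) :- u) refl 1# u₁) (trans (cong (λ w → w - u₁) (trans
        (proj₂ (proj₂ (proj₂ (proj₂ s₁)))) (cong (u₁ +_) (proj₂ (proj₂ (proj₂ (proj₂ s₂)))))))
        (solve 3 (λ u v w → (u :+ (v :+ w)) :- u := v :+ w) refl u₁ u₂ u₃))
      x≢0 : x ≢ 0#
      x≢0 = K-sum≢0 K1 Ku₁
      dx≤2 : d x ≤ 2
      dx≤2 = ℕ.≤-trans (step u₁ K1) (s≤s (ℕ.≤-reflexive (K⇒d≡1 Ku₁)))
      d-x≤2 : d (- x) ≤ 2
      d-x≤2 = ℕ.≤-trans (ℕ.≤-reflexive (cong d -x≡)) (ℕ.≤-trans (step u₃ Ku₂) (s≤s (ℕ.≤-reflexive du₃)))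
      two : ∀ y → y ≢ 0# → d y ≤ 2 → d (- y) ≤ 2 → d y ≡ 2
      two y y≢0 dy≤2 d-y≤2 with d y in e
      ... | 0 = contradiction (d≡0 y e) y≢0
      ... | 1 = contradiction d-y≤2 (ℕ.<⇒≱ (ℕ.≤-reflexive (sym (trans (K⇒d-≡h (d≡1⇒K e)) h≡3))))
      ... | 2 = refl
      ... | suc (suc (suc _)) = contradiction dy≤2 λ where (s≤s (s≤s ()))
      dx≡2 = two x x≢0 dx≤2 d-x≤2
      d-x≡2 = two (- x) (-≢0 x≢0) d-x≤2 (ℕ.≤-trans (ℕ.≤-reflexive (cong d (neg-neg x))) dx≤2)

    -- A closed walk of minimal length h + 1 ≥ 5 has all its steps equal. The sum b of two of its steps always lies in
    -- one class B, and u ↦ b - u preserves {u ∈ K | b - u ∈ K}. For any other step c this set is {u ∈ K | c + u ∈ B},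
    -- hence independent of the two steps, and it is invariant under translation by differences of steps.
    module Long (r : ℕ) (h≡ : h ≡ 4 ℕ.+ r) where

      β : ℕ × ℕ
      β = 2 , 3 ℕ.+ r

      -- The rest z of the walk bounds d (- (a + a′)) from above, and d (- a) = 4 + r bounds it from
      -- below. As it is smaller than h, the sum cannot lie in `K`.
      pair : ∀ {a a′} z → K a → K a′ → d z ≤ 3 ℕ.+ r → a + a′ + z ≡ 0# → τ (a + a′) ≡ β
      pair {a} {a′} z Ka Ka′ dz e = cong₂ _,_ dx≡2 (ℕ.≤-antisym d-x≤ d-x≥)
        where
        x = a + a′
        -x≡z : - x ≡ z
        -x≡z = trans (solve 2 (λ x z → :- x := z :- (x :+ z)) refl x z) (trans (cong (λ w → z - w) e) (solve 1 (λ z → z :- nat 0 := z) refl z))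
        d-x≤ : d (- x) ≤ 3 ℕ.+ r
        d-x≤ = subst (λ w → d w ≤ 3 ℕ.+ r) (sym -x≡z) dz
        d-x≥ : 3 ℕ.+ r ≤ d (- x)
        d-x≥ = ℕ.≤-pred (ℕ.≤-trans (ℕ.≤-reflexive (trans (sym h≡) (trans (sym (K⇒d-≡h Ka))
          (cong d (solve 2 (λ a b → :- a := b :+ (:- (a :+ b))) refl a a′))))) (step (- x) Ka′))
        dx≤2 : d x ≤ 2
        dx≤2 = ℕ.≤-trans (step a′ Ka) (s≤s (ℕ.≤-reflexive (K⇒d≡1 Ka′)))
        dx≡2 : d x ≡ 2
        dx≡2 with d x in eq
        ... | 0 = contradiction (d≡0 x eq) (K-sum≢0 Ka Ka′)
        ... | 1 = contradiction d-x≤ (ℕ.<⇒≱ (ℕ.≤-reflexive (sym (trans (K⇒d-≡h (d≡1⇒K eq)) h≡))))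
        ... | 2 = refl
        ... | suc (suc (suc _)) = contradiction dx≤2 (subst (λ n → ¬ n ≤ 2) (sym eq) λ where (s≤s (s≤s ())))

      R? : ∀ b → Decidable (λ u → K u × K (b - u))
      R? b u = K? u ×-dec K? (b - u)
      N? : ∀ x → Decidable (λ u → K u × τ (x + u) ≡ β)
      N? x u = K? u ×-dec (τ (x + u) ≟τ β)

      -- If x + u has type β, then w = (x + u) / b is in `K`, and dividing by w gives b = x / w + u
      -- / w. The summand x / w determines u.
      N≤R : ∀ {b x} → K x → τ b ≡ β → count (N? x) ≤ count (R? b)
      N≤R {b} {x} Kx eb = count-inj (N? x) (R? b) (λ u → x * inv (w u))
        (λ u (Ku , e) → let Kw = quotient∈K b≢0 (trans e (sym eb)) in
          K-* Kx (K-inv Kw) , subst K (sym (rest u Kw)) (K-* Ku (K-inv Kw)))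
        (λ u u′ (Ku , e) (Ku′ , e′) eq →
          let Kw = quotient∈K b≢0 (trans e (sym eb)); Kw′ = quotient∈K b≢0 (trans e′ (sym eb)) in
          trans (solve 2 (λ x u → u := (x :+ u) :- x) refl x u) (trans (cong (λ v → v - x)
            (*-cancelˡ (inv≢0 b≢0) (inv-injective Kw Kw′ (*-cancelˡ (K⇒≢0 Kx) eq))))
            (solve 2 (λ x u → (x :+ u) :- x := u) refl x u′)))
        where
        b≢0 : b ≢ 0#
        b≢0 refl = contradiction (trans (sym d0) (cong proj₁ eb)) λ ()
        w : F → F
        w u = inv b * (x + u)
        rest : ∀ u → K (w u) → b - x * inv (w u) ≡ u * inv (w u)
        rest u Kw = trans (cong (λ v → v - x * inv (w u)) (trans (sym (*-identityʳ b)) (trans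
          (cong (b *_) (sym (inv-inverseʳ (K⇒≢0 Kw)))) (trans (sym (*-assoc b (w u) (inv (w u)))) (cong (_* inv (w u)) (inv-cancelʳ (x + u) b≢0))))))
          (solve 3 (λ x u i → (x :+ u) :* i :- x :* i := u :* i) refl x u (inv (w u)))
        inv-injective : ∀ {u u′} → K u → K u′ → inv u ≡ inv u′ → u ≡ u′
        inv-injective {u} {u′} Ku Ku′ e = *-cancelˡ (inv≢0 (K⇒≢0 Ku))
          (trans (trans (*-comm _ u) (inv-inverseʳ (K⇒≢0 Ku))) (sym (trans (cong (_* u′) e) (trans (*-comm _ u′) (inv-inverseʳ (K⇒≢0 Ku′))))))

      -- Counting identifies both `S₁₂` and `S₁₃` with the set of u for which c₅ + u has type β.
      -- Composing the reflections in c₁ + c₂ and c₁ + c₃ shifts this set by c₃ - c₂; a nonzero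
      -- shift, repeated, would carry c₁ to 0.
      five : ∀ {c₁ c₂ c₃ c₄ c₅} z → K c₁ → K c₂ → K c₃ → K c₄ → K c₅ → d z ≤ r →
        c₁ + c₂ + c₃ + c₄ + c₅ + z ≡ 0# → c₂ ≡ c₃
      five {c₁} {c₂} {c₃} {c₄} {c₅} z K₁ K₂ K₃ K₄ K₅ dz e = decidable-stable (c₂ ≟F c₃) λ c₂≢c₃ →
          K⇒≢0 (proj₁ (generate {λ y → ∀ u → S₁₂ u → S₁₂ (u + y)}
            (λ x y sx sy u su → subst S₁₂ (+-assoc u x y) (sy _ (sx u su)))
            {c₃ - c₂} (λ eq → c₂≢c₃ (sym (x-y≡0 eq))) shift (- c₁) c₁
              (K₁ , subst K (solve 2 (λ a b → b := (a :+ b) :- a) refl c₁ c₂) K₂))) (-‿inverseʳ c₁)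
        where
        S₁₂ S₁₃ : F → Set
        S₁₂ u = K u × K (c₁ + c₂ - u)
        S₁₃ u = K u × K (c₁ + c₃ - u)
        dz₃ : ∀ {u v} → K u → K v → ∀ {x} → K x → d (x + (u + (v + z))) ≤ 3 ℕ.+ r
        dz₃ Ku Kv Kx = ℕ.≤-trans (step _ Kx) (s≤s (ℕ.≤-trans (step _ Ku) (s≤s (ℕ.≤-trans (step z Kv) (s≤s dz)))))
        R₁₂⊆N : ∀ u → K u × K (c₁ + c₂ - u) → K u × τ (c₅ + u) ≡ β
        R₁₂⊆N u (Ku , Ku′) = Ku , pair ((c₁ + c₂ - u) + (c₃ + (c₄ + z))) K₅ Ku (dz₃ K₃ K₄ Ku′)
          (trans (solve 7 (λ a b c d e u z → (e :+ u) :+ (((a :+ b) :- u) :+ (c :+ (d :+ z))) := ((((a :+ b) :+ c) :+ d) :+ e) :+ z) refl c₁ c₂ c₃ c₄ c₅ u z) e)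
        R₁₃⊆N : ∀ u → K u × K (c₁ + c₃ - u) → K u × τ (c₅ + u) ≡ β
        R₁₃⊆N u (Ku , Ku′) = Ku , pair ((c₁ + c₃ - u) + (c₂ + (c₄ + z))) K₅ Ku (dz₃ K₂ K₄ Ku′)
          (trans (solve 7 (λ a b c d e u z → (e :+ u) :+ (((a :+ c) :- u) :+ (b :+ (d :+ z))) := ((((a :+ b) :+ c) :+ d) :+ e) :+ z) refl c₁ c₂ c₃ c₄ c₅ u z) e)
        N⊆R₁₂ : ∀ u → K u × τ (c₅ + u) ≡ β → K u × K (c₁ + c₂ - u)
        N⊆R₁₂ = count-tight (R? (c₁ + c₂)) (N? c₅) R₁₂⊆N (N≤R K₅ (pair (c₃ + (c₄ + (c₅ + z))) K₁ K₂ (dz₃ K₄ K₅ K₃)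
          (trans (solve 6 (λ a b c d e z → (a :+ b) :+ (c :+ (d :+ (e :+ z))) := ((((a :+ b) :+ c) :+ d) :+ e) :+ z) refl c₁ c₂ c₃ c₄ c₅ z) e)))
        N⊆R₁₃ : ∀ u → K u × τ (c₅ + u) ≡ β → K u × K (c₁ + c₃ - u)
        N⊆R₁₃ = count-tight (R? (c₁ + c₃)) (N? c₅) R₁₃⊆N (N≤R K₅ (pair (c₂ + (c₄ + (c₅ + z))) K₁ K₃ (dz₃ K₄ K₅ K₂)
          (trans (solve 6 (λ a b c d e z → (a :+ c) :+ (b :+ (d :+ (e :+ z))) := ((((a :+ b) :+ c) :+ d) :+ e) :+ z) refl c₁ c₂ c₃ c₄ c₅ z) e)))
        shift : ∀ u → S₁₂ u → S₁₂ (u + (c₃ - c₂))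
        shift u su@(Ku , Ku′) = N⊆R₁₂ _ (R₁₃⊆N _ (subst S₁₃
          (solve 4 (λ a b c u → (a :+ c) :- ((a :+ b) :- u) := u :+ (c :- b)) refl c₁ c₂ c₃ u)
          (proj₂ t , subst K (solve 3 (λ a c v → v := (a :+ c) :- ((a :+ c) :- v)) refl c₁ c₃ (c₁ + c₂ - u)) (proj₁ t))))
          where
          t : S₁₃ (c₁ + c₂ - u)
          t = N⊆R₁₃ _ (R₁₂⊆N _ (Ku′ , subst K (solve 3 (λ a b u → u := (a :+ b) :- ((a :+ b) :- u)) refl c₁ c₂ u) Ku))

      first-step : ∀ u → K u → d (- 1# - u) ≡ 3 ℕ.+ r → u ≡ 1#
      first-step u Ku e =
        let c₃ , z₃ , K₃ , e₃ , eq₃ = K-pred e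
            c₄ , z₄ , K₄ , e₄ , eq₄ = K-pred e₃
            c₅ , z , K₅ , e₅ , eq₅ = K-pred e₄
        -- The closed walk is reordered so that 1 and u become its second and third steps, the ones
        -- that `five` compares.
        in sym (five z K₃ K1 Ku K₄ K₅ (ℕ.≤-reflexive e₅) (closed c₃ c₄ c₅ z
             (trans eq₃ (cong (c₃ +_) (trans eq₄ (cong (c₄ +_) eq₅))))))
        where
        open ≡-Reasoning
        closed : ∀ c₃ c₄ c₅ z → - 1# - u ≡ c₃ + (c₄ + (c₅ + z)) → c₃ + 1# + u + c₄ + c₅ + z ≡ 0#
        closed c₃ c₄ c₅ z eq = begin
          c₃ + 1# + u + c₄ + c₅ + z          ≡⟨ solve 6 (λ o u a b c z → ((((a :+ o) :+ u) :+ b) :+ c) :+ z := (o :+ u) :+ (a :+ (b :+ (c :+ z)))) refl 1# u c₃ c₄ c₅ z ⟩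
          (1# + u) + (c₃ + (c₄ + (c₅ + z)))  ≡⟨ cong ((1# + u) +_) eq ⟨
          (1# + u) + (- 1# - u)              ≡⟨ solve 2 (λ o u → (o :+ u) :+ ((:- o) :- u) := nat 0) refl 1# u ⟩
          0# ∎

      d⟦⟧≤ : ∀ n → d ⟦ n ⟧ ≤ n
      d⟦⟧≤ zero = ℕ.≤-reflexive d0
      d⟦⟧≤ (suc n) = ℕ.≤-trans (ℕ.≤-reflexive (cong d (+-homo 1 n))) (ℕ.≤-trans (step ⟦ n ⟧ K1) (s≤s (d⟦⟧≤ n)))

      unwind : ∀ j e → j ℕ.+ e ≡ h → d (- 1# - ⟦ j ⟧) ≡ e → - 1# - ⟦ h ⟧ ≡ 0#
      unwind j zero jh dj = subst (λ n → - 1# - ⟦ n ⟧ ≡ 0#) (trans (sym (ℕ.+-identityʳ j)) jh) (d≡0 _ dj)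
      unwind j (suc e) jh dj = unwind (suc j) e (trans (sym (ℕ.+-suc j e)) jh) (trans (cong d z≡) dz)
        where
        s = K-pred dj
        u = proj₁ s
        z = proj₁ (proj₂ s)
        Ku = proj₁ (proj₂ (proj₂ s))
        dz = proj₁ (proj₂ (proj₂ (proj₂ s)))
        eq = proj₂ (proj₂ (proj₂ (proj₂ s)))
        -1-u≡ : - 1# - u ≡ ⟦ j ⟧ + z
        -1-u≡ = trans (solve 3 (λ o u j → (:- o) :- u := (((:- o) :- j) :- u) :+ j) refl 1# u ⟦ j ⟧)
          (trans (cong (λ w → w - u + ⟦ j ⟧) eq) (solve 3 (λ u z j → ((u :+ z) :- u) :+ j := j :+ z) refl u z ⟦ j ⟧))
        upper : d (- 1# - u) ≤ 3 ℕ.+ r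
        upper = ℕ.≤-trans (ℕ.≤-reflexive (cong d -1-u≡)) (ℕ.≤-trans (triangle ⟦ j ⟧ z)
          (ℕ.≤-trans (ℕ.+-mono-≤ (d⟦⟧≤ j) (ℕ.≤-reflexive dz)) (ℕ.≤-reflexive (ℕ.suc-injective (trans (sym (ℕ.+-suc j e)) (trans jh h≡))))))
        lower : 3 ℕ.+ r ≤ d (- 1# - u)
        lower = ℕ.≤-pred (ℕ.≤-trans (ℕ.≤-reflexive (trans (sym h≡) (cong d (solve 2 (λ o u → :- o := u :+ ((:- o) :- u)) refl 1# u)))) (step (- 1# - u) Ku))
        z≡ : - 1# - ⟦ suc j ⟧ ≡ z
        z≡ = begin
          - 1# - ⟦ suc j ⟧           ≡⟨ cong (λ w → - 1# - w) (+-homo 1 j) ⟩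
          - 1# - (1# + ⟦ j ⟧)        ≡⟨ solve 2 (λ o j → (:- o) :- (o :+ j) := ((:- o) :- j) :- o) refl 1# ⟦ j ⟧ ⟩
          - 1# - ⟦ j ⟧ - 1#          ≡⟨ cong₂ (λ v w → v - w) eq (sym (first-step u Ku (ℕ.≤-antisym upper lower))) ⟩
          u + z - u                  ≡⟨ solve 2 (λ u z → (u :+ z) :- u := z) refl u z ⟩
          z ∎
          where open ≡-Reasoning

      trivial-K : ∀ u → K u → u ≡ 1#
      trivial-K u Ku = trans (sym (⟦toℕ⟧ u)) (cong ⟦_⟧ (ℕ.≤-antisym n≤1 (toℕ>0 (K⇒≢0 Ku))))
        where
        n = toℕ u
        ⟦1+h⟧≡0 : ⟦ suc h ⟧ ≡ 0#
        ⟦1+h⟧≡0 = begin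
          ⟦ suc h ⟧            ≡⟨ +-homo 1 h ⟩
          1# + ⟦ h ⟧           ≡⟨ solve 2 (λ o h → o :+ h := :- ((:- o) :- h)) refl 1# ⟦ h ⟧ ⟩
          - (- 1# - ⟦ h ⟧)     ≡⟨ cong (λ w → - w) (unwind 0 h refl (cong d (solve 1 (λ o → (:- o) :- nat 0 := :- o) refl 1#))) ⟩
          - 0#                 ≡⟨ -0≡0 ⟩
          0# ∎
          where open ≡-Reasoning
        -u≡ : - u ≡ ⟦ p ℕ.∸ n ⟧
        -u≡ = begin
          - u                              ≡⟨ +-identityˡ (- u) ⟨
          0# - u                           ≡⟨ cong₂ (λ v w → v - w) (sym (∣⇒⟦⟧≡0 (divides 1 (trans (ℕ.m∸n+n≡m (ℕ.<⇒≤ (toℕ<n u))) (sym (ℕ.*-identityˡ p)))))) (sym (⟦toℕ⟧ u)) ⟩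
          ⟦ (p ℕ.∸ n) ℕ.+ n ⟧ - ⟦ n ⟧      ≡⟨ cong (λ v → v - ⟦ n ⟧) (+-homo (p ℕ.∸ n) n) ⟩
          ⟦ p ℕ.∸ n ⟧ + ⟦ n ⟧ - ⟦ n ⟧      ≡⟨ solve 2 (λ a b → (a :+ b) :- b := a) refl ⟦ p ℕ.∸ n ⟧ ⟦ n ⟧ ⟩
          ⟦ p ℕ.∸ n ⟧ ∎
          where open ≡-Reasoning
        h≤ : h ≤ p ℕ.∸ n
        h≤ = ℕ.≤-trans (ℕ.≤-reflexive (trans (sym (K⇒d-≡h Ku)) (cong d -u≡))) (d⟦⟧≤ (p ℕ.∸ n))
        n≤1 : n ≤ 1
        n≤1 = ℕ.+-cancelˡ-≤ h _ _ (ℕ.≤-trans (ℕ.+-monoˡ-≤ n h≤)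
          (ℕ.≤-trans (ℕ.≤-reflexive (ℕ.m∸n+n≡m (ℕ.<⇒≤ (toℕ<n u)))) (ℕ.≤-trans (∣⇒≤ (⟦⟧≡0⇒∣ ⟦1+h⟧≡0)) (ℕ.≤-reflexive (ℕ.+-comm 1 h)))))

    ⟪_⟫ : F → F → ℕ
    ⟪ x ⟫ y = χ (τ y ≟τ τ x)

    sum-⟪⟫ : ∀ {x} → x ≢ 0# → sum ⟪ x ⟫ ≡ k
    sum-⟪⟫ x≢0 = count-class x≢0

    ⟪⟫-cong : ∀ {x x′} → x ∼ x′ → ∀ y → ⟪ x ⟫ y ≡ ⟪ x′ ⟫ y
    ⟪⟫-cong e y = cong (λ t → χ (τ y ≟τ t)) e

    ⟪⟫-reflect : ∀ x y → reflect ⟪ x ⟫ y ≡ ⟪ - x ⟫ y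
    ⟪⟫-reflect x y = χ-cong (τ (- y) ≟τ τ x) (τ y ≟τ τ (- x))
      (λ e → ∼-neg⁻ (trans e (cong τ (sym (neg-neg x))))) (λ e → trans (∼-neg e) (cong τ (neg-neg x)))

    P : F → F → F → ℕ
    P x y = ⟪ x ⟫ ⋆ ⟪ y ⟫

    P≡count : ∀ x y z → P x y z ≡ count (λ w → (τ w ≟τ τ x) ×-dec (τ (z - w) ≟τ τ y))
    P≡count x y z = sum-cong-≗ λ w → sym (χ-× (τ w ≟τ τ x) (τ (z - w) ≟τ τ y))

    P-support : ∀ x y z → P x y z ≢ 0 → ∃ λ w → w ∼ x × z - w ∼ y
    P-support x y z h = count>0⁻ (λ w → (τ w ≟τ τ x) ×-dec (τ (z - w) ≟τ τ y)) (ℕ.n≢0⇒n>0 λ e → h (trans (P≡count x y z) e))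

    P>0 : ∀ x y z w → w ∼ x → z - w ∼ y → 1 ≤ P x y z
    P>0 x y z w e e′ = subst (1 ≤_) (sym (P≡count x y z)) (count>0 (λ w → (τ w ≟τ τ x) ×-dec (τ (z - w) ≟τ τ y)) w (e , e′))

    P-comm : ∀ x y z → P x y z ≡ P y x z
    P-comm x y z = ⋆-comm ⟪ x ⟫ ⟪ y ⟫ z

    P-cong : ∀ {x x′ y y′} → x ∼ x′ → y ∼ y′ → ∀ z → P x y z ≡ P x′ y′ z
    P-cong e e′ z = ⋆-cong (⟪⟫-cong e) (⟪⟫-cong e′) z

    P-scale : ∀ v x y z → v ≢ 0# → P (v * x) (v * y) (v * z) ≡ P x y z
    P-scale v x y z v≢0 = trans
      (sym (sum-bij (v *_) (inv v *_) (λ w → inv-cancelˡ w v≢0) (λ w → inv-cancelʳ w v≢0) (λ w → ⟪ v * x ⟫ w ℕ.* ⟪ v * y ⟫ (v * z - w))))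
      (sum-cong-≗ λ w → cong₂ ℕ._*_ (unscale x w)
        (trans (cong ⟪ v * y ⟫ (solve 3 (λ v z w → v :* z :- v :* w := v :* (z :- w)) refl v z w)) (unscale y (z - w))))
      where
      unscale : ∀ x w → ⟪ v * x ⟫ (v * w) ≡ ⟪ x ⟫ w
      unscale x w = χ-cong (τ (v * w) ≟τ τ (v * x)) (τ w ≟τ τ x)
        (λ e → subst₂ _∼_ (inv-cancelˡ w v≢0) (inv-cancelˡ x v≢0) (mult _ _ (inv v) (inv≢0 v≢0) e))
        (mult w x v v≢0)

    P-neg : ∀ x y z → P (- x) (- y) (- z) ≡ P x y z
    P-neg x y z = trans (cong₂ (λ a b → P a b (- z)) (neg≡ x) (neg≡ y)) (trans (cong (P (- 1# * x) (- 1# * y)) (neg≡ z))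
      (P-scale (- 1#) x y z (-≢0 1≢0)))
      where
      neg≡ : ∀ x → - x ≡ - 1# * x
      neg≡ x = solve 1 (λ x → :- x := (:- nat 1) :* x) refl x

    P-∼ : ∀ x y {z z′} → z ≢ 0# → z′ ∼ z → P x y z′ ≡ P x y z
    P-∼ x y {z} {z′} z≢0 e = begin
      P x y z′                   ≡⟨ cong (P x y) (trans (*-comm u z) (inv-cancelʳ z′ z≢0)) ⟨
      P x y (u * z)              ≡⟨ P-cong (K-scale x Ku) (K-scale y Ku) (u * z) ⟨
      P (u * x) (u * y) (u * z)  ≡⟨ P-scale u x y z (K⇒≢0 Ku) ⟩
      P x y z                    ∎
      where
      open ≡-Reasoning
      u = inv z * z′
      Ku = quotient∈K z≢0 e

    inv-injective : ∀ {u u′} → u ≢ 0# → u′ ≢ 0# → inv u ≡ inv u′ → u ≡ u′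
    inv-injective {u} {u′} u≢0 u′≢0 e = *-cancelˡ (inv≢0 u≢0)
      (trans (trans (*-comm _ u) (inv-inverseʳ u≢0)) (sym (trans (cong (_* u′) e) (trans (*-comm _ u′) (inv-inverseʳ u′≢0)))))

    -- Rotating the equation w + t = z, with w ∼ x and t ∼ y, to t - z = - w.
    rotate≤ : ∀ x y z → x ≢ 0# → z ≢ 0# → P x y z ≤ P y (- z) (- x)
    rotate≤ x y z x≢0 z≢0 = subst₂ _≤_ (sym (P≡count x y z)) (sym (P≡count y (- z) (- x)))
      (count-inj (λ w → (τ w ≟τ τ x) ×-dec (τ (z - w) ≟τ τ y)) (λ t → (τ t ≟τ τ y) ×-dec (τ (- x - t) ≟τ τ (- z)))
        (λ w → (z - w) * inv (u w))
        (λ w (e , e′) → let Ku = quotient∈K x≢0 e in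
          trans (cong τ (*-comm (z - w) (inv (u w)))) (trans (K-scale (z - w) (K-inv Ku)) e′) ,
          trans (cong τ (trans (solve 2 (λ x t → (:- x) :- t := :- (x :+ t)) refl x ((z - w) * inv (u w))) (cong (λ v → - v) (total w Ku))))
            (∼-neg (trans (cong τ (*-comm z (inv (u w)))) (K-scale z (K-inv Ku)))))
        (λ w w′ (e , _) (e′ , _) h → let Ku = quotient∈K x≢0 e; Ku′ = quotient∈K x≢0 e′ in
          *-cancelˡ (inv≢0 x≢0) (inv-injective (K⇒≢0 Ku) (K⇒≢0 Ku′) (*-cancelˡ z≢0
            (trans (sym (total w Ku)) (trans (cong (x +_) h) (total w′ Ku′)))))))
      where
      u : F → F
      u w = inv x * w
      total : ∀ w → K (u w) → x + (z - w) * inv (u w) ≡ z * inv (u w)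
      total w Ku = begin
        x + (z - w) * i           ≡⟨ cong (_+ (z - w) * i) (trans (sym (*-identityʳ x)) (cong (x *_) (sym (inv-inverseʳ (K⇒≢0 Ku))))) ⟩
        x * (u w * i) + (z - w) * i  ≡⟨ cong (_+ (z - w) * i) (trans (sym (*-assoc x (u w) i)) (cong (_* i) (inv-cancelʳ w x≢0))) ⟩
        w * i + (z - w) * i       ≡⟨ solve 3 (λ w z i → w :* i :+ (z :- w) :* i := z :* i) refl w z i ⟩
        z * i                     ∎
        where
        open ≡-Reasoning
        i = inv (u w)

    rotate : ∀ x y z → x ≢ 0# → y ≢ 0# → z ≢ 0# → P x y z ≡ P y (- z) (- x)
    rotate x y z x≢0 y≢0 z≢0 = ℕ.≤-antisym (rotate≤ x y z x≢0 z≢0) (ℕ.≤-trans (rotate≤ y (- z) (- x) y≢0 (-≢0 x≢0))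
      (ℕ.≤-trans (ℕ.≤-reflexive (cong (λ v → P (- z) v (- y)) (neg-neg x)))
        (ℕ.≤-trans (rotate≤ (- z) x (- y) (-≢0 z≢0) (-≢0 y≢0))
          (ℕ.≤-reflexive (cong₂ (P x) (neg-neg y) (neg-neg z))))))

    sum-P : ∀ {x y} → x ≢ 0# → y ≢ 0# → sum (P x y) ≡ k ℕ.* k
    sum-P {x} {y} x≢0 y≢0 = trans (sum-⋆ ⟪ x ⟫ ⟪ y ⟫) (cong₂ ℕ._*_ (sum-⟪⟫ x≢0) (sum-⟪⟫ y≢0))

    exchange-P : ∀ x y z t → ⟨ P x y ∙ P z t ⟩ ≡ ⟨ P x (- z) ∙ P (- y) t ⟩
    exchange-P x y z t = trans (exchange ⟪ x ⟫ ⟪ y ⟫ ⟪ z ⟫ ⟪ t ⟫) (sum-cong-≗ λ v → cong₂ ℕ._*_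
      (⋆-cong {⟪ x ⟫} {⟪ x ⟫} {reflect ⟪ z ⟫} {⟪ - z ⟫} (λ _ → refl) (⟪⟫-reflect z) v)
      (⋆-cong {reflect ⟪ y ⟫} {⟪ - y ⟫} {⟪ t ⟫} {⟪ t ⟫} (⟪⟫-reflect y) (λ _ → refl) v))

    ⟨∙⟩-congʳ : ∀ f {g g′} → (∀ z → g z ≡ g′ z) → ⟨ f ∙ g ⟩ ≡ ⟨ f ∙ g′ ⟩
    ⟨∙⟩-congʳ f e = sum-cong-≗ λ z → cong (f z ℕ.*_) (e z)

    classSum : List F → (F → ℕ) → F → ℕ
    classSum [] g z = 0
    classSum (x ∷ xs) g z = g x ℕ.* ⟪ x ⟫ z ℕ.+ classSum xs g z

    total : List F → (F → ℕ) → ℕ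
    total [] g = 0
    total (x ∷ xs) g = g x ℕ.+ total xs g

    sum-classSum : ∀ {xs} g → All (_≢ 0#) xs → sum (classSum xs g) ≡ total xs g ℕ.* k
    sum-classSum {[]} g [] = sum-zero {p} λ _ → refl
    sum-classSum {x ∷ xs} g (x≢0 ∷ xs≢0) = begin
      sum (λ z → g x ℕ.* ⟪ x ⟫ z ℕ.+ classSum xs g z)             ≡⟨ ∑-distrib-+ (λ z → g x ℕ.* ⟪ x ⟫ z) (classSum xs g) ⟩
      sum (λ z → g x ℕ.* ⟪ x ⟫ z) ℕ.+ sum (classSum xs g)          ≡⟨ cong₂ ℕ._+_ (trans (sym (*-distribˡ-sum (g x) ⟪ x ⟫)) (cong (g x ℕ.*_) (sum-⟪⟫ x≢0))) (sum-classSum g xs≢0) ⟩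
      g x ℕ.* k ℕ.+ total xs g ℕ.* k                              ≡⟨ ℕ.*-distribʳ-+ k (g x) (total xs g) ⟨
      (g x ℕ.+ total xs g) ℕ.* k                                    ∎
      where open ≡-Reasoning

    ClassInvariant : (F → ℕ) → Set
    ClassInvariant g = ∀ {z z′} → z ≢ 0# → z′ ∼ z → g z′ ≡ g z

    classSum≤ : ∀ {xs} g → ClassInvariant g → All (_≢ 0#) xs → AllPairs (λ x y → ¬ x ∼ y) xs → ∀ z → classSum xs g z ≤ g z
    classSum≤ g inv [] [] z = z≤n
    classSum≤ {x ∷ xs} g inv (x≢0 ∷ xs≢0) (x≁xs ∷ distinct) z = go (τ z ≟τ τ x) refl
      where
      none : ∀ {ys} → z ∼ x → All (λ y → ¬ x ∼ y) ys → classSum ys g z ≡ 0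
      none e [] = refl
      none {y ∷ ys} e (x≁y ∷ rest) = cong₂ ℕ._+_
        (trans (cong (g y ℕ.*_) (χ-no (τ z ≟τ τ y) λ e′ → x≁y (trans (sym e) e′))) (ℕ.*-zeroʳ (g y))) (none e rest)
      go : (dec : Dec (z ∼ x)) → dec ≡ (τ z ≟τ τ x) → g x ℕ.* ⟪ x ⟫ z ℕ.+ classSum xs g z ≤ g z
      go (yes e) _ = ℕ.≤-reflexive (trans (cong₂ ℕ._+_
        (trans (cong (g x ℕ.*_) (χ-yes (τ z ≟τ τ x) e)) (ℕ.*-identityʳ (g x))) (none e x≁xs))
        (trans (ℕ.+-identityʳ (g x)) (sym (inv x≢0 e))))
      go (no ¬e) _ = ℕ.≤-trans (ℕ.≤-reflexive (cong (ℕ._+ classSum xs g z)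
        (trans (cong (g x ℕ.*_) (χ-no (τ z ≟τ τ x) ¬e)) (ℕ.*-zeroʳ (g x))))) (classSum≤ g inv xs≢0 distinct z)

    ≤classSum : ∀ {xs} g → ClassInvariant g → All (_≢ 0#) xs → ∀ {z} → Any (z ∼_) xs → g z ≤ classSum xs g z
    ≤classSum {x ∷ xs} g inv (x≢0 ∷ _) {z} (here e) = ℕ.≤-trans (ℕ.≤-reflexive (trans (inv x≢0 e)
      (sym (trans (cong (g x ℕ.*_) (χ-yes (τ z ≟τ τ x) e)) (ℕ.*-identityʳ (g x)))))) (ℕ.m≤m+n _ _)
    ≤classSum {x ∷ xs} g inv (_ ∷ xs≢0) (there h) = ℕ.≤-trans (≤classSum g inv xs≢0 h) (ℕ.m≤n+m _ _)

    lower-bound : ∀ {xs} g → ClassInvariant g → All (_≢ 0#) xs → AllPairs (λ x y → ¬ x ∼ y) xs → total xs g ℕ.* k ≤ sum g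
    lower-bound g inv xs≢0 distinct = ℕ.≤-trans (ℕ.≤-reflexive (sym (sum-classSum g xs≢0))) (sum-mono (classSum≤ g inv xs≢0 distinct))

    upper-bound : ∀ {xs} g → ClassInvariant g → All (_≢ 0#) xs → (∀ z → z ≢ 0# → g z ≢ 0 → Any (z ∼_) xs) →
      sum g ≤ g 0# ℕ.+ total xs g ℕ.* k
    upper-bound {xs} g inv xs≢0 support = begin
      sum g                                              ≤⟨ sum-mono pointwise ⟩
      sum (λ z → g 0# ℕ.* δ 0# z ℕ.+ classSum xs g z)      ≡⟨ ∑-distrib-+ (λ z → g 0# ℕ.* δ 0# z) (classSum xs g) ⟩
      sum (λ z → g 0# ℕ.* δ 0# z) ℕ.+ sum (classSum xs g)  ≡⟨ cong₂ ℕ._+_ at0 (sum-classSum g xs≢0) ⟩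
      g 0# ℕ.+ total xs g ℕ.* k                            ∎
      where
      open ℕ.≤-Reasoning
      g0≡ : g 0# ℕ.* δ 0# 0# ≡ g 0#
      g0≡ = trans (cong (g 0# ℕ.*_) (χ-yes (0# ≟F 0#) refl)) (ℕ.*-identityʳ (g 0#))
      at0 : sum (λ z → g 0# ℕ.* δ 0# z) ≡ g 0#
      at0 = trans (sum-single 0# λ z z≢0 → trans (cong (g 0# ℕ.*_) (χ-no (0# ≟F z) (z≢0 ∘ sym))) (ℕ.*-zeroʳ (g 0#))) g0≡
      pointwise : ∀ z → g z ≤ g 0# ℕ.* δ 0# z ℕ.+ classSum xs g z
      pointwise z = go (z ≟F 0#) (g z ℕ.≟ 0)
        where
        go : Dec (z ≡ 0#) → Dec (g z ≡ 0) → g z ≤ g 0# ℕ.* δ 0# z ℕ.+ classSum xs g z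
        go (yes refl) _ = ℕ.≤-trans (ℕ.≤-reflexive (sym g0≡)) (ℕ.m≤m+n _ _)
        go (no _) (yes e) = ℕ.≤-trans (ℕ.≤-reflexive e) z≤n
        go (no z≢0) (no gz≢0) = ℕ.≤-trans (≤classSum g inv xs≢0 (support z z≢0 gz≢0)) (ℕ.m≤n+m _ _)

    k-odd : ∃ λ n → k ≡ 1 ℕ.+ (n ℕ.+ n)
    k-odd = count A? , (begin
      k                                                        ≡⟨ count-remove K? 1# K1 ⟩
      suc (count (λ w → K? w ×-dec ¬? (w ≟F 1#)))              ≡⟨ cong suc (count-split (λ w → K? w ×-dec ¬? (w ≟F 1#)) (λ w → Pos? (1# - w))) ⟩
      suc (count C? ℕ.+ count D?)                              ≡⟨ cong (λ v → suc (v ℕ.+ count D?)) (count-cong C? A? (λ w ((Kw , _) , h) → Kw , h) (λ w (Kw , h) → (Kw , A⇒≢1 w h) , h)) ⟩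
      suc (count A? ℕ.+ count D?)                              ≡⟨ cong (λ v → suc (count A? ℕ.+ v)) (trans (count-cong D? B? D⇒B B⇒D) (ℕ.≤-antisym B≤A A≤B)) ⟩
      suc (count A? ℕ.+ count A?)                              ∎)
      where
      open ≡-Reasoning
      A? : Decidable (λ w → K w × Pos (1# - w))
      A? w = K? w ×-dec Pos? (1# - w)
      B? : Decidable (λ w → K w × Pos (w - 1#))
      B? w = K? w ×-dec Pos? (w - 1#)
      C? : Decidable (λ w → (K w × w ≢ 1#) × Pos (1# - w))
      C? w = (K? w ×-dec ¬? (w ≟F 1#)) ×-dec Pos? (1# - w)
      D? : Decidable (λ w → (K w × w ≢ 1#) × ¬ Pos (1# - w))
      D? w = (K? w ×-dec ¬? (w ≟F 1#)) ×-dec ¬? (Pos? (1# - w))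
      neg-diff : ∀ w → - (1# - w) ≡ w - 1#
      neg-diff w = solve 2 (λ o w → :- (o :- w) := w :- o) refl 1# w
      ¬Pos0 : ∀ {x} → x ≡ 0# → ¬ Pos x
      ¬Pos0 refl h = ℕ.<-irrefl refl (subst (λ v → d v < d 0#) -0≡0 h)
      A⇒≢1 : ∀ w → Pos (1# - w) → w ≢ 1#
      A⇒≢1 w h refl = ¬Pos0 (-‿inverseʳ 1#) h
      D⇒B : ∀ w → (K w × w ≢ 1#) × ¬ Pos (1# - w) → K w × Pos (w - 1#)
      D⇒B w ((Kw , w≢1) , ¬pos) = Kw , subst Pos (neg-diff w) (ℕ.≤∧≢⇒< (ℕ.≤-trans (ℕ.≤-reflexive (cong d (neg-neg (1# - w)))) (ℕ.≮⇒≥ ¬pos))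
        λ e → skew (λ e′ → w≢1 (sym (x-y≡0 e′))) (trans (sym (cong d (neg-neg (1# - w)))) e))
      B⇒D : ∀ w → K w × Pos (w - 1#) → (K w × w ≢ 1#) × ¬ Pos (1# - w)
      B⇒D w (Kw , h) = (Kw , λ where refl → ¬Pos0 (-‿inverseʳ 1#) h) ,
        X⇒¬Pos (X-∼ (cong τ (solve 2 (λ o w → :- (w :- o) := o :- w) refl 1# w)) (Pos⇒X-neg h))
      swapped : ∀ w → K w → inv w - 1# ∼ 1# - w
      swapped w Kw = trans (sym (K-scale (inv w - 1#) Kw)) (cong τ (trans (distribˡ w (inv w) (- 1#))
        (trans (cong (_+ w * - 1#) (inv-inverseʳ (K⇒≢0 Kw))) (solve 1 (λ w → nat 1 :+ w :* (:- nat 1) := nat 1 :- w) refl w))))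
      swapped′ : ∀ w → K w → 1# - inv w ∼ w - 1#
      swapped′ w Kw = trans (cong τ (solve 2 (λ o i → o :- i := :- (i :- o)) refl 1# (inv w)))
        (trans (∼-neg (swapped w Kw)) (cong τ (neg-diff w)))
      inj : ∀ w w′ → K w → K w′ → inv w ≡ inv w′ → w ≡ w′
      inj w w′ Kw Kw′ = inv-injective (K⇒≢0 Kw) (K⇒≢0 Kw′)
      A≤B : count A? ≤ count B?
      A≤B = count-inj A? B? inv (λ w (Kw , h) → K-inv Kw , Pos-∼ (sym (swapped w Kw)) h) (λ w w′ (Kw , _) (Kw′ , _) → inj w w′ Kw Kw′)
      B≤A : count B? ≤ count A?
      B≤A = count-inj B? A? inv (λ w (Kw , h) → K-inv Kw , Pos-∼ (sym (swapped′ w Kw)) h) (λ w w′ (Kw , _) (Kw′ , _) → inj w w′ Kw Kw′)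

    module Short (h≡2 : h ≡ 2) where

      C D : F → Set
      C z = τ z ≡ (2 , 3)
      D z = τ z ≡ (2 , 4)

      τ1 : τ 1# ≡ (1 , 2)
      τ1 = cong₂ _,_ d1 h≡2

      K-neg⇒τ : ∀ {z} → K (- z) → τ z ≡ (2 , 1)
      K-neg⇒τ {z} K-z = trans (cong τ (sym (neg-neg z))) (trans (τ-neg (- z)) (cong swap (trans K-z τ1)))

      C-neg⇒τ : ∀ {z} → C (- z) → τ z ≡ (3 , 2)
      C-neg⇒τ {z} C-z = trans (cong τ (sym (neg-neg z))) (trans (τ-neg (- z)) (cong swap C-z))

      classify : ∀ {x} → x ≢ 0# → d x ≤ 3 → d (- x) ≤ 3 → K x ⊎ K (- x) ⊎ C x ⊎ C (- x)
      classify {x} x≢0 = go (d x) (d (- x)) refl refl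
        where
        go : ∀ i j → d x ≡ i → d (- x) ≡ j → i ≤ 3 → j ≤ 3 → K x ⊎ K (- x) ⊎ C x ⊎ C (- x)
        go 0 _ e _ _ _ = contradiction (d≡0 x e) x≢0
        go 1 _ e _ _ _ = inj₁ (d≡1⇒K e)
        go _ 0 _ e _ _ = contradiction (d≡0 (- x) e) (-≢0 x≢0)
        go _ 1 _ e _ _ = inj₂ (inj₁ (d≡1⇒K e))
        go 2 2 e e′ _ _ = contradiction (trans e (sym e′)) (skew x≢0)
        go 2 3 e e′ _ _ = inj₂ (inj₂ (inj₁ (cong₂ _,_ e e′)))
        go 3 2 e e′ _ _ = inj₂ (inj₂ (inj₂ (cong₂ _,_ e′ (trans (cong d (neg-neg x)) e))))
        go 3 3 e e′ _ _ = contradiction (trans e (sym e′)) (skew x≢0)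
        go (suc (suc (suc (suc _)))) _ _ _ (s≤s (s≤s (s≤s ()))) _
        go _ (suc (suc (suc (suc _)))) _ _ _ (s≤s (s≤s (s≤s ())))

      difference : ∀ {u v} → K u → K v → u ≢ v → K (u - v) ⊎ K (- (u - v)) ⊎ C (u - v) ⊎ C (- (u - v))
      difference {u} {v} Ku Kv u≢v = classify (u≢v ∘ x-y≡0)
        (ℕ.≤-trans (step (- v) Ku) (s≤s (ℕ.≤-reflexive (trans (K⇒d-≡h Kv) h≡2))))
        (ℕ.≤-trans (ℕ.≤-reflexive (cong d (solve 2 (λ u v → :- (u :- v) := v :+ (:- u)) refl u v)))
          (ℕ.≤-trans (step (- u) Kv) (s≤s (ℕ.≤-reflexive (trans (K⇒d-≡h Ku) h≡2)))))

      K-sum : ∀ {u v} → K u → K v → K (u + v) ⊎ K (- (u + v)) ⊎ C (u + v) ⊎ D (u + v)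
      K-sum {u} {v} Ku Kv = go (d x) (d (- x)) refl refl
          (ℕ.≤-trans (step v Ku) (s≤s (ℕ.≤-reflexive (K⇒d≡1 Kv))))
          (ℕ.≤-trans (ℕ.≤-reflexive (cong d (solve 2 (λ u v → :- (u :+ v) := (:- u) :+ (:- v)) refl u v)))
            (ℕ.≤-trans (triangle (- u) (- v)) (ℕ.≤-reflexive (cong₂ ℕ._+_ (trans (K⇒d-≡h Ku) h≡2) (trans (K⇒d-≡h Kv) h≡2)))))
        where
        x = u + v
        x≢0 = K-sum≢0 Ku Kv
        go : ∀ i j → d x ≡ i → d (- x) ≡ j → i ≤ 2 → j ≤ 4 → K x ⊎ K (- x) ⊎ C x ⊎ D x
        go 0 _ e _ _ _ = contradiction (d≡0 x e) x≢0
        go 1 _ e _ _ _ = inj₁ (d≡1⇒K e)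
        go _ 0 _ e _ _ = contradiction (d≡0 (- x) e) (-≢0 x≢0)
        go _ 1 _ e _ _ = inj₂ (inj₁ (d≡1⇒K e))
        go 2 2 e e′ _ _ = contradiction (trans e (sym e′)) (skew x≢0)
        go 2 3 e e′ _ _ = inj₂ (inj₂ (inj₁ (cong₂ _,_ e e′)))
        go 2 4 e e′ _ _ = inj₂ (inj₂ (inj₂ (cong₂ _,_ e e′)))
        go (suc (suc (suc _))) _ _ _ (s≤s (s≤s ())) _
        go _ (suc (suc (suc (suc (suc _))))) _ _ _ (s≤s (s≤s (s≤s (s≤s ()))))

      module NoC (C-free : ∀ z → ¬ C z) where

        nonzero : ∀ {x i} → d x ≡ suc i → x ≢ 0#
        nonzero e refl = contradiction (trans (sym d0) e) λ ()

        no-classify : ∀ {x} → d x ≡ 3 → d (- x) ≤ 3 → ⊥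
        no-classify {x} dx≡3 d-x≤3 = go (classify (nonzero dx≡3) (ℕ.≤-reflexive dx≡3) d-x≤3)
          where
          go : K x ⊎ K (- x) ⊎ C x ⊎ C (- x) → ⊥
          go (inj₁ Kx) = contradiction (trans (sym dx≡3) (K⇒d≡1 Kx)) λ ()
          go (inj₂ (inj₁ K-x)) = contradiction (trans (sym dx≡3) (cong proj₁ (K-neg⇒τ K-x))) λ ()
          go (inj₂ (inj₂ (inj₁ Cx))) = C-free x Cx
          go (inj₂ (inj₂ (inj₂ C-x))) = C-free (- x) C-x

        no-D : ∀ f → ¬ D f
        no-D f Df = go (K-pred (cong proj₂ Df))
          where
          go : (∃₂ λ u z → K u × d z ≡ 3 × - f ≡ u + z) → ⊥
          go (u , z , Ku , dz , eq) = no-classify dz (ℕ.≤-trans (ℕ.≤-reflexive (cong d -z≡))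
              (ℕ.≤-trans (step f Ku) (s≤s (ℕ.≤-reflexive (cong proj₁ Df)))))
            where
            -z≡ : - z ≡ u + f
            -z≡ = trans (solve 2 (λ u z → :- z := u :- (u :+ z)) refl u z)
              (trans (cong (λ v → u - v) (sym eq)) (solve 2 (λ u f → u :- (:- f) := u :+ f) refl u f))

        no-3 : ∀ x → d x ≢ 3
        no-3 x dx = go (K-pred dx)
          where
          go : (∃₂ λ u z → K u × d z ≡ 2 × x ≡ u + z) → ⊥
          go (u , z , Ku , dz , eq) = go′ (K-pred dz)
            where
            x≡ : x ≡ u - - z
            x≡ = trans eq (solve 2 (λ u z → u :+ z := u :- (:- z)) refl u z)
            K-z⇒ : K (- z) → ⊥
            K-z⇒ K-z = go″ (difference Ku K-z λ u≡ → nonzero dx (trans x≡ (trans (cong (λ v → v - - z) u≡) (-‿inverseʳ (- z)))))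
              where
              go″ : K (u - - z) ⊎ K (- (u - - z)) ⊎ C (u - - z) ⊎ C (- (u - - z)) → ⊥
              go″ (inj₁ h) = contradiction (trans (sym dx) (trans (cong d x≡) (K⇒d≡1 h))) λ ()
              go″ (inj₂ (inj₁ h)) = contradiction (trans (sym dx) (trans (cong d x≡) (cong proj₁ (K-neg⇒τ h)))) λ ()
              go″ (inj₂ (inj₂ (inj₁ h))) = C-free _ h
              go″ (inj₂ (inj₂ (inj₂ h))) = C-free _ h
            go′ : (∃₂ λ v w → K v × d w ≡ 1 × z ≡ v + w) → ⊥
            go′ (v , w , Kv , dw , eq′) = go″ (K-sum Kv (d≡1⇒K dw))
              where
              go″ : K (v + w) ⊎ K (- (v + w)) ⊎ C (v + w) ⊎ D (v + w) → ⊥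
              go″ (inj₁ h) = contradiction (trans (sym dz) (trans (cong d eq′) (K⇒d≡1 h))) λ ()
              go″ (inj₂ (inj₁ h)) = K-z⇒ (subst (λ t → K (- t)) (sym eq′) h)
              go″ (inj₂ (inj₂ (inj₁ h))) = C-free _ h
              go″ (inj₂ (inj₂ (inj₂ h))) = no-D _ h

        no-3+ : ∀ n x → d x ≢ 3 ℕ.+ n
        no-3+ zero x = no-3 x
        no-3+ (suc n) x dx = no-3+ n (proj₁ (proj₂ (K-pred dx))) (proj₁ (proj₂ (proj₂ (proj₂ (K-pred dx)))))

        d≤2 : ∀ x → d x ≤ 2
        d≤2 x = ℕ.≮⇒≥ λ lt → no-3+ (proj₁ (ℕ.m≤n⇒∃[o]m+o≡n lt)) x (sym (proj₂ (ℕ.m≤n⇒∃[o]m+o≡n lt)))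

        every : ∀ x → x ≡ 0# ⊎ K x ⊎ K (- x)
        every x = go (x ≟F 0#)
          where
          go : Dec (x ≡ 0#) → x ≡ 0# ⊎ K x ⊎ K (- x)
          go (yes e) = inj₁ e
          go (no x≢0) = go′ (classify x≢0 (ℕ.≤-trans (d≤2 x) (ℕ.n≤1+n 2)) (ℕ.≤-trans (d≤2 (- x)) (ℕ.n≤1+n 2)))
            where
            go′ : K x ⊎ K (- x) ⊎ C x ⊎ C (- x) → x ≡ 0# ⊎ K x ⊎ K (- x)
            go′ (inj₁ h) = inj₂ (inj₁ h)
            go′ (inj₂ (inj₁ h)) = inj₂ (inj₂ h)
            go′ (inj₂ (inj₂ (inj₁ h))) = contradiction h (C-free x)
            go′ (inj₂ (inj₂ (inj₂ h))) = contradiction h (C-free (- x))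

      all-or-C : (∀ x → x ≡ 0# ⊎ K x ⊎ K (- x)) ⊎ ∃ C
      all-or-C = go (anyF? (λ z → τ z ≟τ (2 , 3)))
        where
        go : Dec (∃ C) → (∀ x → x ≡ 0# ⊎ K x ⊎ K (- x)) ⊎ ∃ C
        go (yes h) = inj₂ h
        go (no noC) = inj₁ (NoC.every λ z Cz → noC (z , Cz))

      -- By `departure`, the inverse of a sum b of two elements of K lies just beyond the boundary of X.
      inv-departure : ∀ {u v} → K u → K v → ¬ K (u + v) → let b = inv (u + v) in d b ≡ suc (d (- b))
      inv-departure {u} {v} Ku Kv ¬Kb = subst (λ t → proj₁ t ≡ suc (proj₂ t)) (trans (cong τ (*-identityˡ (u * ib))) (K-scale ib Ku))
          (Flow.departure 1# d1 (u * ib) (x*y≢0 (K⇒≢0 Ku) (inv≢0 b≢0) , trans (cong τ 1-v≡) (trans (K-scale ib Kv) (sym (K-scale ib Ku))))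
            λ Kv′ → ¬Kb (trans (sym (K-scale b (trans (sym (K-scale ib Ku)) Kv′))) (cong τ (trans (*-comm ib b) (inv-inverseʳ b≢0)))))
        where
        b = u + v
        ib = inv b
        b≢0 = K-sum≢0 Ku Kv
        1-v≡ : 1# - u * ib ≡ v * ib
        1-v≡ = trans (cong (_- u * ib) (sym (inv-inverseʳ b≢0))) (solve 3 (λ u v i → (u :+ v) :* i :- u :* i := v :* i) refl u v ib)

      as-sum : ∀ {b} → d b ≡ 2 → ∃₂ λ u v → K u × K v × b ≡ u + v
      as-sum db = let u , v , Ku , dv , eq = K-pred db in u , v , Ku , d≡1⇒K dv , eq

      inv-departure′ : ∀ {b} → d b ≡ 2 → d (inv b) ≡ suc (d (- inv b))
      inv-departure′ {b} db = let u , v , Ku , Kv , eq = as-sum db in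
        subst (λ b → d (inv b) ≡ suc (d (- inv b))) (sym eq)
          (inv-departure Ku Kv λ Kb → contradiction (trans (sym db) (trans (cong d eq) (K⇒d≡1 Kb))) λ ())

      module WithC (c : F) (Cc : C c) where

        c≢0 : c ≢ 0#
        c≢0 e = contradiction (trans (sym d0) (trans (cong d (sym e)) (cong proj₁ Cc))) λ ()

        τ-1 : τ (- 1#) ≡ (2 , 1)
        τ-1 = trans (τ-neg 1#) (cong swap τ1)

        τ-c : τ (- c) ≡ (3 , 2)
        τ-c = trans (τ-neg c) (cong swap Cc)

        -1≢0 = -≢0 1≢0
        -c≢0 = -≢0 c≢0

        clash : ∀ {x y : F} {i j} → τ x ≡ i → τ y ≡ j → i ≢ j → ¬ x ∼ y
        clash ex ey i≢j e = i≢j (trans (sym ex) (trans e ey))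

        μ σ : F → ℕ
        μ = P 1# (- 1#)
        σ = P 1# 1#

        k>0 : 0 < k
        k>0 = count>0 K? 1# K1

        μ-neg : ∀ z → μ (- z) ≡ μ z
        μ-neg z = trans (P-comm 1# (- 1#) (- z)) (trans (cong (λ v → P (- 1#) v (- z)) (sym (neg-neg 1#))) (P-neg 1# (- 1#) z))

        μ0≤k : μ 0# ≤ k
        μ0≤k = ℕ.≤-trans (ℕ.≤-reflexive (P≡count 1# (- 1#) 0#))
          (count-mono (λ w → (τ w ≟τ τ 1#) ×-dec (τ (0# - w) ≟τ τ (- 1#))) K? λ w → proj₁)

        μ-support : ∀ z → z ≢ 0# → μ z ≢ 0 → Any (z ∼_) (1# ∷ - 1# ∷ c ∷ - c ∷ [])
        μ-support z z≢0 h = let w , Kw , e = P-support 1# (- 1#) z h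
                                z≡ = solve 2 (λ w z → z := w :- (:- (z :- w))) refl w z
                                K-z+w = trans (∼-neg e) (cong τ (neg-neg 1#)) in
          Sum.[ (λ Kz → here (trans (cong τ z≡) Kz)) ,
            Sum.[ (λ K-z → there (here (trans (cong τ z≡) (trans (K-neg⇒τ K-z) (sym τ-1))))) ,
              Sum.[ (λ Cz → there (there (here (trans (cong τ z≡) (trans Cz (sym Cc)))))) ,
                (λ C-z → there (there (there (here (trans (cong τ z≡) (trans (C-neg⇒τ C-z) (sym τ-c))))))) ] ] ]
          (difference Kw K-z+w λ w≡ → z≢0 (trans z≡ (trans (cong (_- (- (z - w))) w≡) (-‿inverseʳ _))))

        P-invariant : ∀ x y → ClassInvariant (P x y)
        P-invariant x y = P-∼ x y

        ic = inv c
        ic≢0 = inv≢0 c≢0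

        a y γ del : ℕ
        a = μ 1#
        y = μ c
        γ = σ c
        del = μ ic

        reps : List F
        reps = 1# ∷ - 1# ∷ c ∷ - c ∷ []

        reps≢0 : All (_≢ 0#) reps
        reps≢0 = 1≢0 ∷ -1≢0 ∷ c≢0 ∷ -c≢0 ∷ []

        k≤1+2a+2y : k ≤ 1 ℕ.+ 2 ℕ.* a ℕ.+ 2 ℕ.* y
        k≤1+2a+2y = ℕ.*-cancelʳ-≤ _ _ k {{ℕ.>-nonZero k>0}} (begin
          k ℕ.* k                                                   ≡⟨ sum-P 1≢0 -1≢0 ⟨
          sum μ                                                     ≤⟨ upper-bound μ (P-invariant 1# (- 1#)) reps≢0 μ-support ⟩
          μ 0# ℕ.+ total reps μ ℕ.* k                               ≤⟨ ℕ.+-monoˡ-≤ _ μ0≤k ⟩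
          k ℕ.+ total reps μ ℕ.* k                                  ≡⟨ cong (λ t → k ℕ.+ t ℕ.* k) (cong₂ (λ a′ y′ → a ℕ.+ (a′ ℕ.+ (y ℕ.+ (y′ ℕ.+ 0)))) (μ-neg 1#) (μ-neg c)) ⟩
          k ℕ.+ (a ℕ.+ (a ℕ.+ (y ℕ.+ (y ℕ.+ 0)))) ℕ.* k             ≡⟨ solveℕ 3 (λ k a y → k :+ℕ (a :+ℕ (a :+ℕ (y :+ℕ (y :+ℕ conℕ 0)))) :*ℕ k :=ℕ (conℕ 1 :+ℕ conℕ 2 :*ℕ a :+ℕ conℕ 2 :*ℕ y) :*ℕ k) refl k a y ⟩
          (1 ℕ.+ 2 ℕ.* a ℕ.+ 2 ℕ.* y) ℕ.* k                         ∎)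
          where open ℕ.≤-Reasoning

        P-e : ∀ e z → e ≢ 0# → P (- e) e z ≡ μ (inv e * z)
        P-e e z e≢0 = trans (P-comm (- e) e z) (trans (cong₂ (λ u v → P u v z) (sym (*-identityʳ e)) (solve 1 (λ e → :- e := e :* (:- nat 1)) refl e))
          (trans (cong (P (e * 1#) (e * - 1#)) (sym (inv-cancelʳ z e≢0))) (P-scale e 1# (- 1#) (inv e * z) e≢0)))

        -- ∑ (⟪1⟫ ⋆ ⟪e⟫)² = ∑ μ(z) μ(z / e) reduces to μ(0)² = k² = ∑ ⟪1⟫ ⋆ ⟪e⟫.
        P≤1 : ∀ e → e ≢ 0# → (∀ z → z ≢ 0# → μ z ℕ.* μ (inv e * z) ≡ 0) → ∀ z → P 1# e z ≤ 1
        P≤1 e e≢0 h z = square (P 1# e z) (sum-tight n≤n² energy z)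
          where
          n≤n² : ∀ z → P 1# e z ≤ P 1# e z ℕ.* P 1# e z
          n≤n² z = go (P 1# e z) where
            go : ∀ n → n ≤ n ℕ.* n
            go zero = z≤n
            go (suc n) = ℕ.m≤m*n (suc n) (suc n)
          square : ∀ n → n ≡ n ℕ.* n → n ≤ 1
          square zero _ = z≤n
          square (suc n) e = ℕ.≤-reflexive (sym (ℕ.*-cancelˡ-≡ 1 (suc n) (suc n) (trans (ℕ.*-identityʳ (suc n)) e)))
          energy : ⟨ P 1# e ∙ P 1# e ⟩ ≤ sum (P 1# e)
          energy = begin
            ⟨ P 1# e ∙ P 1# e ⟩                ≡⟨ exchange-P 1# e 1# e ⟩
            ⟨ μ ∙ P (- e) e ⟩                  ≡⟨ ⟨∙⟩-congʳ μ (λ z → P-e e z e≢0) ⟩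
            sum (λ z → μ z ℕ.* μ (inv e * z))  ≡⟨ sum-single 0# (λ z z≢0 → h z z≢0) ⟩
            μ 0# ℕ.* μ (inv e * 0#)            ≡⟨ cong (λ v → μ 0# ℕ.* μ v) (zeroʳ (inv e)) ⟩
            μ 0# ℕ.* μ 0#                      ≤⟨ ℕ.*-mono-≤ μ0≤k μ0≤k ⟩
            k ℕ.* k                            ≡⟨ sum-P 1≢0 e≢0 ⟨
            sum (P 1# e)                       ∎
            where open ℕ.≤-Reasoning

        infix 4 _≈±_
        _≈±_ : F → F → Set
        x ≈± y = x ∼ y ⊎ x ∼ - y

        ≈±-sym : ∀ {x y} → x ≈± y → y ≈± x
        ≈±-sym (inj₁ e) = inj₁ (sym e)
        ≈±-sym {x} {y} (inj₂ e) = inj₂ (sym (trans (∼-neg e) (cong τ (neg-neg y))))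

        ≈±-trans : ∀ {x y z} → x ≈± y → y ≈± z → x ≈± z
        ≈±-trans (inj₁ e) (inj₁ e′) = inj₁ (trans e e′)
        ≈±-trans (inj₁ e) (inj₂ e′) = inj₂ (trans e e′)
        ≈±-trans (inj₂ e) (inj₁ e′) = inj₂ (trans e (∼-neg e′))
        ≈±-trans {z = z} (inj₂ e) (inj₂ e′) = inj₁ (trans e (trans (∼-neg e′) (cong τ (neg-neg z))))

        ≈±-mult : ∀ {x y} v → v ≢ 0# → x ≈± y → v * x ≈± v * y
        ≈±-mult {x} {y} v v≢0 (inj₁ e) = inj₁ (mult x y v v≢0 e)
        ≈±-mult {x} {y} v v≢0 (inj₂ e) = inj₂ (trans (mult x (- y) v v≢0 e) (cong τ (solve 2 (λ v y → v :* (:- y) := :- (v :* y)) refl v y)))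

        μ-support± : ∀ z → z ≢ 0# → μ z ≢ 0 → z ≈± 1# ⊎ z ≈± c
        μ-support± z z≢0 h = go (μ-support z z≢0 h)
          where
          go : Any (z ∼_) reps → z ≈± 1# ⊎ z ≈± c
          go (here e) = inj₁ (inj₁ e)
          go (there (here e)) = inj₁ (inj₂ e)
          go (there (there (here e))) = inj₂ (inj₁ e)
          go (there (there (there (here e)))) = inj₂ (inj₂ e)

        product≡0 : ∀ m n → (m ≢ 0 → n ≢ 0 → ⊥) → m ℕ.* n ≡ 0
        product≡0 zero n h = refl
        product≡0 (suc m) zero h = ℕ.*-zeroʳ (suc m)
        product≡0 (suc m) (suc n) h = ⊥-elim (h (λ ()) λ ())

        count-τ≤k : ∀ i j → count (λ z → τ z ≟τ (suc i , j)) ≤ k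
        count-τ≤k i j with anyF? (λ z → τ z ≟τ (suc i , j))
        ... | yes (x , e) = ℕ.≤-reflexive (trans (count-cong (λ z → τ z ≟τ (suc i , j)) (λ z → τ z ≟τ τ x) (λ z e′ → trans e′ (sym e)) (λ z e′ → trans e′ e))
                              (count-class λ x≡0 → contradiction (trans (sym d0) (trans (cong d (sym x≡0)) (cong proj₁ e))) λ ()))
        ... | no h = ℕ.≤-trans (ℕ.≤-reflexive (count-none (λ z → τ z ≟τ (suc i , j)) λ z e → h (z , e))) z≤n

        union : ∀ {A B : F → Set} (A? : Decidable A) (B? : Decidable B) → count (λ z → A? z ⊎-dec B? z) ≤ count A? ℕ.+ count B?
        union A? B? = ℕ.≤-trans (ℕ.m≤m+n _ (count (λ z → A? z ×-dec B? z))) (ℕ.≤-reflexive (sym (count-incl-excl A? B?)))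

        module WithD (f : F) (Df : D f) where

          f≢0 : f ≢ 0#
          f≢0 e = contradiction (trans (sym d0) (trans (cong d (sym e)) (cong proj₁ Df))) λ ()

          if = inv f
          if≢0 = inv≢0 f≢0

          f≉1 : ¬ f ≈± 1#
          f≉1 (inj₁ e) = clash Df τ1 (λ ()) e
          f≉1 (inj₂ e) = clash Df τ-1 (λ ()) e

          f≉c : ¬ f ≈± c
          f≉c (inj₁ e) = clash Df Cc (λ ()) e
          f≉c (inj₂ e) = clash Df τ-c (λ ()) e

          fc≉1 : ¬ f * c ≈± 1#
          fc≉1 (inj₁ e) = contradiction (trans (sym (cong proj₁ if∼c)) (trans (inv-departure′ (cong proj₁ Df)) (cong (suc ∘ proj₂) if∼c))) λ ()
            where
            if∼c : τ if ≡ (2 , 3)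
            if∼c = trans (sym (subst₂ _∼_ (inv-cancelˡ c f≢0) (*-identityʳ if) (mult (f * c) 1# if if≢0 e))) Cc
          fc≉1 (inj₂ e) = contradiction (trans (sym (cong proj₁ ic∼-f)) (trans (inv-departure′ (cong proj₁ Cc)) (cong (suc ∘ proj₂) ic∼-f))) λ ()
            where
            ic∼-f : τ ic ≡ (4 , 2)
            ic∼-f = trans (sym (subst₂ _∼_ (trans (solve 3 (λ i f c → i :* (:- (f :* c)) := :- (c :* (i :* f))) refl ic f c) (cong (λ v → - v) (inv-cancelʳ f c≢0)))
                      (trans (solve 1 (λ i → i :* (:- (:- nat 1)) := i) refl ic) refl)
                      (mult (- (f * c)) (- - 1#) ic ic≢0 (∼-neg e)))) (trans (τ-neg f) (cong swap Df))

          from-inv : ∀ {x z} → if * x ≈± z → x ≈± f * z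
          from-inv {x} {z} e = subst (_≈± f * z) (inv-cancelʳ x f≢0) (≈±-mult f f≢0 e)

          from-c : ∀ {z} → c ≈± f * z → z ≈± 1# ⊎ z ≈± c → ⊥
          from-c e (inj₁ e′) = f≉c (≈±-sym (≈±-trans e (subst (f * _ ≈±_) (*-identityʳ f) (≈±-mult f f≢0 e′))))
          from-c {z} e (inj₂ e′) = f≉1 (≈±-sym (subst₂ _≈±_ (trans (*-comm ic c) (inv-inverseʳ c≢0))
            (trans (solve 3 (λ i f c → i :* (f :* c) := c :* (i :* f)) refl ic f c) (inv-cancelʳ f c≢0))
            (≈±-mult ic ic≢0 (≈±-trans e (≈±-mult f f≢0 e′)))))

          from-1 : ∀ {z} → 1# ≈± f * z → z ≈± 1# ⊎ z ≈± c → ⊥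
          from-1 e (inj₁ e′) = f≉1 (≈±-sym (≈±-trans e (subst (f * _ ≈±_) (*-identityʳ f) (≈±-mult f f≢0 e′))))
          from-1 e (inj₂ e′) = fc≉1 (≈±-sym (≈±-trans e (≈±-mult f f≢0 e′)))

          disjoint : ∀ z → z ≢ 0# → μ z ℕ.* μ (if * z) ≡ 0
          disjoint z z≢0 = product≡0 (μ z) (μ (if * z)) λ h h′ →
            Sum.[ (λ e → from-1 (≈±-trans (≈±-sym e) (from-inv {z} (inj₁ refl))) (μ-support± _ (x*y≢0 if≢0 z≢0) h′)) ,
                  (λ e → from-c (≈±-trans (≈±-sym e) (from-inv {z} (inj₁ refl))) (μ-support± _ (x*y≢0 if≢0 z≢0) h′)) ]
            (μ-support± z z≢0 h)

          T? : ∀ h → Decidable (λ z → τ z ≡ h)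
          T? h z = τ z ≟τ h

          U₂? : Decidable (λ z → τ z ≡ (3 , 5) ⊎ τ z ≡ (3 , 6))
          U₂? z = T? (3 , 5) z ⊎-dec T? (3 , 6) z
          U₃? : Decidable (λ z → τ z ≡ (3 , 4) ⊎ τ z ≡ (3 , 5) ⊎ τ z ≡ (3 , 6))
          U₃? z = T? (3 , 4) z ⊎-dec U₂? z
          U₄? : Decidable (λ z → C z ⊎ τ z ≡ (3 , 4) ⊎ τ z ≡ (3 , 5) ⊎ τ z ≡ (3 , 6))
          U₄? z = T? (2 , 3) z ⊎-dec U₃? z

          support : ∀ z → P 1# f z ≢ 0 → C z ⊎ τ z ≡ (3 , 4) ⊎ τ z ≡ (3 , 5) ⊎ τ z ≡ (3 , 6)
          support z h = let w , Kw , e = P-support 1# f z h in locate w Kw e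
            where
            locate : ∀ w → K w → z - w ∼ f → C z ⊎ τ z ≡ (3 , 4) ⊎ τ z ≡ (3 , 5) ⊎ τ z ≡ (3 , 6)
            locate w Kw e = go (d z) (d (- z)) refl refl dz≤3 d-z≥3 d-z≤6
              where
              f′ = z - w
              z≡ : z ≡ w + f′
              z≡ = solve 2 (λ z w → z := w :+ (z :- w)) refl z w
              dz≤3 : d z ≤ 3
              dz≤3 = ℕ.≤-trans (ℕ.≤-reflexive (cong d z≡)) (ℕ.≤-trans (step f′ Kw) (s≤s (ℕ.≤-reflexive (cong proj₁ (trans e Df)))))
              d-z≥3 : 3 ≤ d (- z)
              d-z≥3 = ℕ.≤-pred (ℕ.≤-trans (ℕ.≤-reflexive (trans (sym (cong proj₂ (trans e Df))) (cong d (solve 2 (λ z w → :- (z :- w) := w :+ (:- z)) refl z w)))) (step (- z) Kw))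
              d-z≤6 : d (- z) ≤ 6
              d-z≤6 = ℕ.≤-trans (ℕ.≤-reflexive (cong d (solve 2 (λ z w → :- z := (:- (z :- w)) :+ (:- w)) refl z w)))
                (ℕ.≤-trans (triangle (- f′) (- w)) (ℕ.≤-reflexive (cong₂ ℕ._+_ (cong proj₂ (trans e Df)) (trans (K⇒d-≡h Kw) h≡2))))
              -- f = w + f u with u ∈ K would make w = f (1 - u), so that μ (1 / f) > 0.
              ¬Dz : ¬ D z
              ¬Dz Dz = from-1 {if} (inj₁ (cong τ (sym (inv-inverseʳ f≢0)))) (μ-support± if if≢0 λ μ≡0 →
                  ℕ.<⇒≱ (P>0 1# (- 1#) if (if * z * inv u)
                    (trans (cong τ (*-comm (if * z) (inv u))) (trans (K-scale (if * z) (K-inv Ku)) (quotient∈K f≢0 (trans Dz (sym Df)))))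
                    (trans (cong τ minus≡) (∼-neg (K-* Kt (K-inv Ku))))) (ℕ.≤-trans (ℕ.≤-reflexive μ≡0) z≤n))
                where
                u = w
                Ku = Kw
                t = if * f′
                Kt : K t
                Kt = quotient∈K f≢0 e
                minus≡ : if - if * z * inv u ≡ - (t * inv u)
                minus≡ = trans (cong (λ v → v - if * z * inv u) (trans (sym (*-identityʳ if)) (cong (if *_) (sym (inv-inverseʳ (K⇒≢0 Ku))))))
                  (solve 4 (λ i z w iw → i :* (w :* iw) :- (i :* z) :* iw := :- ((i :* (z :- w)) :* iw)) refl if z w (inv u))
              go : ∀ i j → d z ≡ i → d (- z) ≡ j → i ≤ 3 → 3 ≤ j → j ≤ 6 → C z ⊎ τ z ≡ (3 , 4) ⊎ τ z ≡ (3 , 5) ⊎ τ z ≡ (3 , 6)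
              go 0 j dz d-z _ 3≤j _ = contradiction (ℕ.≤-trans 3≤j (ℕ.≤-reflexive (trans (sym d-z)
                (trans (cong d (trans (cong (λ v → - v) (d≡0 z dz)) -0≡0)) d0)))) λ ()
              go 1 j dz d-z _ 3≤j _ = contradiction (ℕ.≤-trans 3≤j (ℕ.≤-reflexive (trans (sym d-z) (trans (K⇒d-≡h (d≡1⇒K dz)) h≡2)))) λ where (s≤s (s≤s ()))
              go 2 3 dz d-z _ _ _ = inj₁ (cong₂ _,_ dz d-z)
              go 2 4 dz d-z _ _ _ = contradiction (cong₂ _,_ dz d-z) ¬Dz
              go 2 (suc (suc (suc (suc (suc j))))) dz d-z _ _ _ = contradiction (ℕ.≤-trans (ℕ.≤-reflexive (sym d-z)) d-z≤4) (λ where (s≤s (s≤s (s≤s (s≤s ())))))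
                where
                d-z≤4 : d (- z) ≤ 4
                d-z≤4 = let u , v , Ku , Kv , eq = as-sum dz in
                  ℕ.≤-trans (ℕ.≤-reflexive (cong d (trans (cong (λ v → - v) eq) (solve 2 (λ u v → :- (u :+ v) := (:- u) :+ (:- v)) refl u v))))
                    (ℕ.≤-trans (triangle (- u) (- v)) (ℕ.≤-reflexive (cong₂ ℕ._+_ (trans (K⇒d-≡h Ku) h≡2) (trans (K⇒d-≡h Kv) h≡2))))
              go 3 3 dz d-z _ _ _ = contradiction (trans dz (sym d-z)) (skew λ z≡0 → contradiction (trans (sym d0) (trans (cong d (sym z≡0)) dz)) λ ())
              go 3 4 dz d-z _ _ _ = inj₂ (inj₁ (cong₂ _,_ dz d-z))
              go 3 5 dz d-z _ _ _ = inj₂ (inj₂ (inj₁ (cong₂ _,_ dz d-z)))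
              go 3 6 dz d-z _ _ _ = inj₂ (inj₂ (inj₂ (cong₂ _,_ dz d-z)))
              go 3 (suc (suc (suc (suc (suc (suc (suc _))))))) _ _ _ _ (s≤s (s≤s (s≤s (s≤s (s≤s (s≤s ()))))))
              go (suc (suc (suc (suc _)))) _ _ _ (s≤s (s≤s (s≤s ())))
              go 2 (suc (suc zero)) _ _ _ (s≤s (s≤s ()))
              go 2 (suc zero) _ _ _ (s≤s ())
              go 3 (suc (suc zero)) _ _ _ (s≤s (s≤s ()))
              go 3 (suc zero) _ _ _ (s≤s ())

          |U₂|≤ : count U₂? ≤ k ℕ.+ k
          |U₂|≤ = ℕ.≤-trans (union (T? (3 , 5)) (T? (3 , 6))) (ℕ.+-mono-≤ (count-τ≤k 2 5) (count-τ≤k 2 6))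
          |U₃|≤ : count U₃? ≤ k ℕ.+ (k ℕ.+ k)
          |U₃|≤ = ℕ.≤-trans (union (T? (3 , 4)) U₂?) (ℕ.+-mono-≤ (count-τ≤k 2 4) |U₂|≤)
          |U₄|≤ : count U₄? ≤ k ℕ.+ (k ℕ.+ (k ℕ.+ k))
          |U₄|≤ = ℕ.≤-trans (union (T? (2 , 3)) U₃?) (ℕ.+-mono-≤ (count-τ≤k 1 3) |U₃|≤)

          bound : ∀ z → Dec (P 1# f z ≡ 0) → P 1# f z ≤ χ (U₄? z)
          bound z (yes e) = ℕ.≤-trans (ℕ.≤-reflexive e) z≤n
          bound z (no ne) = ℕ.≤-trans (P≤1 f f≢0 disjoint z) (ℕ.≤-reflexive (sym (χ-yes (U₄? z) (support z ne))))

          sum≤ : sum (P 1# f) ≤ count U₄?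
          sum≤ = sum-mono {f = P 1# f} {g = λ z → χ (U₄? z)} λ z → bound z (P 1# f z ℕ.≟ 0)

          k≤4 : k ≤ 4
          k≤4 = ℕ.*-cancelʳ-≤ k 4 k {{ℕ.>-nonZero k>0}} (begin
            k ℕ.* k                          ≡⟨ sum-P 1≢0 f≢0 ⟨
            sum (P 1# f)                     ≤⟨ sum≤ ⟩
            count U₄?                        ≤⟨ |U₄|≤ ⟩
            k ℕ.+ (k ℕ.+ (k ℕ.+ k))          ≡⟨ cong (λ v → k ℕ.+ (k ℕ.+ (k ℕ.+ v))) (ℕ.+-identityʳ k) ⟨
            4 ℕ.* k ∎)
            where open ℕ.≤-Reasoning

        module NoD (D-free : ∀ z → ¬ D z) where

          v-at-1 : P 1# (- c) 1# ≡ y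
          v-at-1 = trans (sym (P-neg 1# (- c) 1#)) (trans (sym (rotate 1# (- 1#) (- c) 1≢0 -1≢0 -c≢0)) (μ-neg c))

          v-at--1 : P 1# (- c) (- 1#) ≡ γ
          v-at--1 = sym (rotate 1# 1# c 1≢0 1≢0 c≢0)

          scaled : ∀ z → P (- c) c (- z) ≡ μ (ic * z)
          scaled z = trans (P-e c (- z) c≢0) (trans (cong μ (solve 2 (λ i z → i :* (:- z) := :- (i :* z)) refl ic z)) (μ-neg (ic * z)))

          scaled1 : P (- c) c (- 1#) ≡ del
          scaled1 = trans (scaled 1#) (cong μ (*-identityʳ ic))

          v-at--c : P 1# (- c) (- c) ≡ del
          v-at--c = begin
            P 1# (- c) (- c)         ≡⟨ P-comm 1# (- c) (- c) ⟩
            P (- c) 1# (- c)         ≡⟨ cong (λ v → P (- c) v (- c)) (neg-neg 1#) ⟨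
            P (- c) (- - 1#) (- c)   ≡⟨ rotate c (- c) (- 1#) c≢0 -c≢0 -1≢0 ⟨
            P c (- c) (- 1#)         ≡⟨ P-comm c (- c) (- 1#) ⟩
            P (- c) c (- 1#)         ≡⟨ scaled1 ⟩
            del ∎
            where open ≡-Reasoning

          w-at-1 : P 1# c 1# ≡ y
          w-at-1 = trans (sym (P-neg 1# c 1#)) (sym (rotate 1# (- 1#) c 1≢0 -1≢0 c≢0))

          σ-sum : ∀ z → σ z ≢ 0 → ∃₂ λ u v → K u × K v × z ≡ u + v
          σ-sum z h = let w , Kw , e = P-support 1# 1# z h in w , z - w , Kw , e , solve 2 (λ z w → z := w :+ (z :- w)) refl z w

          σ-c≡0 : σ (- c) ≡ 0
          σ-c≡0 = decidable-stable (σ (- c) ℕ.≟ 0) λ h → go (σ-sum (- c) h)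
            where
            go : (∃₂ λ u v → K u × K v × - c ≡ u + v) → ⊥
            go (u , v , Ku , Kv , eq) = ℕ.<⇒≱ (ℕ.≤-reflexive (sym (cong proj₁ τ-c)))
              (ℕ.≤-trans (ℕ.≤-reflexive (cong d eq)) (ℕ.≤-trans (step v Ku) (s≤s (ℕ.≤-reflexive (K⇒d≡1 Kv)))))

          w-at--1 : P 1# c (- 1#) ≡ 0
          w-at--1 = trans (P-comm 1# c (- 1#)) (trans (rotate c 1# (- 1#) c≢0 1≢0 -1≢0)
            (trans (cong (λ v → P 1# v (- c)) (neg-neg 1#)) σ-c≡0))

          w-at-c : P 1# c c ≡ del
          w-at-c = begin
            P 1# c c                     ≡⟨ P-comm 1# c c ⟩
            P c 1# c                     ≡⟨ cong₂ (P c) (neg-neg 1#) (neg-neg c) ⟨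
            P c (- - 1#) (- - c)         ≡⟨ rotate (- c) c (- 1#) -c≢0 c≢0 -1≢0 ⟨
            P (- c) c (- 1#)             ≡⟨ scaled1 ⟩
            del ∎
            where open ≡-Reasoning

          σ-at-1 : σ 1# ≡ a
          σ-at-1 = trans (rotate 1# 1# 1# 1≢0 1≢0 1≢0) (μ-neg 1#)

          σ-support : ∀ z → σ z ≢ 0 → Any (z ∼_) (1# ∷ - 1# ∷ c ∷ [])
          σ-support z h = go (σ-sum z h)
            where
            go : (∃₂ λ u v → K u × K v × z ≡ u + v) → Any (z ∼_) (1# ∷ - 1# ∷ c ∷ [])
            go (u , v , Ku , Kv , eq) = go′ (K-sum Ku Kv)
              where
              go′ : K (u + v) ⊎ K (- (u + v)) ⊎ C (u + v) ⊎ D (u + v) → Any (z ∼_) (1# ∷ - 1# ∷ c ∷ [])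
              go′ (inj₁ h) = here (trans (cong τ eq) h)
              go′ (inj₂ (inj₁ h)) = there (here (trans (cong τ eq) (trans (K-neg⇒τ h) (sym τ-1))))
              go′ (inj₂ (inj₂ (inj₁ h))) = there (there (here (trans (cong τ eq) (trans h (sym Cc)))))
              go′ (inj₂ (inj₂ (inj₂ h))) = contradiction h (D-free _)

          σ0≡0 : σ 0# ≡ 0
          σ0≡0 = decidable-stable (σ 0# ℕ.≟ 0) λ h → go (σ-sum 0# h)
            where
            go : (∃₂ λ u v → K u × K v × 0# ≡ u + v) → ⊥
            go (u , v , Ku , Kv , eq) = K-sum≢0 Ku Kv (sym eq)

          reps₃ : List F
          reps₃ = 1# ∷ - 1# ∷ - c ∷ []

          reps₃≢0 : All (_≢ 0#) reps₃
          reps₃≢0 = 1≢0 ∷ -1≢0 ∷ -c≢0 ∷ []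

          distinct₃ : AllPairs (λ x y → ¬ x ∼ y) reps₃
          distinct₃ = (clash τ1 τ-1 (λ ()) ∷ clash τ1 τ-c (λ ()) ∷ []) ∷ (clash τ-1 τ-c (λ ()) ∷ []) ∷ [] ∷ []

          product-invariant : ∀ {f g} → ClassInvariant f → ClassInvariant g → ClassInvariant (λ z → f z ℕ.* g z)
          product-invariant inv-f inv-g z≢0 e = cong₂ ℕ._*_ (inv-f z≢0 e) (inv-g z≢0 e)

          energy₁ : y ℕ.* y ℕ.+ γ ℕ.* γ ℕ.+ del ℕ.* del ≤ k ℕ.+ (2 ℕ.* (a ℕ.* del) ℕ.+ 2 ℕ.* (a ℕ.* y))
          energy₁ = ℕ.*-cancelʳ-≤ _ _ k {{ℕ.>-nonZero k>0}} (begin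
            (y ℕ.* y ℕ.+ γ ℕ.* γ ℕ.+ del ℕ.* del) ℕ.* k
              ≡⟨ cong (ℕ._* k) (trans (ℕ.+-assoc (y ℕ.* y) _ _) (cong (λ t → y ℕ.* y ℕ.+ (γ ℕ.* γ ℕ.+ t)) (sym (ℕ.+-identityʳ _)))) ⟩
            (y ℕ.* y ℕ.+ (γ ℕ.* γ ℕ.+ (del ℕ.* del ℕ.+ 0))) ℕ.* k
              ≡⟨ cong (ℕ._* k) (cong₂ ℕ._+_ (sq v-at-1) (cong₂ ℕ._+_ (sq v-at--1) (cong (ℕ._+ 0) (sq v-at--c)))) ⟨
            total reps₃ vv ℕ.* k
              ≤⟨ lower-bound vv (product-invariant (P-∼ 1# (- c)) (P-∼ 1# (- c))) reps₃≢0 distinct₃ ⟩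
            ⟨ P 1# (- c) ∙ P 1# (- c) ⟩
              ≡⟨ exchange-P 1# (- c) 1# (- c) ⟩
            ⟨ μ ∙ P (- - c) (- c) ⟩
              ≡⟨ ⟨∙⟩-congʳ μ (λ z → trans (P-comm (- - c) (- c) z) (trans (cong (λ v → P (- c) v z) (neg-neg c)) (P-e c z c≢0))) ⟩
            sum μμ
              ≤⟨ upper-bound μμ μμ-invariant reps≢0 (λ z z≢0 h → μ-support z z≢0 λ e → h (cong (ℕ._* μ (ic * z)) e)) ⟩
            μμ 0# ℕ.+ total reps μμ ℕ.* k
              ≤⟨ ℕ.+-monoˡ-≤ _ (ℕ.≤-trans (ℕ.≤-reflexive (cong (λ v → μ 0# ℕ.* μ v) (zeroʳ ic))) (ℕ.*-mono-≤ μ0≤k μ0≤k)) ⟩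
            k ℕ.* k ℕ.+ total reps μμ ℕ.* k
              ≡⟨ cong (λ t → k ℕ.* k ℕ.+ t ℕ.* k) (cong₂ ℕ._+_ (cong (a ℕ.*_) (cong μ (*-identityʳ ic)))
                   (cong₂ ℕ._+_ (cong₂ ℕ._*_ (μ-neg 1#) (trans (cong μ (solve 1 (λ i → i :* (:- nat 1) := :- i) refl ic)) (μ-neg ic)))
                     (cong₂ ℕ._+_ (cong (y ℕ.*_) (cong μ icc)) (cong (ℕ._+ 0) (cong₂ ℕ._*_ (μ-neg c)
                       (trans (cong μ (trans (solve 2 (λ i c → i :* (:- c) := :- (i :* c)) refl ic c) (cong (λ v → - v) icc))) (μ-neg 1#))))))) ⟩
            k ℕ.* k ℕ.+ (a ℕ.* del ℕ.+ (a ℕ.* del ℕ.+ (y ℕ.* a ℕ.+ (y ℕ.* a ℕ.+ 0)))) ℕ.* k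
              ≡⟨ solveℕ 4 (λ k a d y → k :*ℕ k :+ℕ (a :*ℕ d :+ℕ (a :*ℕ d :+ℕ (y :*ℕ a :+ℕ (y :*ℕ a :+ℕ conℕ 0)))) :*ℕ k
                   :=ℕ (k :+ℕ (conℕ 2 :*ℕ (a :*ℕ d) :+ℕ conℕ 2 :*ℕ (a :*ℕ y))) :*ℕ k) refl k a del y ⟩
            (k ℕ.+ (2 ℕ.* (a ℕ.* del) ℕ.+ 2 ℕ.* (a ℕ.* y))) ℕ.* k ∎)
            where
            open ℕ.≤-Reasoning
            vv μμ : F → ℕ
            vv z = P 1# (- c) z ℕ.* P 1# (- c) z
            μμ z = μ z ℕ.* μ (ic * z)
            sq : ∀ {m n} → m ≡ n → m ℕ.* m ≡ n ℕ.* n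
            sq e = cong₂ ℕ._*_ e e
            icc : ic * c ≡ 1#
            icc = trans (*-comm ic c) (inv-inverseʳ c≢0)
            μμ-invariant : ClassInvariant μμ
            μμ-invariant {z} {z′} z≢0 e = cong₂ ℕ._*_ (P-∼ 1# (- 1#) z≢0 e) (P-∼ 1# (- 1#) (x*y≢0 ic≢0 z≢0) (mult z′ z ic ic≢0 e))

          energy₂ : a ℕ.* γ ℕ.+ y ℕ.* del ≤ γ ℕ.* del
          energy₂ = ℕ.+-cancelˡ-≤ (a ℕ.* y) _ _ (ℕ.*-cancelʳ-≤ _ _ k {{ℕ.>-nonZero k>0}} (begin
            (a ℕ.* y ℕ.+ (a ℕ.* γ ℕ.+ y ℕ.* del)) ℕ.* k
              ≡⟨ cong (λ t → (a ℕ.* y ℕ.+ (a ℕ.* γ ℕ.+ t)) ℕ.* k) (sym (ℕ.+-identityʳ _)) ⟩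
            (a ℕ.* y ℕ.+ (a ℕ.* γ ℕ.+ (y ℕ.* del ℕ.+ 0))) ℕ.* k
              ≡⟨ cong (ℕ._* k) (cong₂ ℕ._+_ (cong (a ℕ.*_) (trans (P-comm (- c) 1# 1#) v-at-1)) (cong₂ ℕ._+_
                   (cong₂ ℕ._*_ (μ-neg 1#) (trans (P-comm (- c) 1# (- 1#)) v-at--1))
                   (cong (ℕ._+ 0) (cong₂ ℕ._*_ (μ-neg c) (trans (P-comm (- c) 1# (- c)) v-at--c))))) ⟨
            total reps₃ μv ℕ.* k
              ≤⟨ lower-bound μv (product-invariant (P-∼ 1# (- 1#)) (P-∼ (- c) 1#)) reps₃≢0 distinct₃ ⟩
            ⟨ μ ∙ P (- c) 1# ⟩
              ≡⟨ exchange-P 1# (- 1#) (- c) 1# ⟩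
            ⟨ P 1# (- - c) ∙ P (- - 1#) 1# ⟩
              ≡⟨ cong₂ (λ s t → ⟨ P 1# s ∙ P t 1# ⟩) (neg-neg c) (neg-neg 1#) ⟩
            sum wσ
              ≤⟨ upper-bound wσ (product-invariant (P-∼ 1# c) (P-∼ 1# 1#)) (1≢0 ∷ -1≢0 ∷ c≢0 ∷ [])
                   (λ z _ h → σ-support z λ e → h (trans (cong (P 1# c z ℕ.*_) e) (ℕ.*-zeroʳ (P 1# c z)))) ⟩
            wσ 0# ℕ.+ total (1# ∷ - 1# ∷ c ∷ []) wσ ℕ.* k
              ≡⟨ cong₂ (λ s t → s ℕ.+ t ℕ.* k) (trans (cong (P 1# c 0# ℕ.*_) σ0≡0) (ℕ.*-zeroʳ (P 1# c 0#)))
                   (cong₂ ℕ._+_ (cong₂ ℕ._*_ w-at-1 σ-at-1) (cong₂ ℕ._+_ (cong (ℕ._* σ (- 1#)) w-at--1) (cong (ℕ._+ 0) (cong (ℕ._* γ) w-at-c)))) ⟩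
            0 ℕ.+ (y ℕ.* a ℕ.+ (0 ℕ.+ (del ℕ.* γ ℕ.+ 0))) ℕ.* k
              ≡⟨ solveℕ 5 (λ k a d y g → conℕ 0 :+ℕ (y :*ℕ a :+ℕ (conℕ 0 :+ℕ (d :*ℕ g :+ℕ conℕ 0))) :*ℕ k :=ℕ (a :*ℕ y :+ℕ g :*ℕ d) :*ℕ k) refl k a del y γ ⟩
            (a ℕ.* y ℕ.+ γ ℕ.* del) ℕ.* k ∎))
            where
            open ℕ.≤-Reasoning
            μv wσ : F → ℕ
            μv z = μ z ℕ.* P (- c) 1# z
            wσ z = P 1# c z ℕ.* σ z

          γ≥1 : 1 ≤ γ
          γ≥1 = go (as-sum (cong proj₁ Cc))
            where
            go : (∃₂ λ u v → K u × K v × c ≡ u + v) → 1 ≤ γ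
            go (u , v , Ku , Kv , eq) = P>0 1# 1# c u Ku (trans (cong τ (trans (cong (λ t → t - u) eq) (solve 2 (λ u v → (u :+ v) :- u := v) refl u v))) Kv)

          del-cases : del ≡ 0 ⊎ del ≡ y
          del-cases = go (del ℕ.≟ 0)
            where
            τic : ∀ {i j} → τ ic ≡ (i , j) → i ≡ suc j
            τic e = trans (sym (cong proj₁ e)) (trans (inv-departure′ (cong proj₁ Cc)) (cong (suc ∘ proj₂) e))
            c≉1 : ¬ c ≈± 1#
            c≉1 (inj₁ e) = clash Cc τ1 (λ ()) e
            c≉1 (inj₂ e) = clash Cc τ-1 (λ ()) e
            go′ : ic ≈± 1# ⊎ ic ≈± c → del ≡ 0 ⊎ del ≡ y
            go′ (inj₁ e) = contradiction (≈±-sym (subst₂ _≈±_ (inv-inverseʳ c≢0) (*-identityʳ c) (≈±-mult c c≢0 e))) c≉1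
            go′ (inj₂ (inj₁ e)) = contradiction (τic (trans e Cc)) λ ()
            go′ (inj₂ (inj₂ e)) = inj₂ (trans (P-∼ 1# (- 1#) -c≢0 e) (μ-neg c))
            go : Dec (del ≡ 0) → del ≡ 0 ⊎ del ≡ y
            go (yes e) = inj₁ e
            go (no h) = go′ (μ-support± ic ic≢0 h)

          μ± : ∀ {z x} → x ≢ 0# → z ≈± x → μ z ≡ μ x
          μ± x≢0 (inj₁ e) = P-∼ 1# (- 1#) x≢0 e
          μ± {x = x} x≢0 (inj₂ e) = trans (P-∼ 1# (- 1#) (-≢0 x≢0) e) (μ-neg x)

          k≤3 : k ≤ 3
          k≤3 = go del-cases
            where
            go : del ≡ 0 ⊎ del ≡ y → k ≤ 3
            go (inj₂ e) = energy-bound′ a y γ k (subst (λ t → a ℕ.* γ ℕ.+ y ℕ.* t ≤ γ ℕ.* t) e energy₂)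
              (subst (λ t → y ℕ.* y ℕ.+ γ ℕ.* γ ℕ.+ t ℕ.* t ≤ k ℕ.+ (2 ℕ.* (a ℕ.* t) ℕ.+ 2 ℕ.* (a ℕ.* y))) e energy₁) k≤1+2a+2y γ≥1
            go (inj₁ e) = ℕ.≤-trans k≤1+2a+2y (ℕ.≤-trans (ℕ.≤-reflexive (cong (λ t → 1 ℕ.+ 2 ℕ.* t ℕ.+ 2 ℕ.* y) a≡0))
                (s≤s (ℕ.*-monoʳ-≤ 2 (subst (_≤ 1) w-at-1 (P≤1 c c≢0 disjoint 1#)))))
              where
              aγ≡0 : a ℕ.* γ ≡ 0
              aγ≡0 = ℕ.n≤0⇒n≡0 (ℕ.≤-trans (ℕ.m≤m+n _ _) (ℕ.≤-trans energy₂ (ℕ.≤-reflexive (trans (cong (γ ℕ.*_) e) (ℕ.*-zeroʳ γ)))))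
              a≡0 : a ≡ 0
              a≡0 = ℕ.m*n≡0⇒m≡0 a γ {{ℕ.>-nonZero γ≥1}} aγ≡0
              disjoint : ∀ z → z ≢ 0# → μ z ℕ.* μ (ic * z) ≡ 0
              disjoint z z≢0 = product≡0 (μ z) (μ (ic * z)) λ h h′ → go′ h h′ (μ-support± z z≢0 h)
                where
                go′ : μ z ≢ 0 → μ (ic * z) ≢ 0 → z ≈± 1# ⊎ z ≈± c → ⊥
                go′ h h′ (inj₁ e) = h (trans (μ± 1≢0 e) a≡0)
                go′ h h′ (inj₂ e) = h′ (trans (μ± 1≢0 (subst (ic * z ≈±_) (trans (*-comm ic c) (inv-inverseʳ c≢0)) (≈±-mult ic ic≢0 e))) a≡0)

        |K|≤3 : k ≤ 3
        |K|≤3 = go (anyF? (λ z → τ z ≟τ (2 , 4)))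
          where
          odd≤ : ∀ n → k ≡ 1 ℕ.+ (n ℕ.+ n) → k ≤ 4 → k ≤ 3
          odd≤ 0 e _ = ℕ.≤-trans (ℕ.≤-reflexive e) (s≤s z≤n)
          odd≤ 1 e _ = ℕ.≤-reflexive e
          odd≤ (suc (suc n)) e k≤4 = contradiction (ℕ.≤-trans (ℕ.≤-reflexive (sym e)) k≤4) λ where
            (s≤s (s≤s (s≤s h))) → ℕ.<⇒≱ (ℕ.≤-trans (s≤s (s≤s z≤n)) (ℕ.m≤n+m (suc (suc n)) n)) h
          go : Dec (∃ D) → k ≤ 3
          go (yes (f , Df)) = odd≤ (proj₁ k-odd) (proj₂ k-odd) (WithD.k≤4 f Df)
          go (no noD) = NoD.k≤3 λ z Dz → noD (z , Dz)

        zero-product : ∀ {x y} → x ≢ 0# → x * y ≡ 0# → y ≡ 0#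
        zero-product {x} {y} x≢0 e = decidable-stable (y ≟F 0#) λ y≢0 → x*y≢0 x≢0 y≢0 e

        nontrivial : ∃ λ u → K u × u ≢ 1#
        nontrivial = go (anyF? (λ u → K? u ×-dec ¬? (u ≟F 1#)))
          where
          go : Dec (∃ λ u → K u × u ≢ 1#) → ∃ λ u → K u × u ≢ 1#
          go (yes h) = h
          go (no h) = contradiction (trans (sum11 (as-sum (cong proj₁ Cc))) (sym (sum11 (as-sum (cong proj₁ τ-1))))) λ c≡-1 →
              clash Cc τ-1 (λ ()) (cong τ c≡-1)
            where
            K⇒≡1 : ∀ {u} → K u → u ≡ 1#
            K⇒≡1 {u} Ku = decidable-stable (u ≟F 1#) λ u≢1 → h (u , Ku , u≢1)
            sum11 : ∀ {b} → (∃₂ λ u v → K u × K v × b ≡ u + v) → b ≡ 1# + 1#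
            sum11 (u , v , Ku , Kv , eq) = trans eq (cong₂ _+_ (K⇒≡1 Ku) (K⇒≡1 Kv))

        module Thirteen (u : F) (Ku : K u) (u≢1 : u ≢ 1#) where

          iu = inv u
          u≢0 = K⇒≢0 Ku

          u+1≢0 : u + 1# ≢ 0#
          u+1≢0 = K-sum≢0 Ku K1

          u-1≢0 : u - 1# ≢ 0#
          u-1≢0 = u≢1 ∘ x-y≡0

          u²≢1 : u * u ≢ 1#
          u²≢1 e = u+1≢0 (zero-product u-1≢0 (trans (solve 2 (λ u o → (u :- nat 1) :* (u :+ nat 1) := u :* u :- nat 1) refl u 1#)
            (trans (cong (_- 1#) e) (-‿inverseʳ 1#))))

          iu≢1 : iu ≢ 1#
          iu≢1 e = u≢1 (trans (sym (*-identityʳ u)) (trans (cong (u *_) (sym e)) (inv-inverseʳ u≢0)))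

          iu≢u : iu ≢ u
          iu≢u e = u²≢1 (trans (cong (u *_) (sym e)) (inv-inverseʳ u≢0))

          exhaust : ∀ t → K t → t ≡ 1# ⊎ t ≡ u ⊎ t ≡ iu
          exhaust = exhaust₃ K? |K|≤3 K1 Ku (K-inv Ku) u≢1 iu≢1 iu≢u

          u²≡iu : u * u ≡ iu
          u²≡iu = go (exhaust (u * u) (K-* Ku Ku))
            where
            go : u * u ≡ 1# ⊎ u * u ≡ u ⊎ u * u ≡ iu → u * u ≡ iu
            go (inj₁ e) = contradiction e u²≢1
            go (inj₂ (inj₁ e)) = contradiction (*-cancelˡ u≢0 (trans e (sym (*-identityʳ u)))) u≢1
            go (inj₂ (inj₂ e)) = e

          u³≡1 : u * (u * u) ≡ 1#
          u³≡1 = trans (cong (u *_) u²≡iu) (inv-inverseʳ u≢0)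

          1+u+u²≡0 : 1# + u + u * u ≡ 0#
          1+u+u²≡0 = zero-product u-1≢0 (trans (solve 1 (λ u → (u :- nat 1) :* (nat 1 :+ u :+ u :* u) := u :* (u :* u) :- nat 1) refl u)
            (trans (cong (_- 1#) u³≡1) (-‿inverseʳ 1#)))

          cube : ∀ t → K t → t * (t * t) ≡ 1#
          cube t Kt = go (exhaust t Kt)
            where
            go : t ≡ 1# ⊎ t ≡ u ⊎ t ≡ iu → t * (t * t) ≡ 1#
            go (inj₁ refl) = solve 0 (nat 1 :* (nat 1 :* nat 1) := nat 1) refl
            go (inj₂ (inj₁ refl)) = u³≡1
            go (inj₂ (inj₂ e)) = trans (cong (λ t → t * (t * t)) (trans e (sym u²≡iu)))
              (trans (solve 1 (λ u → (u :* u) :* ((u :* u) :* (u :* u)) := (u :* (u :* u)) :* (u :* (u :* u))) refl u)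
                (trans (cong₂ _*_ u³≡1 u³≡1) (*-identityʳ 1#)))

          two = 1# + 1#

          c∼two : c ∼ two
          c∼two = go (as-sum (cong proj₁ Cc))
            where
            go : (∃₂ λ x y → K x × K y × c ≡ x + y) → c ∼ two
            go (x , y′ , Kx , Ky , eq) = go′ (exhaust w (trans (K-scale y′ (K-inv Kx)) Ky))
              where
              w = inv x * y′
              c∼1+w : c ∼ 1# + w
              c∼1+w = trans (cong τ (trans eq (trans (cong₂ _+_ (sym (*-identityʳ x)) (sym (inv-cancelʳ y′ (K⇒≢0 Kx)))) (sym (distribˡ x 1# w)))))
                (K-scale (1# + w) Kx)
              not-neg : ∀ {t} → K t → 1# + w ≡ - t → c ∼ two
              not-neg Kt e = contradiction (trans (trans c∼1+w (cong τ e)) (∼-neg Kt)) (clash Cc τ-1 λ ())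
              go′ : w ≡ 1# ⊎ w ≡ u ⊎ w ≡ iu → c ∼ two
              go′ (inj₁ e) = trans c∼1+w (cong (λ v → τ (1# + v)) e)
              go′ (inj₂ (inj₁ e)) = not-neg (K-* Ku Ku) (trans (cong (1# +_) e)
                (trans (solve 1 (λ u → nat 1 :+ u := (nat 1 :+ u :+ u :* u) :- u :* u) refl u) (trans (cong (_- u * u) 1+u+u²≡0) (+-identityˡ _))))
              go′ (inj₂ (inj₂ e)) = not-neg Ku (trans (cong (1# +_) (trans e (sym u²≡iu)))
                (trans (solve 1 (λ u → nat 1 :+ u :* u := (nat 1 :+ u :+ u :* u) :- u) refl u) (trans (cong (_- u) 1+u+u²≡0) (+-identityˡ _))))

          two≢0 : two ≢ 0#
          two≢0 e = c≢0 (∼0⇒≡0 (trans c∼two (cong τ e)))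

          -- (1 - u)² = - 3 u; cubing it for 1 - u = ± e t with t³ = 1 gives e⁶ = - 27.
          sixth : ∀ {e t} → K t → (1# - u) * (1# - u) ≡ (e * t) * (e * t) → (e * e) * ((e * e) * (e * e)) + 27 · 1# ≡ 0#
          sixth {e} {t} Kt eq = begin
            e⁶ + 27 · 1#                          ≡⟨ cong (_+ 27 · 1#) (trans (sym (*-identityʳ e⁶)) (cong (e⁶ *_) (trans (sym (*-identityʳ 1#)) (sym (cong₂ _*_ (cube t Kt) (cube t Kt)))))) ⟩
            e⁶ * ((t * (t * t)) * (t * (t * t))) + 27 · 1#
              ≡⟨ cong (_+ 27 · 1#) (solve 2 (λ e t → ((e :* e) :* ((e :* e) :* (e :* e))) :* ((t :* (t :* t)) :* (t :* (t :* t)))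
                   := ((e :* t) :* (e :* t)) :* (((e :* t) :* (e :* t)) :* ((e :* t) :* (e :* t)))) refl e t) ⟩
            s * (s * s) + 27 · 1#                 ≡⟨ cong (λ v → v * (v * v) + 27 · 1#) (trans (sym eq) square) ⟩
            m * (m * m) + 27 · 1#                 ≡⟨ solve 1 (λ u → (:- (num 3 :* u)) :* ((:- (num 3 :* u)) :* (:- (num 3 :* u))) :+ num 27 := num 27 :* (nat 1 :- u :* (u :* u))) refl u ⟩
            (27 · 1#) * (1# - u * (u * u))          ≡⟨ cong (λ v → (27 · 1#) * (1# - v)) u³≡1 ⟩
            (27 · 1#) * (1# - 1#)                   ≡⟨ trans (cong ((27 · 1#) *_) (-‿inverseʳ 1#)) (zeroʳ _) ⟩
            0# ∎
            where
            open ≡-Reasoning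
            num : ∀ {n} → ℕ → Polynomial n
            num zero = nat 0
            num (suc n) = nat 1 :+ num n
            e⁶ = (e * e) * ((e * e) * (e * e))
            s = (e * t) * (e * t)
            m = - ((3 · 1#) * u)
            square : (1# - u) * (1# - u) ≡ m
            square = trans (solve 1 (λ u → (nat 1 :- u) :* (nat 1 :- u) := (nat 1 :+ u :+ u :* u) :+ (:- (num 3 :* u))) refl u)
              (trans (cong (_+ m) 1+u+u²≡0) (+-identityˡ m))

          p∣28⊎91 : p ∣ 28 ⊎ p ∣ 91
          p∣28⊎91 = go (difference K1 Ku (u≢1 ∘ sym))
            where
            num : ∀ {n} → ℕ → Polynomial n
            num zero = nat 0
            num (suc n) = nat 1 :+ num n
            ·1≡0⇒∣ : ∀ n → n · 1# ≡ 0# → p ∣ n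
            ·1≡0⇒∣ n e = ⟦⟧≡0⇒∣ (trans (sym (*-identityʳ ⟦ n ⟧)) (trans (sym (·≡* n 1#)) e))
            neg-square : ∀ {x} → (1# - u) * (1# - u) ≡ (- (1# - u)) * (- (1# - u))
            neg-square = solve 1 (λ x → x :* x := (:- x) :* (:- x)) refl (1# - u)
            one-case : ∀ t → K t → (1# - u) * (1# - u) ≡ t * t → p ∣ 28
            one-case t Kt e = ·1≡0⇒∣ 28 (trans (solve 0 (num 28 := (nat 1 :* nat 1) :* ((nat 1 :* nat 1) :* (nat 1 :* nat 1)) :+ num 27) refl)
              (sixth {1#} {t} Kt (trans e (cong₂ _*_ (sym (*-identityˡ t)) (sym (*-identityˡ t))))))
            two-case : ∀ x → C x → (1# - u) * (1# - u) ≡ x * x → p ∣ 91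
            two-case x Cx e = ·1≡0⇒∣ 91 (trans (solve 0 (num 91 := let w = nat 1 :+ nat 1 in (w :* w) :* ((w :* w) :* (w :* w)) :+ num 27) refl)
              (sixth {two} {inv two * x} (quotient∈K two≢0 (trans (trans Cx (sym Cc)) c∼two))
                (trans e (cong₂ _*_ (sym (inv-cancelʳ x two≢0)) (sym (inv-cancelʳ x two≢0))))))
            go : K (1# - u) ⊎ K (- (1# - u)) ⊎ C (1# - u) ⊎ C (- (1# - u)) → p ∣ 28 ⊎ p ∣ 91
            go (inj₁ h) = inj₁ (one-case _ h refl)
            go (inj₂ (inj₁ h)) = inj₁ (one-case _ h (neg-square {u}))
            go (inj₂ (inj₂ (inj₁ h))) = inj₂ (two-case _ h refl)
            go (inj₂ (inj₂ (inj₂ h))) = inj₂ (two-case _ h (neg-square {u}))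

          3≤k : 3 ≤ k
          3≤k = subst (3 ≤_) (sym (trans (count-remove K? 1# K1) (cong suc (count-remove K₁? u (Ku , u≢1)))))
            (s≤s (s≤s (count>0 (λ v → K₁? v ×-dec ¬? (v ≟F u)) iu ((K-inv Ku , iu≢1) , iu≢u))))
            where
            K₁? : Decidable (λ v → K v × v ≢ 1#)
            K₁? v = K? v ×-dec ¬? (v ≟F 1#)

          9≤p : 9 ≤ p
          9≤p = ℕ.≤-trans (ℕ.*-monoʳ-≤ 3 3≤k) (ℕ.≤-trans
            (lower-bound {1# ∷ - 1# ∷ c ∷ []} (λ _ → 1) (λ _ _ → refl) (1≢0 ∷ -1≢0 ∷ c≢0 ∷ [])
              ((clash τ1 τ-1 (λ ()) ∷ clash τ1 Cc (λ ()) ∷ []) ∷ (clash τ-1 Cc (λ ()) ∷ []) ∷ [] ∷ []))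
            (ℕ.≤-reflexive (count-⊤ p)))

          p≡13 : p ≡ 13
          p≡13 = go p∣28⊎91
            where
            too-small : ∀ n {A : Set} .{{_ : NonZero n}} → n ≤ 8 → p ∣ n → A
            too-small n n≤8 h = contradiction (ℕ.≤-trans 9≤p (∣⇒≤ h)) (ℕ.<⇒≱ (s≤s n≤8))
            go : p ∣ 28 ⊎ p ∣ 91 → p ≡ 13
            go (inj₁ h) = Sum.[ too-small 4 (s≤s (s≤s (s≤s (s≤s z≤n)))) , too-small 7 (s≤s (s≤s (s≤s (s≤s (s≤s (s≤s (s≤s z≤n))))))) ] (euclidsLemma 4 7 pr h)
            go (inj₂ h) = Sum.[ too-small 7 (s≤s (s≤s (s≤s (s≤s (s≤s (s≤s (s≤s z≤n))))))) ,
                Sum.[ (λ e → contradiction (subst (9 ≤_) e 9≤p) λ where (s≤s ())) , (λ e → e) ] ∘ prime⇒irreducible (from-yes (prime? 13)) ]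
              (euclidsLemma 7 13 pr h)

    classification : (∀ u → K u → u ≡ 1#) ⊎ (∀ x → x ≡ 0# ⊎ K x ⊎ K (- x)) ⊎
      (p ≡ 13 × (∀ t → K t → t * (t * t) ≡ 1#) × ∃ λ u → K u × u ≢ 1#)
    classification = go h refl
      where
      go : ∀ n → h ≡ n → (∀ u → K u → u ≡ 1#) ⊎ (∀ x → x ≡ 0# ⊎ K x ⊎ K (- x)) ⊎
        (p ≡ 13 × (∀ t → K t → t * (t * t) ≡ 1#) × ∃ λ u → K u × u ≢ 1#)
      go 0 e = contradiction (ℕ.≤-trans h≥2 (ℕ.≤-reflexive e)) λ ()
      go 1 e = contradiction (ℕ.≤-trans h≥2 (ℕ.≤-reflexive e)) λ where (s≤s ())
      go 3 e = contradiction e h≢3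
      go (suc (suc (suc (suc r)))) e = inj₁ (Long.trivial-K r e)
      go 2 e = inj₂ (go′ (Short.all-or-C e))
        where
        go′ : (∀ x → x ≡ 0# ⊎ K x ⊎ K (- x)) ⊎ ∃ (Short.C e) → (∀ x → x ≡ 0# ⊎ K x ⊎ K (- x)) ⊎
          (p ≡ 13 × (∀ t → K t → t * (t * t) ≡ 1#) × ∃ λ u → K u × u ≢ 1#)
        go′ (inj₁ h) = inj₁ h
        go′ (inj₂ (c , Cc)) = inj₂ (p≡13 , cube , nontrivial)
          where
          open Short.WithC e c Cc using (nontrivial; module Thirteen)
          open Thirteen (proj₁ nontrivial) (proj₁ (proj₂ nontrivial)) (proj₂ (proj₂ nontrivial)) using (p≡13; cube)

-- Primitive roots

prime-part : ∀ {q} → Prime q → ∀ n → n ≢ 0 → ∃₂ λ a m → n ≡ q ℕ.^ a ℕ.* m × ¬ q ∣ m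
prime-part {q} pr n n≢0 = go n n ℕ.≤-refl n≢0
  where
  1<q = ℕ.nonTrivial⇒n>1 q {{prime⇒nonTrivial pr}}
  go : ∀ bound n → n ≤ bound → n ≢ 0 → ∃₂ λ a m → n ≡ q ℕ.^ a ℕ.* m × ¬ q ∣ m
  go zero n n≤0 n≢0 = contradiction (ℕ.n≤0⇒n≡0 n≤0) n≢0
  go (suc bound) n n≤ n≢0 with q ∣? n
  ... | no q∤n = 0 , n , sym (ℕ.*-identityˡ n) , q∤n
  ... | yes (divides t e) = suc (proj₁ r) , proj₁ (proj₂ r) , eq , proj₂ (proj₂ (proj₂ r))
    where
    t≢0 : t ≢ 0
    t≢0 refl = n≢0 e
    r = go bound t (ℕ.≤-pred (ℕ.<-≤-trans (subst (t <_) (sym e) (ℕ.m<m*n t q {{ℕ.≢-nonZero t≢0}} 1<q)) n≤)) t≢0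
    eq : n ≡ q ℕ.^ suc (proj₁ r) ℕ.* proj₁ (proj₂ r)
    eq = trans e (trans (ℕ.*-comm t q) (trans (cong (q ℕ.*_) (proj₁ (proj₂ (proj₂ r)))) (sym (ℕ.*-assoc q _ _))))

prime∤⇒coprime : ∀ {q} → Prime q → ∀ {m} → ¬ q ∣ m → Coprime m q
prime∤⇒coprime pr q∤m (d∣m , d∣q) = Sum.[ (λ e → e) , (λ e → contradiction (subst (_∣ _) e d∣m) q∤m) ] (prime⇒irreducible pr d∣q)

coprime-^ : ∀ {m q} → Coprime m q → ∀ k → Coprime m (q ℕ.^ k)
coprime-^ c zero (d∣m , d∣1) = ℕ.≤-antisym (∣⇒≤ d∣1) (ℕ.n≢0⇒n>0 λ where refl → contradiction (∣⇒≤ d∣1) λ _ → absurd d∣1)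
  where
  absurd : ¬ 0 ∣ 1
  absurd (divides q e) = contradiction (trans e (ℕ.*-zeroʳ q)) λ ()
coprime-^ c (suc k) (d∣m , d∣) = coprime-^ c k (d∣m , coprime-divisor (λ (e∣d , e∣q) → c (∣-trans e∣d d∣m , e∣q)) d∣)

module PrimitiveRoot (p : ℕ) (pr : Prime p) where
  open PrimeField p pr
  open import Algebra.Properties.Semiring.Exp (CommutativeRing.semiring commutativeRing) public
    using (_^_; ^-homo-*; ^-assocʳ)
  open import Algebra.Properties.CommutativeSemiring.Exp (CommutativeRing.commutativeSemiring commutativeRing) public
    using (^-distrib-*)
  open import Algebra.Properties.Semiring.Mult (CommutativeRing.semiring commutativeRing) using () renaming (_×_ to _ו_)

  1^ : ∀ n → 1# ^ n ≡ 1#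
  1^ zero = refl
  1^ (suc n) = trans (*-identityˡ _) (1^ n)

  ^≢0 : ∀ {x} n → x ≢ 0# → x ^ n ≢ 0#
  ^≢0 zero x≢0 = 1≢0
  ^≢0 (suc n) x≢0 = x*y≢0 x≢0 (^≢0 n x≢0)

  ⟦^⟧ : ∀ a n → ⟦ a ℕ.^ n ⟧ ≡ ⟦ a ⟧ ^ n
  ⟦^⟧ a zero = refl
  ⟦^⟧ a (suc n) = trans (*-homo a (a ℕ.^ n)) (cong (⟦ a ⟧ *_) (⟦^⟧ a n))

  power-one : ∀ {x} a b → x ^ a ≡ 1# → x ^ (a ℕ.* b) ≡ 1#
  power-one {x} a b e = trans (sym (^-assocʳ x a b)) (trans (cong (_^ b) e) (1^ b))

  power-one′ : ∀ {x} a b → x ^ b ≡ 1# → x ^ (a ℕ.* b) ≡ 1#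
  power-one′ {x} a b e = trans (cong (x ^_) (ℕ.*-comm a b)) (power-one b a e)

  fermat-p : ∀ x → x ^ p ≡ x
  fermat-p x = subst (λ x → x ^ p ≡ x) (⟦toℕ⟧ x) (go (toℕ x))
    where
    char : p ו 1# ≡ 0#
    char = trans (same p) (trans (·≡* p 1#) (trans (*-identityʳ ⟦ p ⟧) (∣⇒⟦⟧≡0 ∣-refl)))
      where
      same : ∀ n → n ו 1# ≡ n · 1#
      same zero = refl
      same (suc n) = cong (1# +_) (same n)
    0^p : ∀ n → n ≢ 0 → 0# ^ n ≡ 0#
    0^p zero h = contradiction refl h
    0^p (suc n) _ = zeroˡ _
    go : ∀ n → ⟦ n ⟧ ^ p ≡ ⟦ n ⟧
    go zero = 0^p p (ℕ.≢-nonZero⁻¹ p)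
    go (suc n) = trans (cong (_^ p) (+-homo 1 n)) (trans (Freshman.freshman (CommutativeRing.commutativeSemiring commutativeRing) p pr char 1# ⟦ n ⟧)
      (trans (cong₂ _+_ (1^ p) (go n)) (sym (+-homo 1 n))))

  N : ℕ
  N = ℕ.pred p

  1+N≡p : suc N ≡ p
  1+N≡p = ℕ.suc-pred p

  fermat : ∀ {x} → x ≢ 0# → x ^ N ≡ 1#
  fermat {x} x≢0 = *-cancelˡ x≢0 (trans (cong (x ^_) 1+N≡p) (trans (fermat-p x) (sym (*-identityʳ x))))

  Monic : ℕ → (F → F) → Set
  Monic zero f = ∀ x → f x ≡ 1#
  Monic (suc n) f = ∃₂ λ g c → Monic n g × (∀ x → f x ≡ x * g x + c)

  add-lower : ∀ n {f g} r → Monic (suc n) f → Monic n g → Monic (suc n) (λ x → f x + r * g x)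
  add-lower zero {f} {g} r (f₁ , c , m₁ , e) m = f₁ , c + r , m₁ , λ x → begin
      f x + r * g x              ≡⟨ cong₂ (λ a b → a + r * b) (e x) (m x) ⟩
      x * f₁ x + c + r * 1#      ≡⟨ solve 4 (λ x f c r → x :* f :+ c :+ r :* nat 1 := x :* f :+ (c :+ r)) refl x (f₁ x) c r ⟩
      x * f₁ x + (c + r) ∎
    where open ≡-Reasoning
  add-lower (suc n) {f} {g} r (f₁ , c , m₁ , e) (g₁ , c′ , m₁′ , e′) =
    (λ x → f₁ x + r * g₁ x) , c + r * c′ , add-lower n r m₁ m₁′ , λ x → begin
      f x + r * g x                                ≡⟨ cong₂ (λ a b → a + r * b) (e x) (e′ x) ⟩
      x * f₁ x + c + r * (x * g₁ x + c′)           ≡⟨ solve 6 (λ x f g c c′ r → x :* f :+ c :+ r :* (x :* g :+ c′) := x :* (f :+ r :* g) :+ (c :+ r :* c′)) refl x (f₁ x) (g₁ x) c c′ r ⟩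
      x * (f₁ x + r * g₁ x) + (c + r * c′) ∎
    where open ≡-Reasoning

  divide : ∀ n {f} → Monic (suc n) f → ∀ r → ∃ λ g → Monic n g × (∀ x → f x - f r ≡ (x - r) * g x)
  divide zero {f} (f₁ , c , m , e) r = (λ _ → 1#) , (λ _ → refl) , λ x → begin
      f x - f r                              ≡⟨ cong₂ _-_ (trans (e x) (cong (λ a → x * a + c) (m x))) (trans (e r) (cong (λ a → r * a + c) (m r))) ⟩
      x * 1# + c - (r * 1# + c)              ≡⟨ solve 3 (λ x r c → x :* nat 1 :+ c :- (r :* nat 1 :+ c) := (x :- r) :* nat 1) refl x r c ⟩
      (x - r) * 1# ∎
    where open ≡-Reasoning
  divide (suc n) {f} (f₁ , c , m , e) r = (λ x → f₁ x + r * h x) , add-lower n r m mh , λ x → begin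
      f x - f r                                          ≡⟨ cong₂ _-_ (e x) (e r) ⟩
      x * f₁ x + c - (r * f₁ r + c)                      ≡⟨ solve 5 (λ x r c f g → x :* f :+ c :- (r :* g :+ c) := (x :- r) :* f :+ r :* (f :- g)) refl x r c (f₁ x) (f₁ r) ⟩
      (x - r) * f₁ x + r * (f₁ x - f₁ r)                 ≡⟨ cong (λ v → (x - r) * f₁ x + r * v) (eh x) ⟩
      (x - r) * f₁ x + r * ((x - r) * h x)               ≡⟨ solve 4 (λ x r f h → (x :- r) :* f :+ r :* ((x :- r) :* h) := (x :- r) :* (f :+ r :* h)) refl x r (f₁ x) (h x) ⟩
      (x - r) * (f₁ x + r * h x) ∎
    where
    open ≡-Reasoning
    h = proj₁ (divide n m r)
    mh = proj₁ (proj₂ (divide n m r))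
    eh = proj₂ (proj₂ (divide n m r))

  too-many-roots : ∀ n {f} → Monic n f → (ρ : ℕ → F) → (∀ i j → i < j → j ≤ n → ρ i ≢ ρ j) → ¬ (∀ i → i ≤ n → f (ρ i) ≡ 0#)
  too-many-roots zero m ρ distinct root = 1≢0 (trans (sym (m (ρ 0))) (root 0 z≤n))
  too-many-roots (suc n) {f} m ρ distinct root = too-many-roots n (proj₁ (proj₂ q)) ρ (λ i j i<j j≤n → distinct i j i<j (ℕ.m≤n⇒m≤1+n j≤n)) λ i i≤n →
      decidable-stable (g (ρ i) ≟F 0#) λ gρ≢0 → x*y≢0 (λ e → distinct i (suc n) (s≤s i≤n) ℕ.≤-refl (x-y≡0 e)) gρ≢0
        (trans (sym (proj₂ (proj₂ q) (ρ i))) (trans (cong₂ _-_ (root i (ℕ.m≤n⇒m≤1+n i≤n)) (root (suc n) ℕ.≤-refl)) (-‿inverseʳ 0#)))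
    where
    q = divide n m (ρ (suc n))
    g = proj₁ q

  ^-monic : ∀ n → Monic n (λ x → x ^ n)
  ^-monic zero x = refl
  ^-monic (suc n) = (λ x → x ^ n) , 0# , ^-monic n , λ x → sym (+-identityʳ _)

  ^-1-monic : ∀ n → 0 < n → Monic n (λ x → x ^ n - 1#)
  ^-1-monic (suc n) _ = (λ x → x ^ n) , - 1# , ^-monic n , λ x → refl

  nonroot : ∀ M → 0 < M → M < N → ∃ λ x → x ≢ 0# × x ^ M ≢ 1#
  nonroot M 0<M M<N = go (anyF? (λ x → ¬? (x ≟F 0#) ×-dec ¬? (x ^ M ≟F 1#)))
    where
    go : Dec (∃ λ x → x ≢ 0# × x ^ M ≢ 1#) → ∃ λ x → x ≢ 0# × x ^ M ≢ 1#
    go (yes h) = h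
    go (no h) = contradiction
        (λ i i≤M → trans (cong (_- 1#) (decidable-stable (⟦ suc i ⟧ ^ M ≟F 1#) λ ne → h (⟦ suc i ⟧ , ⟦⟧≢0 (s≤s z≤n) (bound i≤M) , ne))) (-‿inverseʳ 1#))
        (too-many-roots M (^-1-monic M 0<M) (λ i → ⟦ suc i ⟧)
          λ i j i<j j≤M e → ℕ.<⇒≢ i<j (ℕ.suc-injective (trans (sym (toℕ-⟦⟧-< (bound (ℕ.≤-trans (ℕ.<⇒≤ i<j) j≤M)))) (trans (cong toℕ e) (toℕ-⟦⟧-< (bound j≤M))))))
      where
      bound : ∀ {i} → i ≤ M → suc i < p
      bound i≤M = subst (_ <_) 1+N≡p (s≤s (ℕ.≤-<-trans i≤M M<N))

  HasOrder : F → ℕ → Set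
  HasOrder g m = g ^ m ≡ 1# × (∀ j → g ^ j ≡ 1# → m ∣ j)

  coprime-one : ∀ {y t q} → Coprime t q → y ^ t ≡ 1# → y ^ q ≡ 1# → y ≡ 1#
  coprime-one {y} {t} {q} c et eq = go (coprime-Bézout c)
    where
    combine : ∀ {t q} a b → y ^ t ≡ 1# → y ^ q ≡ 1# → 1 ℕ.+ b ℕ.* q ≡ a ℕ.* t → y ≡ 1#
    combine {t} {q} a b et eq e = begin
      y                        ≡⟨ *-identityʳ y ⟨
      y * 1#                   ≡⟨ cong (y *_) (power-one′ b q eq) ⟨
      y ^ (1 ℕ.+ b ℕ.* q)      ≡⟨ cong (y ^_) e ⟩
      y ^ (a ℕ.* t)            ≡⟨ power-one′ a t et ⟩
      1# ∎
      where open ≡-Reasoning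
    go : Bézout.Identity 1 t q → y ≡ 1#
    go (Bézout.+- a b e) = combine a b et eq e
    go (Bézout.-+ a b e) = combine b a eq et e

  order-prime-power : ∀ {h q} a → Prime q → h ^ (q ℕ.^ suc a) ≡ 1# → h ^ (q ℕ.^ a) ≢ 1# → HasOrder h (q ℕ.^ suc a)
  order-prime-power {h} {q} a qpr e ne = e , λ j ej → go (suc a) ℕ.≤-refl j ej
    where
    go : ∀ i → i ≤ suc a → ∀ j → h ^ j ≡ 1# → q ℕ.^ i ∣ j
    go zero _ j _ = 1∣ j
    go (suc i) (s≤s i≤a) j ej = lift (go i (ℕ.m≤n⇒m≤1+n i≤a) j ej)
      where
      lift : q ℕ.^ i ∣ j → q ℕ.^ suc i ∣ j
      lift (divides t j≡) = subst (q ℕ.^ suc i ∣_) (trans (ℕ.*-comm (q ℕ.^ i) t) (sym j≡))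
        (subst (_∣ q ℕ.^ i ℕ.* t) (ℕ.*-comm (q ℕ.^ i) q) (*-monoʳ-∣ (q ℕ.^ i) q∣t))
        where
        y^t : (h ^ (q ℕ.^ a)) ^ t ≡ 1#
        y^t = trans (^-assocʳ h (q ℕ.^ a) t) (trans (cong (h ^_) exponents) (power-one j (q ℕ.^ (a ℕ.∸ i)) ej))
          where
          exponents : q ℕ.^ a ℕ.* t ≡ j ℕ.* q ℕ.^ (a ℕ.∸ i)
          exponents = begin
            q ℕ.^ a ℕ.* t                            ≡⟨ cong (λ b → q ℕ.^ b ℕ.* t) (sym (ℕ.m∸n+n≡m i≤a)) ⟩
            q ℕ.^ (a ℕ.∸ i ℕ.+ i) ℕ.* t              ≡⟨ cong (ℕ._* t) (ℕ.^-distribˡ-+-* q (a ℕ.∸ i) i) ⟩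
            q ℕ.^ (a ℕ.∸ i) ℕ.* q ℕ.^ i ℕ.* t        ≡⟨ ℕ.*-assoc (q ℕ.^ (a ℕ.∸ i)) _ t ⟩
            q ℕ.^ (a ℕ.∸ i) ℕ.* (q ℕ.^ i ℕ.* t)      ≡⟨ cong (q ℕ.^ (a ℕ.∸ i) ℕ.*_) (trans (ℕ.*-comm _ t) (sym j≡)) ⟩
            q ℕ.^ (a ℕ.∸ i) ℕ.* j                    ≡⟨ ℕ.*-comm _ j ⟩
            j ℕ.* q ℕ.^ (a ℕ.∸ i) ∎
            where open ≡-Reasoning
        q∣t : q ∣ t
        q∣t = decidable-stable (q ∣? t) λ q∤t → ne (coprime-one (prime∤⇒coprime qpr q∤t) y^t
          (trans (^-assocʳ h (q ℕ.^ a) q) (trans (cong (h ^_) (ℕ.*-comm (q ℕ.^ a) q)) e)))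

  order-product : ∀ {g h m n} → Coprime m n → HasOrder g m → HasOrder h n → HasOrder (g * h) (m ℕ.* n)
  order-product {g} {h} {m} {n} c (gm , og) (hn , oh) =
    trans (^-distrib-* g h (m ℕ.* n)) (trans (cong₂ _*_ (power-one m n gm) (power-one′ m n hn)) (*-identityʳ 1#)) ,
    λ j e → both (m∣ j e) (n∣ j e)
    where
    m∣ : ∀ j → (g * h) ^ j ≡ 1# → m ∣ j
    m∣ j e = coprime-divisor c (og (n ℕ.* j) (begin
      g ^ (n ℕ.* j)                         ≡⟨ *-identityʳ _ ⟨
      g ^ (n ℕ.* j) * 1#                    ≡⟨ cong (g ^ (n ℕ.* j) *_) (power-one n j hn) ⟨
      g ^ (n ℕ.* j) * h ^ (n ℕ.* j)         ≡⟨ ^-distrib-* g h (n ℕ.* j) ⟨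
      (g * h) ^ (n ℕ.* j)                   ≡⟨ power-one′ n j e ⟩
      1# ∎))
      where open ≡-Reasoning
    n∣ : ∀ j → (g * h) ^ j ≡ 1# → n ∣ j
    n∣ j e = coprime-divisor (coprime-sym c) (oh (m ℕ.* j) (begin
      h ^ (m ℕ.* j)                         ≡⟨ *-identityˡ _ ⟨
      1# * h ^ (m ℕ.* j)                    ≡⟨ cong (_* h ^ (m ℕ.* j)) (power-one m j gm) ⟨
      g ^ (m ℕ.* j) * h ^ (m ℕ.* j)         ≡⟨ ^-distrib-* g h (m ℕ.* j) ⟨
      (g * h) ^ (m ℕ.* j)                   ≡⟨ power-one′ m j e ⟩
      1# ∎))
      where open ≡-Reasoning
    both : ∀ {j} → m ∣ j → n ∣ j → m ℕ.* n ∣ j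
    both m∣j (divides t refl) = subst₂ _∣_ (ℕ.*-comm n m) (ℕ.*-comm n t)
      (*-monoʳ-∣ n (coprime-divisor c (subst (m ∣_) (ℕ.*-comm t n) m∣j)))

  order-step : ∀ {g m q c} → Prime q → HasOrder g m → m ℕ.* q ℕ.* c ≡ N → ∃ λ g′ → HasOrder g′ (m ℕ.* q)
  order-step {g} {m} {q} {c} qpr (gm , og) e = g ^ (q ℕ.^ a) * h , subst (HasOrder (g ^ (q ℕ.^ a) * h)) order≡
      (order-product (coprime-^ (prime∤⇒coprime qpr q∤m′) (suc a)) g-order h-order)
    where
    instance
      q≢0 : NonZero q
      q≢0 = prime⇒nonZero qpr
    N>0 : 0 < N
    N>0 = ℕ.≤-pred (subst (1 <_) (sym 1+N≡p) 1<p)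
    m≢0 : m ≢ 0
    m≢0 refl = ℕ.<⇒≢ N>0 e
    c≢0 : c ≢ 0
    c≢0 refl = ℕ.<⇒≢ N>0 (trans (sym (ℕ.*-zeroʳ (m ℕ.* q))) e)
    part = prime-part qpr m m≢0
    a = proj₁ part
    m′ = proj₁ (proj₂ part)
    m≡ : m ≡ q ℕ.^ a ℕ.* m′
    m≡ = proj₁ (proj₂ (proj₂ part))
    q∤m′ : ¬ q ∣ m′
    q∤m′ = proj₂ (proj₂ (proj₂ part))
    M = m ℕ.* c
    Mq≡N : M ℕ.* q ≡ N
    Mq≡N = trans (ℕ.*-assoc m c q) (trans (cong (m ℕ.*_) (ℕ.*-comm c q)) (trans (sym (ℕ.*-assoc m q c)) e))
    instance
      M≢0 : NonZero M
      M≢0 = ℕ.m*n≢0 m c {{ℕ.≢-nonZero m≢0}} {{ℕ.≢-nonZero c≢0}}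
    M<N : M < N
    M<N = subst (M <_) Mq≡N (ℕ.m<m*n M q (ℕ.nonTrivial⇒n>1 q {{prime⇒nonTrivial qpr}}))
    x = proj₁ (nonroot M (ℕ.>-nonZero⁻¹ M) M<N)
    x≢0 = proj₁ (proj₂ (nonroot M (ℕ.>-nonZero⁻¹ M) M<N))
    x^M≢1 = proj₂ (proj₂ (nonroot M (ℕ.>-nonZero⁻¹ M) M<N))
    h = x ^ (m′ ℕ.* c)
    M≡ : m′ ℕ.* c ℕ.* q ℕ.^ a ≡ M
    M≡ = trans (ℕ.*-comm (m′ ℕ.* c) (q ℕ.^ a)) (trans (sym (ℕ.*-assoc (q ℕ.^ a) m′ c)) (cong (ℕ._* c) (sym m≡)))
    h-order : HasOrder h (q ℕ.^ suc a)
    h-order = order-prime-power a qpr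
      (trans (^-assocʳ x (m′ ℕ.* c) (q ℕ.^ suc a)) (trans (cong (x ^_) (trans (cong (m′ ℕ.* c ℕ.*_) (ℕ.*-comm q (q ℕ.^ a)))
        (trans (sym (ℕ.*-assoc (m′ ℕ.* c) (q ℕ.^ a) q)) (trans (cong (ℕ._* q) M≡) Mq≡N)))) (fermat x≢0)))
      (λ e → x^M≢1 (trans (cong (x ^_) (sym M≡)) (trans (sym (^-assocʳ x (m′ ℕ.* c) (q ℕ.^ a))) e)))
    g-order : HasOrder (g ^ (q ℕ.^ a)) m′
    g-order = trans (^-assocʳ g (q ℕ.^ a) m′) (trans (cong (g ^_) (sym m≡)) gm) ,
      λ j e → *-cancelˡ-∣ (q ℕ.^ a) {{ℕ.m^n≢0 q a}} (subst (_∣ q ℕ.^ a ℕ.* j) m≡ (og _ (trans (sym (^-assocʳ g (q ℕ.^ a) j)) e)))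
    order≡ : m′ ℕ.* q ℕ.^ suc a ≡ m ℕ.* q
    order≡ = trans (cong (m′ ℕ.*_) (ℕ.*-comm q (q ℕ.^ a))) (trans (sym (ℕ.*-assoc m′ (q ℕ.^ a) q))
      (cong (ℕ._* q) (trans (ℕ.*-comm m′ (q ℕ.^ a)) (sym m≡))))

  element-of-order-N : ∃ λ g → HasOrder g N
  element-of-order-N = build (factors) factorsPrime 1# 1 (1^ 1 , λ j _ → 1∣ j) (trans (ℕ.*-identityˡ _) (sym isFactorisation))
    where
    instance
      N≢0 : NonZero N
      N≢0 = ℕ.>-nonZero (ℕ.≤-pred (subst (1 <_) (sym 1+N≡p) 1<p))
    open PrimeFactorisation (factorise N)
    build : ∀ qs → All Prime qs → ∀ g m → HasOrder g m → m ℕ.* product qs ≡ N → ∃ λ g → HasOrder g N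
    build [] [] g m o e = g , subst (HasOrder g) (trans (sym (ℕ.*-identityʳ m)) e) o
    build (q ∷ qs) (qpr ∷ qprs) g m o e = build qs qprs (proj₁ next) (m ℕ.* q) (proj₂ next) e′
      where
      e′ : m ℕ.* q ℕ.* product qs ≡ N
      e′ = trans (ℕ.*-assoc m q _) e
      next = order-step {c = product qs} qpr o e′

  primitive-root : ∃ λ α → α ≢ 0# × (∀ x → x ≢ 0# → ∃ λ k → α ^ k ≡ x)
  primitive-root = α , α≢0 , λ x x≢0 → power x x≢0
    where
    α = proj₁ element-of-order-N
    αN = proj₁ (proj₂ element-of-order-N)
    order = proj₂ (proj₂ element-of-order-N)
    N>0 : 0 < N
    N>0 = ℕ.≤-pred (subst (1 <_) (sym 1+N≡p) 1<p)
    zero-power : ∀ n → 0 < n → 0# ^ n ≡ 0#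
    zero-power (suc n) _ = zeroˡ _
    α≢0 : α ≢ 0#
    α≢0 e = 1≢0 (trans (sym αN) (trans (cong (_^ N) e) (zero-power N N>0)))
    power : ∀ x → x ≢ 0# → ∃ λ k → α ^ k ≡ x
    power x x≢0 = go (anyF? {N} (λ i → α ^ toℕ i ≟F x))
      where
      go : Dec (∃ λ (i : Fin N) → α ^ toℕ i ≡ x) → ∃ λ k → α ^ k ≡ x
      go (yes (i , e)) = toℕ i , e
      go (no h) = contradiction root (too-many-roots N (^-1-monic N N>0) ρ distinct)
        where
        ρ′ : ∀ i → Dec (i < N) → F
        ρ′ i (yes _) = α ^ i
        ρ′ i (no _) = x
        ρ : ℕ → F
        ρ i = ρ′ i (i ℕ.<? N)
        root : ∀ i → i ≤ N → ρ i ^ N - 1# ≡ 0#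
        root i _ = trans (cong (_- 1#) (go′ (i ℕ.<? N))) (-‿inverseʳ 1#)
          where
          go′ : ∀ dec → ρ′ i dec ^ N ≡ 1#
          go′ (yes _) = trans (^-assocʳ α i N) (power-one′ i N αN)
          go′ (no _) = fermat x≢0
        distinct : ∀ i j → i < j → j ≤ N → ρ i ≢ ρ j
        distinct i j i<j j≤N = go′ (i ℕ.<? N) (j ℕ.<? N)
          where
          go′ : ∀ di dj → ρ′ i di ≢ ρ′ j dj
          go′ (no i≮N) _ _ = i≮N (ℕ.<-≤-trans i<j j≤N)
          go′ (yes i<N) (no _) e = h (fromℕ< i<N , trans (cong (α ^_) (toℕ-fromℕ< i<N)) e)
          go′ (yes i<N) (yes j<N) e = ℕ.<⇒≱ (ℕ.≤-<-trans (ℕ.m∸n≤m j i) j<N)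
            (∣⇒≤ {{ℕ.>-nonZero (ℕ.m<n⇒0<n∸m i<j)}} (order (j ℕ.∸ i) (*-cancelˡ (^≢0 i α≢0) (begin
              α ^ i * α ^ (j ℕ.∸ i)   ≡⟨ ^-homo-* α i (j ℕ.∸ i) ⟨
              α ^ (i ℕ.+ (j ℕ.∸ i))   ≡⟨ cong (α ^_) (ℕ.m+[n∸m]≡n (ℕ.<⇒≤ i<j)) ⟩
              α ^ j                    ≡⟨ e ⟨
              α ^ i                    ≡⟨ *-identityʳ _ ⟨
              α ^ i * 1# ∎))))
            where open ≡-Reasoning

-- The digraphs of the list

module Cayley (m : ℕ) .{{_ : NonZero m}} where
  open ZMod m
  open CommutativeRing commutativeRing using (+-comm)
  open IntSolver commutativeRing

  Cong-+ : ∀ (x y z : F) → Cong m (toℕ x ℕ.+ toℕ y) (toℕ z) ⇔ (x + y ≡ z)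
  Cong-+ x y z = mk⇔
    (λ c → trans (sym hom) (trans (⟦⟧-cong {toℕ x ℕ.+ toℕ y} {toℕ z} c) (⟦toℕ⟧ z)))
    (λ e → ⟦⟧-cong⁻ (trans hom (trans e (sym (⟦toℕ⟧ z)))))
    where
    hom : ⟦ toℕ x ℕ.+ toℕ y ⟧ ≡ x + y
    hom = trans (+-homo (toℕ x) (toℕ y)) (cong₂ _+_ (⟦toℕ⟧ x) (⟦toℕ⟧ y))

  Cong-0 : ∀ (x : F) → Cong m (toℕ x) 0 ⇔ (x ≡ 0#)
  Cong-0 x = mk⇔ (λ c → trans (sym (⟦toℕ⟧ x)) (⟦⟧-cong {toℕ x} {0} c)) (λ e → ⟦⟧-cong⁻ {toℕ x} {0} (trans (⟦toℕ⟧ x) e))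

  Cong-sum-0 : ∀ (x y : F) → Cong m (toℕ x ℕ.+ toℕ y) 0 ⇔ (x + y ≡ 0#)
  Cong-sum-0 x y = mk⇔
    (λ c → trans (sym hom) (⟦⟧-cong {toℕ x ℕ.+ toℕ y} {0} c))
    (λ e → ⟦⟧-cong⁻ {toℕ x ℕ.+ toℕ y} {0} (trans hom e))
    where
    hom : ⟦ toℕ x ℕ.+ toℕ y ⟧ ≡ x + y
    hom = trans (+-homo (toℕ x) (toℕ y)) (cong₂ _+_ (⟦toℕ⟧ x) (⟦toℕ⟧ y))

  +-shift : ∀ {s x y : F} → s + x ≡ y → s ≡ y - x
  +-shift {s} {x} e = trans (solve 2 (λ s x → s := (s :+ x) :- x) refl s x) (cong (_- x) e)

  CayArc⇔ : ∀ T x y → CayArc m T x y ⇔ (y - x) ∈ T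
  CayArc⇔ T x y = mk⇔
    (λ (s , s∈T , c) → subst (_∈ T) (+-shift (Equivalence.to (Cong-+ s x y) c)) s∈T)
    (λ h → y - x , h , Equivalence.from (Cong-+ (y - x) x y) (solve 2 (λ x y → (y :- x) :+ x := y) refl x y))

  circuit⇔ : ∀ x y → CircuitArc m x y ⇔ (y - x ≡ 1#)
  circuit⇔ x y = mk⇔
    (λ c → sym (+-shift (trans (+-comm 1# x) (trans (sym hom) (trans (⟦⟧-cong {toℕ x ℕ.+ 1} {toℕ y} c) (⟦toℕ⟧ y))))))
    (λ e → ⟦⟧-cong⁻ (trans hom (trans (cong (x +_) (sym e)) (trans (solve 2 (λ x y → x :+ (y :- x) := y) refl x y) (sym (⟦toℕ⟧ y))))))
    where
    hom : ⟦ toℕ x ℕ.+ 1 ⟧ ≡ x + 1#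
    hom = trans (+-homo (toℕ x) 1) (cong (_+ 1#) (⟦toℕ⟧ x))

module PrimeConverse (p : ℕ) (pr : Prime p) where
  open PrimeField p pr
  open Cayley p
  open Distance p

  module _ {n : ℕ} (adj : Fin n → Fin n → Bool) (f : Fin n ↔ F) (S : F → Set) (S? : Decidable S)
    (arc : ∀ x y → (adj x y ≡ true) ⇔ S (Inverse.to f y - Inverse.to f x))
    (d : F → ℕ) (isDistance : IsDistance S d)
    (¬S0 : ¬ S 0#) (s : F) (Ss : S s) (antisymmetric : ∀ t → S t → s + t ≢ 0#)
    (homogeneous : ∀ x y → TwoWay.τ d x ≡ TwoWay.τ d y →
      ∃ λ u → u ≢ 0# × y ≡ u * x × (∀ z → TwoWay.τ d (u * z) ≡ TwoWay.τ d z)) where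

    private
      open Transport adj f S arc
      open TwoWay d

      s≢0 : s ≢ 0#
      s≢0 e = ¬S0 (subst S e Ss)

      scheme : ∀ z z′ a b → τ z ≡ τ z′ → inter z a b ≡ inter z′ a b
      scheme z z′ a b e = go (homogeneous z z′ e)
        where
        go : (∃ λ u → u ≢ 0# × z′ ≡ u * z × (∀ z → τ (u * z) ≡ τ z)) → inter z a b ≡ inter z′ a b
        go (u , u≢0 , refl , inv-τ) = trans
          (count-cong (λ w → (τ w ≟τ a) ×-dec (τ (z - w) ≟τ b)) (λ w → Q? (u * w))
            (λ w (e , e′) → trans (inv-τ w) e , trans (diff w) e′) (λ w (e , e′) → trans (sym (inv-τ w)) e , trans (sym (diff w)) e′))
          (count-bij Q? (u *_) (inv u *_)
            (λ w → trans (solve 3 (λ u i w → i :* (u :* w) := (u :* i) :* w) refl u (inv u) w) (trans (cong (_* w) (inv-inverseʳ u≢0)) (*-identityˡ w)))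
            (λ w → trans (sym (*-assoc u (inv u) w)) (trans (cong (_* w) (inv-inverseʳ u≢0)) (*-identityˡ w))))
          where
          Q? : Decidable (λ w → τ w ≡ a × τ (u * z - w) ≡ b)
          Q? w = (τ w ≟τ a) ×-dec (τ (u * z - w) ≟τ b)
          diff : ∀ w → τ (u * z - u * w) ≡ τ (z - w)
          diff w = trans (cong τ (solve 3 (λ u z w → u :* z :- u :* w := u :* (z :- w)) refl u z w)) (inv-τ (z - w))

      closed⇒all : (Q : F → Set) → (∀ y y′ → Q y → Q y′ → Q (y - y′)) → ∀ {x} → x ≢ 0# → Q x → ∀ z → Q z
      closed⇒all Q closed {x} x≢0 qx = generate {Q} (λ y y′ qy qy′ → subst Q (solve 3 (λ x y y′ → y :- ((x :- x) :- y′) := y :+ y′) refl x y y′)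
        (closed _ _ qy (closed _ _ (closed _ _ qx qx) qy′))) x≢0 qx

      T : Subset p
      T = tabulate (λ x → does (S? x))

      ∈T⇒S : ∀ {x} → x ∈ T → S x
      ∈T⇒S {x} h = go (S? x) (trans (sym (lookup∘tabulate _ x)) ([]=⇒lookup h))
        where
        go : (dec : Dec (S x)) → does dec ≡ inside → S x
        go (yes Sx) _ = Sx

      S⇒∈T : ∀ {x} → S x → x ∈ T
      S⇒∈T {x} Sx = lookup⇒[]= x T (trans (lookup∘tabulate _ x) (go (S? x)))
        where
        go : (dec : Dec (S x)) → does dec ≡ inside
        go (yes _) = refl
        go (no ¬Sx) = contradiction Sx ¬Sx

    wdr : WeaklyDistanceRegular adj
    wdr = stronglyConnected isDistance , associationScheme isDistance scheme

    primitive-scheme : Primitive adj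
    primitive-scheme = primitiveScheme isDistance (Inverse.from f 0#) λ x z x≢0 Q closed qx → closed⇒all Q closed x≢0 qx z

    circulant : Circulant adj
    circulant = p , T ,
      ((λ t t∈T c → ¬S0 (subst S (Equivalence.to (Cong-0 t) c) (∈T⇒S t∈T))) ,
       closed⇒all ⟨ T ⟩ (λ y y′ gy gy′ → sg-sub y y′ (y - y′) gy gy′
         (Equivalence.from (Cong-+ (y - y′) y′ y) (solve 2 (λ y y′ → (y :- y′) :+ y′ := y) refl y y′))) s≢0 (sg-elem s (S⇒∈T Ss)) ,
       (s , S⇒∈T Ss , λ t t∈T c → antisymmetric t (∈T⇒S t∈T) (Equivalence.to (Cong-sum-0 s t) c))) ,
      f , λ x y → mk⇔
        (λ a → Equivalence.from (CayArc⇔ T (Inverse.to f x) (Inverse.to f y)) (S⇒∈T (Equivalence.to (arc x y) a)))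
        (λ c → Equivalence.from (arc x y) (∈T⇒S (Equivalence.to (CayArc⇔ T (Inverse.to f x) (Inverse.to f y)) c)))

    conclusion : WeaklyDistanceRegular adj × Primitive adj × Circulant adj
    conclusion = wdr , primitive-scheme , circulant

  circuit-case : ∀ {n} (adj : Fin n → Fin n → Bool) → IsDigraph n adj → IsoTo adj p (CircuitArc p) →
    WeaklyDistanceRegular adj × Primitive adj × Circulant adj
  circuit-case adj (_ , x₀ , y₀ , x₀y₀ , ¬y₀x₀) (f , iso) = conclusion adj f (_≡ 1#) (_≟F 1#) arc toℕ isDistance
      (λ e → 1≢0 (sym e)) 1# refl (λ where t refl → 2≢0)
      λ x y e → 1# , 1≢0 , trans (sym (toℕ-injective (cong proj₁ e))) (sym (*-identityˡ x)) , λ z → cong (λ v → toℕ v , toℕ (- v)) (*-identityˡ z)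
    where
    to = Inverse.to f
    arc : ∀ x y → (adj x y ≡ true) ⇔ (to y - to x ≡ 1#)
    arc x y = mk⇔ (Equivalence.to (circuit⇔ _ _) ∘ Equivalence.to (iso x y)) (Equivalence.from (iso x y) ∘ Equivalence.from (circuit⇔ _ _))
    2≢0 : 1# + 1# ≢ 0#
    2≢0 e = contradiction (trans (sym ¬y₀x₀) (Equivalence.from (arc y₀ x₀) (trans (solve 2 (λ x y → x :- y := :- (y :- x)) refl (to x₀) (to y₀))
      (trans (cong (λ v → - v) (Equivalence.to (arc x₀ y₀) x₀y₀)) (trans (solve 1 (λ o → :- o := o :- (o :+ o)) refl 1#)
        (trans (cong (λ v → 1# - v) e) (solve 1 (λ o → o :- nat 0 := o) refl 1#))))))) λ ()
    isDistance : IsDistance (_≡ 1#) toℕ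
    isDistance = record
      { d0 = trans (toℕ-⟦⟧ 0) (m<n⇒m%n≡m (ℕ.>-nonZero⁻¹ p))
      ; d≡0 = λ x e → trans (sym (⟦toℕ⟧ x)) (cong ⟦_⟧ e)
      ; d-step = λ where
          s x refl → ℕ.≤-trans (ℕ.≤-reflexive (trans (cong toℕ (trans (cong (1# +_) (sym (⟦toℕ⟧ x))) (sym (+-homo 1 (toℕ x))))) (toℕ-⟦⟧ (suc (toℕ x)))))
            (m%n≤m (suc (toℕ x)) p)
      ; d-pred = λ x n e → 1# , ⟦ n ⟧ , refl , toℕ-⟦⟧-< (ℕ.<-trans (ℕ.n<1+n n) (subst (_< p) e (toℕ<n x))) ,
          trans (sym (⟦toℕ⟧ x)) (trans (cong ⟦_⟧ e) (+-homo 1 n)) }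

  module _ (p%4≡3 : p % 4 ≡ 3) where
    open PrimitiveRoot p pr

    Square : F → Set
    Square z = ∃ λ w → w ≢ 0# × z ≡ w * w

    Square? : Decidable Square
    Square? z = anyF? (λ w → ¬? (w ≟F 0#) ×-dec (z ≟F w * w))

    -1-nonsquare : ¬ Square (- 1#)
    -1-nonsquare (w , w≢0 , e) = ℕ.<⇒≱ p>2 (∣⇒≤ (⟦⟧≡0⇒∣ (trans (+-homo 1 1) 2≡0)))
      where
      t = p / 4
      p≡ : p ≡ 3 ℕ.+ t ℕ.* 4
      p≡ = trans (m≡m%n+[m/n]*n p 4) (cong (ℕ._+ t ℕ.* 4) p%4≡3)
      p>2 : 2 < p
      p>2 = subst (2 <_) (sym p≡) (s≤s (s≤s (s≤s z≤n)))
      N≡ : N ≡ 2 ℕ.* suc (t ℕ.* 2)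
      N≡ = ℕ.suc-injective (trans 1+N≡p (trans p≡ (solveℕ 1 (λ t → conℕ 3 :+ℕ t :*ℕ conℕ 4 :=ℕ conℕ 1 :+ℕ conℕ 2 :*ℕ (conℕ 1 :+ℕ t :*ℕ conℕ 2)) refl t)))
      w²≡-1 : w ^ 2 ≡ - 1#
      w²≡-1 = trans (cong (w *_) (*-identityʳ w)) (sym e)
      -1² : (- 1#) ^ 2 ≡ 1#
      -1² = solve 0 ((:- nat 1) :* ((:- nat 1) :* nat 1) := nat 1) refl
      1≡-1 : 1# ≡ - 1#
      1≡-1 = begin
        1#                                     ≡⟨ fermat w≢0 ⟨
        w ^ N                                  ≡⟨ cong (w ^_) N≡ ⟩
        w ^ (2 ℕ.* suc (t ℕ.* 2))              ≡⟨ ^-assocʳ w 2 (suc (t ℕ.* 2)) ⟨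
        (w ^ 2) ^ suc (t ℕ.* 2)                ≡⟨ cong (_^ suc (t ℕ.* 2)) w²≡-1 ⟩
        - 1# * (- 1#) ^ (t ℕ.* 2)              ≡⟨ cong (- 1# *_) (power-one′ t 2 -1²) ⟩
        - 1# * 1#                              ≡⟨ *-identityʳ (- 1#) ⟩
        - 1# ∎
        where open ≡-Reasoning
      2≡0 : 1# + 1# ≡ 0#
      2≡0 = trans (cong (1# +_) 1≡-1) (-‿inverseʳ 1#)

    module _ (α : ℕ) (isPrimitive : IsPrimitiveElement p α) where
      private
        powers = proj₂ isPrimitive

      Sq1 : Square 1#
      Sq1 = 1# , 1≢0 , sym (*-identityˡ 1#)

      ¬Sq0 : ¬ Square 0#
      ¬Sq0 (w , w≢0 , e) = x*y≢0 w≢0 w≢0 (sym e)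

      Sq≢0 : ∀ {z} → Square z → z ≢ 0#
      Sq≢0 sq refl = ¬Sq0 sq

      Sq-* : ∀ {y z} → Square y → Square z → Square (y * z)
      Sq-* (v , v≢0 , refl) (w , w≢0 , refl) = v * w , x*y≢0 v≢0 w≢0 , solve 2 (λ v w → (v :* v) :* (w :* w) := (v :* w) :* (v :* w)) refl v w

      Sq-inv : ∀ {z} → Square z → Square (inv z)
      Sq-inv {z} sq@(w , w≢0 , e) = inv z * w , x*y≢0 (inv≢0 z≢0) w≢0 , sym (begin
          (inv z * w) * (inv z * w)    ≡⟨ solve 2 (λ i w → (i :* w) :* (i :* w) := ((w :* w) :* i) :* i) refl (inv z) w ⟩
          ((w * w) * inv z) * inv z    ≡⟨ cong (λ v → (v * inv z) * inv z) e ⟨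
          (z * inv z) * inv z          ≡⟨ cong (_* inv z) (inv-inverseʳ z≢0) ⟩
          1# * inv z                   ≡⟨ *-identityˡ (inv z) ⟩
          inv z ∎)
        where
        open ≡-Reasoning
        z≢0 = Sq≢0 sq

      power : ∀ x → x ≢ 0# → ∃ λ k → ⟦ α ⟧ ^ k ≡ x
      power x x≢0 = let k , c = powers x (x≢0 ∘ Equivalence.to (Cong-0 x)) in
        k , trans (sym (⟦^⟧ α k)) (trans (⟦⟧-cong {α ℕ.^ k} {toℕ x} c) (⟦toℕ⟧ x))

      parity : ∀ k → (∃ λ i → k ≡ 2 ℕ.* i) ⊎ (∃ λ i → k ≡ 2 ℕ.* i ℕ.+ 1)
      parity zero = inj₁ (0 , refl)
      parity (suc k) = Sum.[ (λ (i , e) → inj₂ (i , trans (cong suc e) (ℕ.+-comm 1 (2 ℕ.* i)))) ,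
        (λ (i , e) → inj₁ (suc i , trans (cong suc e) (trans (cong suc (ℕ.+-comm (2 ℕ.* i) 1)) (sym (ℕ.*-suc 2 i))))) ] (parity k)

      α≢0 : ⟦ α ⟧ ≢ 0#
      α≢0 e = go (power (- 1#) (-≢0 1≢0))
        where
        go : (∃ λ k → ⟦ α ⟧ ^ k ≡ - 1#) → ⊥
        go (zero , e′) = -1-nonsquare (1# , 1≢0 , trans (sym e′) (sym (*-identityˡ 1#)))
        go (suc k , e′) = -≢0 1≢0 (trans (sym e′) (trans (cong (_* ⟦ α ⟧ ^ k) e) (zeroˡ _)))

      even-power : ∀ i → Square (⟦ α ⟧ ^ (2 ℕ.* i))
      even-power i = ⟦ α ⟧ ^ i , ^≢0 i α≢0 , trans (cong (⟦ α ⟧ ^_) (cong (i ℕ.+_) (ℕ.+-identityʳ i))) (^-homo-* ⟦ α ⟧ i i)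

      even-or-odd : ∀ x → x ≢ 0# → (∃ λ i → ⟦ α ⟧ ^ (2 ℕ.* i) ≡ x) ⊎ (∃ λ i → ⟦ α ⟧ ^ (2 ℕ.* i ℕ.+ 1) ≡ x)
      even-or-odd x x≢0 = split (power x x≢0)
        where
        split : (∃ λ k → ⟦ α ⟧ ^ k ≡ x) → (∃ λ i → ⟦ α ⟧ ^ (2 ℕ.* i) ≡ x) ⊎ (∃ λ i → ⟦ α ⟧ ^ (2 ℕ.* i ℕ.+ 1) ≡ x)
        split (k , e) = Sum.map (λ (i , k≡) → i , trans (cong (⟦ α ⟧ ^_) (sym k≡)) e) (λ (i , k≡) → i , trans (cong (⟦ α ⟧ ^_) (sym k≡)) e) (parity k)

      -1-odd : ∃ λ i → ⟦ α ⟧ ^ (2 ℕ.* i ℕ.+ 1) ≡ - 1#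
      -1-odd = go (even-or-odd (- 1#) (-≢0 1≢0))
        where
        go : (∃ λ i → ⟦ α ⟧ ^ (2 ℕ.* i) ≡ - 1#) ⊎ (∃ λ i → ⟦ α ⟧ ^ (2 ℕ.* i ℕ.+ 1) ≡ - 1#) → ∃ λ i → ⟦ α ⟧ ^ (2 ℕ.* i ℕ.+ 1) ≡ - 1#
        go (inj₁ (i , e)) = contradiction (subst Square e (even-power i)) -1-nonsquare
        go (inj₂ h) = h

      odd-power′ : ∀ j → ⟦ α ⟧ ^ (2 ℕ.* j ℕ.+ 1) ≡ - 1# → ∀ i → Square (- (⟦ α ⟧ ^ (2 ℕ.* i ℕ.+ 1)))
      odd-power′ j e i = subst Square same-value (even-power (j ℕ.+ i ℕ.+ 1))
        where
        open ≡-Reasoning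
        exponents : ∀ j i → 2 ℕ.* (j ℕ.+ i ℕ.+ 1) ≡ (2 ℕ.* j ℕ.+ 1) ℕ.+ (2 ℕ.* i ℕ.+ 1)
        exponents = solveℕ 2 (λ j i → conℕ 2 :*ℕ (j :+ℕ i :+ℕ conℕ 1) :=ℕ (conℕ 2 :*ℕ j :+ℕ conℕ 1) :+ℕ (conℕ 2 :*ℕ i :+ℕ conℕ 1)) refl
        same-value : ⟦ α ⟧ ^ (2 ℕ.* (j ℕ.+ i ℕ.+ 1)) ≡ - (⟦ α ⟧ ^ (2 ℕ.* i ℕ.+ 1))
        same-value = begin
          ⟦ α ⟧ ^ (2 ℕ.* (j ℕ.+ i ℕ.+ 1))                            ≡⟨ cong (⟦ α ⟧ ^_) (exponents j i) ⟩
          ⟦ α ⟧ ^ ((2 ℕ.* j ℕ.+ 1) ℕ.+ (2 ℕ.* i ℕ.+ 1))              ≡⟨ ^-homo-* ⟦ α ⟧ (2 ℕ.* j ℕ.+ 1) (2 ℕ.* i ℕ.+ 1) ⟩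
          ⟦ α ⟧ ^ (2 ℕ.* j ℕ.+ 1) * ⟦ α ⟧ ^ (2 ℕ.* i ℕ.+ 1)          ≡⟨ cong (_* ⟦ α ⟧ ^ (2 ℕ.* i ℕ.+ 1)) e ⟩
          - 1# * ⟦ α ⟧ ^ (2 ℕ.* i ℕ.+ 1)                             ≡⟨ neg (⟦ α ⟧ ^ (2 ℕ.* i ℕ.+ 1)) ⟩
          - (⟦ α ⟧ ^ (2 ℕ.* i ℕ.+ 1)) ∎
          where
          neg : ∀ x → - 1# * x ≡ - x
          neg x = solve 1 (λ x → (:- nat 1) :* x := :- x) refl x

      odd-power : ∀ i → Square (- (⟦ α ⟧ ^ (2 ℕ.* i ℕ.+ 1)))
      odd-power = odd-power′ (proj₁ -1-odd) (proj₂ -1-odd)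

      cover : ∀ x → x ≢ 0# → Square x ⊎ Square (- x)
      cover x x≢0 = Sum.map (λ (i , e) → subst Square e (even-power i)) (λ (i , e) → subst (λ v → Square (- v)) e (odd-power i)) (even-or-odd x x≢0)

      not-both : ∀ {x} → Square x → ¬ Square (- x)
      not-both {x} sq sq′ = -1-nonsquare (subst Square
        (trans (solve 2 (λ x i → (:- x) :* i := :- (x :* i)) refl x (inv x)) (cong (λ v → - v) (inv-inverseʳ (Sq≢0 sq)))) (Sq-* sq′ (Sq-inv sq)))

      paley⇔ : ∀ x y → PaleyArc p α x y ⇔ Square (y - x)
      paley⇔ x y = mk⇔ forth back
        where
        value : ∀ k → ⟦ toℕ y ℕ.+ α ℕ.^ (2 ℕ.* k ℕ.+ 1) ⟧ ≡ y + ⟦ α ⟧ ^ (2 ℕ.* k ℕ.+ 1)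
        value k = trans (+-homo (toℕ y) _) (cong₂ _+_ (⟦toℕ⟧ y) (⟦^⟧ α (2 ℕ.* k ℕ.+ 1)))
        forth : PaleyArc p α x y → Square (y - x)
        forth (k , c) = subst Square (trans (solve 2 (λ y a → :- a := y :- (y :+ a)) refl y (⟦ α ⟧ ^ (2 ℕ.* k ℕ.+ 1)))
          (cong (λ v → y - v) (trans (sym (value k)) (trans (⟦⟧-cong {toℕ y ℕ.+ α ℕ.^ (2 ℕ.* k ℕ.+ 1)} {toℕ x} c) (⟦toℕ⟧ x))))) (odd-power k)
        back : Square (y - x) → PaleyArc p α x y
        back sq = go (even-or-odd (x - y) λ e → Sq≢0 sq (trans neg (trans (cong (λ v → - v) e) (solve 0 (:- nat 0 := nat 0) refl))))
          where
          neg : y - x ≡ - (x - y)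
          neg = solve 2 (λ x y → y :- x := :- (x :- y)) refl x y
          go : (∃ λ i → ⟦ α ⟧ ^ (2 ℕ.* i) ≡ x - y) ⊎ (∃ λ i → ⟦ α ⟧ ^ (2 ℕ.* i ℕ.+ 1) ≡ x - y) → PaleyArc p α x y
          go (inj₁ (i , e)) = contradiction (subst Square neg sq) (not-both (subst Square e (even-power i)))
          go (inj₂ (i , e)) = i , ⟦⟧-cong⁻ (trans (value i) (trans (cong (y +_) e)
            (trans (solve 2 (λ x y → y :+ (x :- y) := x) refl x y) (sym (⟦toℕ⟧ x)))))

      antisymmetric : ∀ t → Square t → 1# + t ≢ 0#
      antisymmetric t sq e = -1-nonsquare (subst Square (trans (solve 2 (λ o t → t := (o :+ t) :- o) refl 1# t) (trans (cong (_- 1#) e) (+-identityˡ _))) sq)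

      d′ : ∀ {z} → Dec (z ≡ 0#) → Dec (Square z) → ℕ
      d′ (yes _) _ = 0
      d′ (no _) (yes _) = 1
      d′ (no _) (no _) = 2

      d : F → ℕ
      d z = d′ (z ≟F 0#) (Square? z)

      d-zero : d 0# ≡ 0
      d-zero = go (0# ≟F 0#) (Square? 0#)
        where
        go : ∀ a b → d′ a b ≡ 0
        go (yes _) _ = refl
        go (no h) _ = contradiction refl h

      d-square : ∀ {z} → Square z → d z ≡ 1
      d-square {z} sq = go (z ≟F 0#) (Square? z)
        where
        go : ∀ a b → d′ a b ≡ 1
        go (yes e) _ = contradiction e (Sq≢0 sq)
        go (no _) (yes _) = refl
        go (no _) (no h) = contradiction sq h

      d-nonsquare : ∀ {z} → Square (- z) → d z ≡ 2
      d-nonsquare {z} sq = go (z ≟F 0#) (Square? z)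
        where
        go : ∀ a b → d′ a b ≡ 2
        go (yes e) _ = contradiction (trans (cong (λ v → - v) e) (solve 0 (:- nat 0 := nat 0) refl)) (Sq≢0 sq)
        go (no _) (yes h) = contradiction sq (not-both h)
        go (no _) (no _) = refl

      d≤2 : ∀ z → d z ≤ 2
      d≤2 z = go (z ≟F 0#) (Square? z)
        where
        go : ∀ a b → d′ {z} a b ≤ 2
        go (yes _) _ = z≤n
        go (no _) (yes _) = s≤s z≤n
        go (no _) (no _) = ℕ.≤-refl

      data View (z : F) : Set where
        zero : z ≡ 0# → View z
        square : Square z → View z
        nonsquare : Square (- z) → View z

      view : ∀ z → View z
      view z = go (z ≟F 0#)
        where
        go : Dec (z ≡ 0#) → View z
        go (yes e) = zero e
        go (no h) = Sum.[ square , nonsquare ]′ (cover z h)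

      -- Otherwise the squares would be closed under addition, and 0 = 1 + ⋯ + 1 would be a nonzero square.
      NonsquareSum : F → F → Set
      NonsquareSum a b = Square a × Square b × Square (- (a + b))

      NonsquareSum? : ∀ a → Decidable (NonsquareSum a)
      NonsquareSum? a b = Square? a ×-dec (Square? b ×-dec Square? (- (a + b)))

      nonsquare-sum : ∃₂ NonsquareSum
      nonsquare-sum = decidable-stable (anyF? {P = λ a → ∃ (NonsquareSum a)} λ a → anyF? {P = NonsquareSum a} (NonsquareSum? a))
        λ h → ¬Sq0 (generate {Square} (λ a b sqa sqb → closed h a b sqa sqb (view (a + b))) 1≢0 Sq1 0#)
        where
        opposite : ∀ a b → a + b ≡ 0# → b ≡ - a
        opposite a b e = trans (solve 2 (λ a b → b := :- (a :- (a :+ b))) refl a b)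
          (trans (cong (λ v → - (a - v)) e) (solve 1 (λ a → :- (a :- nat 0) := :- a) refl a))
        closed : ¬ ∃₂ NonsquareSum → ∀ a b → Square a → Square b → View (a + b) → Square (a + b)
        closed h a b sqa sqb (zero e) = contradiction (subst Square (opposite a b e) sqb) (not-both sqa)
        closed h a b sqa sqb (square sq) = sq
        closed h a b sqa sqb (nonsquare sq) = contradiction (a , b , sqa , sqb , sq) h

      isDistance : IsDistance Square d
      isDistance = record { d0 = d-zero ; d≡0 = λ x e → d≡0 x e (view x) ; d-step = λ s x sq → d-step s x sq (view x) ; d-pred = λ x n e → d-pred x n e (view x) }
        where
        d≡0 : ∀ x → d x ≡ 0 → View x → x ≡ 0#
        d≡0 x e (zero h) = h
        d≡0 x e (square h) = contradiction (trans (sym e) (d-square h)) λ ()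
        d≡0 x e (nonsquare h) = contradiction (trans (sym e) (d-nonsquare h)) λ ()
        d-step : ∀ s x → Square s → View x → d (s + x) ≤ suc (d x)
        d-step s x sq (zero refl) = ℕ.≤-trans (ℕ.≤-reflexive (trans (cong d (+-identityʳ s)) (d-square sq))) (s≤s z≤n)
        d-step s x sq (square h) = ℕ.≤-trans (d≤2 (s + x)) (ℕ.≤-reflexive (cong suc (sym (d-square h))))
        d-step s x sq (nonsquare h) = ℕ.≤-trans (d≤2 (s + x)) (ℕ.≤-trans (ℕ.n≤1+n 2) (ℕ.≤-reflexive (cong suc (sym (d-nonsquare h)))))
        d-pred : ∀ x n → d x ≡ suc n → View x → ∃₂ λ s z → Square s × d z ≡ n × x ≡ s + z
        d-pred x n e (zero refl) = contradiction (trans (sym d-zero) e) λ ()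
        d-pred x n e (square h) = x , 0# , h , trans d-zero (ℕ.suc-injective (trans (sym (d-square h)) e)) , sym (+-identityʳ x)
        d-pred x n e (nonsquare h) = go nonsquare-sum
          where
          go : ∃₂ NonsquareSum → ∃₂ λ s z → Square s × d z ≡ n × x ≡ s + z
          go (a , b , sqa , sqb , sq) = u * a , u * b , Sq-* sqᵤ sqa , trans (d-square (Sq-* sqᵤ sqb)) (ℕ.suc-injective (trans (sym (d-nonsquare h)) e)) , (begin
              x                                        ≡⟨ *-identityʳ x ⟨
              x * 1#                                   ≡⟨ cong (x *_) (inv-inverseʳ (Sq≢0 sq)) ⟨
              x * (- (a + b) * inv (- (a + b)))        ≡⟨ solve 4 (λ x a b i → x :* ((:- (a :+ b)) :* i) := ((:- x) :* i) :* a :+ ((:- x) :* i) :* b) refl x a b (inv (- (a + b))) ⟩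
              u * a + u * b ∎)
            where
            open ≡-Reasoning
            u = - x * inv (- (a + b))
            sqᵤ : Square u
            sqᵤ = Sq-* h (Sq-inv sq)

      d-scale : ∀ {u} z → Square u → d (u * z) ≡ d z
      d-scale {u} z sq = go (view z)
        where
        go : View z → d (u * z) ≡ d z
        go (zero refl) = cong d (zeroʳ u)
        go (square h) = trans (d-square (Sq-* sq h)) (sym (d-square h))
        go (nonsquare h) = trans (d-nonsquare (subst Square (solve 2 (λ u z → u :* (:- z) := :- (u :* z)) refl u z) (Sq-* sq h))) (sym (d-nonsquare h))

      open TwoWay d

      homogeneous : ∀ x y → τ x ≡ τ y → ∃ λ u → u ≢ 0# × y ≡ u * x × (∀ z → τ (u * z) ≡ τ z)
      homogeneous x y e = go (view x) (view y)
        where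
        Goal = ∃ λ u → u ≢ 0# × y ≡ u * x × (∀ z → τ (u * z) ≡ τ z)
        by-square : ∀ u → Square u → y ≡ u * x → Goal
        by-square u sq eq = u , Sq≢0 sq , eq , λ z → cong₂ _,_ (d-scale z sq)
          (trans (cong d (solve 2 (λ u z → :- (u :* z) := u :* (:- z)) refl u z)) (d-scale (- z) sq))
        quotient : x ≢ 0# → y ≡ (y * inv x) * x
        quotient x≢0 = sym (trans (solve 3 (λ x y i → (y :* i) :* x := y :* (x :* i)) refl x y (inv x)) (trans (cong (y *_) (inv-inverseʳ x≢0)) (*-identityʳ y)))
        clash : ∀ {i j} → d x ≡ i → d y ≡ j → i ≢ j → Goal
        clash dx dy i≢j = contradiction (trans (sym dx) (trans (cong proj₁ e) dy)) i≢j
        go : View x → View y → Goal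
        go (zero refl) (zero refl) = by-square 1# Sq1 (sym (*-identityˡ 0#))
        go (square h) (square h′) = by-square (y * inv x) (Sq-* h′ (Sq-inv h)) (quotient (Sq≢0 h))
        go (nonsquare h) (nonsquare h′) = by-square (- y * inv (- x)) (Sq-* h′ (Sq-inv h)) (sym (begin
            (- y * inv (- x)) * x         ≡⟨ solve 3 (λ x y i → ((:- y) :* i) :* x := y :* ((:- x) :* i)) refl x y (inv (- x)) ⟩
            y * (- x * inv (- x))         ≡⟨ cong (y *_) (inv-inverseʳ (Sq≢0 h)) ⟩
            y * 1#                        ≡⟨ *-identityʳ y ⟩
            y ∎))
          where open ≡-Reasoning
        go (zero refl) (square h) = clash d-zero (d-square h) λ ()
        go (zero refl) (nonsquare h) = clash d-zero (d-nonsquare h) λ ()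
        go (square h) (zero refl) = clash (d-square h) d-zero λ ()
        go (square h) (nonsquare h′) = clash (d-square h) (d-nonsquare h′) λ ()
        go (nonsquare h) (zero refl) = clash (d-nonsquare h) d-zero λ ()
        go (nonsquare h) (square h′) = clash (d-nonsquare h) (d-square h′) λ ()

      paley-case : ∀ {n} (adj : Fin n → Fin n → Bool) → IsoTo adj p (PaleyArc p α) →
        WeaklyDistanceRegular adj × Primitive adj × Circulant adj
      paley-case adj (f , iso) = conclusion adj f Square Square? arc d isDistance ¬Sq0 1# Sq1 antisymmetric homogeneous
        where
        to = Inverse.to f
        arc : ∀ x y → (adj x y ≡ true) ⇔ Square (to y - to x)
        arc x y = mk⇔ (Equivalence.to (paley⇔ _ _) ∘ Equivalence.to (iso x y)) (Equivalence.from (iso x y) ∘ Equivalence.from (paley⇔ _ _))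

module Order13 where
  abstract
    prime-13 : Prime 13
    prime-13 = from-yes (prime? 13)

  open PrimeField 13 prime-13
  open Cayley 13
  open PrimeConverse 13 prime-13 using (conclusion)
  open Distance 13

  infixl 6 _⊕_
  infixl 7 _⊗_
  _⊕_ _⊗_ : F → F → F
  x ⊕ y = (toℕ x ℕ.+ toℕ y) mod 13
  x ⊗ y = (toℕ x ℕ.* toℕ y) mod 13

  ⊖_ : F → F
  ⊖ x = (13 ℕ.∸ toℕ x) mod 13

  ⟦⟧≡mod : ∀ n → ⟦ n ⟧ ≡ n mod 13
  ⟦⟧≡mod n = toℕ-injective (trans (toℕ-⟦⟧ n) (sym (toℕ-fromℕ< _)))

  +≡⊕ : ∀ x y → x + y ≡ x ⊕ y
  +≡⊕ x y = trans (sym (trans (+-homo (toℕ x) (toℕ y)) (cong₂ _+_ (⟦toℕ⟧ x) (⟦toℕ⟧ y)))) (⟦⟧≡mod _)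

  *≡⊗ : ∀ x y → x * y ≡ x ⊗ y
  *≡⊗ x y = trans (sym (trans (*-homo (toℕ x) (toℕ y)) (cong₂ _*_ (⟦toℕ⟧ x) (⟦toℕ⟧ y)))) (⟦⟧≡mod _)

  0≡#0 : 0# ≡ # 0
  0≡#0 = ⟦⟧≡mod 0

  1≡#1 : 1# ≡ # 1
  1≡#1 = ⟦⟧≡mod 1

  -≡⊖ : ∀ x → - x ≡ ⊖ x
  -≡⊖ x = trans (solve 2 (λ x y → :- x := y :- (x :+ y)) refl x (⊖ x))
    (trans (cong (λ v → ⊖ x - v) (trans (+≡⊕ x (⊖ x)) (trans (from-yes (allF? λ x → x ⊕ ⊖ x ≟F # 0) x) (sym 0≡#0))))
      (solve 1 (λ y → y :- nat 0 := y) refl (⊖ x)))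

  d : F → ℕ
  d = lookup (0 ∷ 1 ∷ 2 ∷ 1 ∷ 2 ∷ 2 ∷ 2 ∷ 3 ∷ 3 ∷ 1 ∷ 2 ∷ 3 ∷ 2 ∷ [])

  isDistance : IsDistance (_∈ S13) d
  isDistance = record
    { d0 = cong d 0≡#0
    ; d≡0 = λ x e → trans (from-yes (allF? λ x → (d x ℕ.≟ 0) →-dec (x ≟F # 0)) x e) (sym 0≡#0)
    ; d-step = λ s x Ss → subst (λ v → d v ≤ suc (d x)) (sym (+≡⊕ s x))
        (from-yes (allF? λ s → allF? λ x → (s ∈? S13) →-dec (d (s ⊕ x) ℕ.≤? suc (d x))) s x Ss)
    ; d-pred = λ x n e → predecessor x n e (from-yes (allF? λ x → ¬? (d x ℕ.≟ 0) →-dec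
        (anyF? λ s → anyF? λ z → (s ∈? S13) ×-dec ((suc (d z) ℕ.≟ d x) ×-dec (x ≟F s ⊕ z)))) x λ e′ → contradiction (trans (sym e) e′) λ ()) }
    where
    predecessor : ∀ x n → d x ≡ suc n → (∃₂ λ s z → s ∈ S13 × suc (d z) ≡ d x × x ≡ s ⊕ z) →
      ∃₂ λ s z → s ∈ S13 × d z ≡ n × x ≡ s + z
    predecessor x n e (s , z , Ss , dz , x≡) = s , z , Ss , ℕ.suc-injective (trans dz e) , trans x≡ (sym (+≡⊕ s z))

  open TwoWay d

  homogeneous : ∀ x y → τ x ≡ τ y → ∃ λ u → u ≢ 0# × y ≡ u * x × (∀ z → τ (u * z) ≡ τ z)
  homogeneous x y e = go (from-yes (allF? λ x → allF? λ y → (d x ℕ.≟ d y) →-dec ((d (⊖ x) ℕ.≟ d (⊖ y)) →-dec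
      (anyF? λ u → ¬? (u ≟F # 0) ×-dec ((y ≟F u ⊗ x) ×-dec (allF? λ z → d (u ⊗ z) ℕ.≟ d z))))) x y (cong proj₁ e)
      (subst₂ (λ v w → d v ≡ d w) (-≡⊖ x) (-≡⊖ y) (cong proj₂ e)))
    where
    go : (∃ λ u → u ≢ # 0 × y ≡ u ⊗ x × (∀ z → d (u ⊗ z) ≡ d z)) → ∃ λ u → u ≢ 0# × y ≡ u * x × (∀ z → τ (u * z) ≡ τ z)
    go (u , u≢0 , y≡ , scale) = u , (λ e → u≢0 (trans e 0≡#0)) , trans y≡ (sym (*≡⊗ u x)) ,
      λ z → cong₂ _,_ (scale′ z) (trans (cong d (solve 2 (λ u z → :- (u :* z) := u :* (:- z)) refl u z)) (scale′ (- z)))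
      where
      scale′ : ∀ z → d (u * z) ≡ d z
      scale′ z = trans (cong d (*≡⊗ u z)) (scale z)

  thirteen-case : ∀ {n} (adj : Fin n → Fin n → Bool) → IsoTo adj 13 (CayArc 13 S13) →
    WeaklyDistanceRegular adj × Primitive adj × Circulant adj
  thirteen-case adj (f , iso) = conclusion adj f (_∈ S13) (_∈? S13) arc d isDistance
      (λ h → from-yes (¬? (# 0 ∈? S13)) (subst (_∈ S13) 0≡#0 h))
      (# 1) (from-yes (# 1 ∈? S13))
      (λ t St e → from-yes (allF? λ t → (t ∈? S13) →-dec ¬? (# 1 ⊕ t ≟F # 0)) t St (trans (sym (+≡⊕ (# 1) t)) (trans e 0≡#0)))
      homogeneous
    where
    to = Inverse.to f
    arc : ∀ x y → (adj x y ≡ true) ⇔ ((to y - to x) ∈ S13)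
    arc x y = mk⇔ (Equivalence.to (CayArc⇔ S13 (to x) (to y)) ∘ Equivalence.to (iso x y))
      (Equivalence.from (iso x y) ∘ Equivalence.from (CayArc⇔ S13 (to x) (to y)))

  cube-roots : ∀ {K : F → Set} → K 1# → (∀ {u v} → K u → K v → K (u * v)) →
    (∀ t → K t → t * (t * t) ≡ 1#) → (∃ λ u → K u × u ≢ 1#) → ∀ t → K t ⇔ (t ∈ S13)
  cube-roots {K} K1 K-* cube (u , Ku , u≢1) t = mk⇔
      (λ Kt → from-yes (allF? λ t → (t ⊗ (t ⊗ t) ≟F # 1) →-dec (t ∈? S13)) t (cube⊗ t Kt))
      (λ St → go (from-yes (allF? λ u → allF? λ t → (u ⊗ (u ⊗ u) ≟F # 1) →-dec (¬? (u ≟F # 1) →-dec ((t ∈? S13) →-dec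
        ((t ≟F # 1) ⊎-dec ((t ≟F u) ⊎-dec (t ≟F u ⊗ u)))))) u t (cube⊗ u Ku) (λ e → u≢1 (trans e (sym 1≡#1))) St))
    where
    cube⊗ : ∀ t → K t → t ⊗ (t ⊗ t) ≡ # 1
    cube⊗ t Kt = trans (sym (trans (*≡⊗ t (t * t)) (cong (t ⊗_) (*≡⊗ t t)))) (trans (cube t Kt) 1≡#1)
    go : t ≡ # 1 ⊎ t ≡ u ⊎ t ≡ u ⊗ u → K t
    go (inj₁ e) = subst K (sym (trans e (sym 1≡#1))) K1
    go (inj₂ (inj₁ e)) = subst K (sym e) Ku
    go (inj₂ (inj₂ e)) = subst K (sym (trans e (sym (*≡⊗ u u)))) (K-* Ku Ku)

-- Circulant digraphs

Listed : ∀ {n} → (Fin n → Fin n → Bool) → Set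
Listed adj =
  (∃ λ p → Prime p × p % 4 ≡ 3 × (∃ λ α → IsPrimitiveElement p α × IsoTo adj p (PaleyArc p α)))
  ⊎ (∃ λ p → Prime p × IsoTo adj p (CircuitArc p))
  ⊎ IsoTo adj 13 (CayArc 13 S13)

thirteen : ∀ {n} (adj : Fin n → Fin n → Bool) {p} → p ≡ 13 → (pr : Prime p) → let open PrimeField p pr in
  (f : Fin n ↔ F) (K : F → Set) →
  (∀ {R : F → F → Set} → (∀ x y → K (y - x) ⇔ R x y) → IsoTo adj p R) →
  K 1# → (∀ {u v} → K u → K v → K (u * v)) → (∀ t → K t → t * (t * t) ≡ 1#) → (∃ λ u → K u × u ≢ 1#) →
  IsoTo adj 13 (CayArc 13 S13)
thirteen adj refl pr f K transfer K1 K-* cube nontrivial = transfer {R = CayArc 13 S13} λ x y → mk⇔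
    (λ Kd → Equivalence.from (CayArc⇔ S13 x y) (Equivalence.to (roots (y - x)) Kd))
    (λ a → Equivalence.from (roots (y - x)) (Equivalence.to (CayArc⇔ S13 x y) a))
  where
  open PrimeField 13 pr
  open Cayley 13
  roots : ∀ t → K t ⇔ (t ∈ S13)
  roots = Order13.cube-roots {K} K1 (λ {u} {v} → K-* {u} {v}) cube nontrivial

module PrimeForward (p : ℕ) (pr : Prime p) where
  open PrimeField p pr
  open PrimeCore p pr
  open Cayley p
  open Distance p

  rescale : ∀ {S d s} → IsDistance S d → TwoWay.IsScheme d → ¬ S 0# → d s ≡ 1 → d (- s) ≢ 1 → TwoWay.IsSkew (λ x → d (s * x))
  rescale {S} {d} {s} isDistance isScheme ¬S0 ds d-s = record
    { d0 = trans (cong d (zeroʳ s)) d0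
    ; d≡0 = λ x e → *-cancelˡ s≢0 (trans (d≡0 (s * x) e) (sym (zeroʳ s)))
    ; triangle = λ x y → ℕ.≤-trans (ℕ.≤-reflexive (cong d (distribˡ s x y))) (triangle (s * x) (s * y))
    ; d-pred = λ x n e → predecessor x n (d-pred (s * x) n e)
    ; mult = λ x y v v≢0 e → trans (τ-scale v x) (trans (multiplier (s * x) (s * y) v v≢0
        (trans (sym (τ-scale′ x)) (trans e (τ-scale′ y)))) (sym (τ-scale v y)))
    ; d1 = trans (cong d (*-identityʳ s)) ds
    ; d-1 = λ e → d-s (trans (cong d (solve 1 (λ s → :- s := s :* (:- nat 1)) refl s)) e) }
    where
    open IsDistance isDistance
    open TwoWay d
    open Multipliers d isScheme

    s≢0 : s ≢ 0#
    s≢0 e = contradiction (trans (sym ds) (trans (cong d e) d0)) λ ()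

    predecessor : ∀ x n → (∃₂ λ t z → S t × d z ≡ n × s * x ≡ t + z) →
      ∃₂ λ t z → d (s * t) ≡ 1 × d (s * z) ≡ n × x ≡ t + z
    predecessor x n (t , z , St , dz , e) = inv s * t , inv s * z , trans (cong d (inv-cancelʳ t s≢0)) (S⇒d≡1 t ¬S0 St) ,
      trans (cong d (inv-cancelʳ z s≢0)) dz , *-cancelˡ s≢0 (trans e (sym (trans (distribˡ s _ _) (cong₂ _+_ (inv-cancelʳ t s≢0) (inv-cancelʳ z s≢0)))))

    τ-scale′ : ∀ x → TwoWay.τ (λ x → d (s * x)) x ≡ τ (s * x)
    τ-scale′ x = cong (λ v → d (s * x) , d v) (solve 2 (λ s x → s :* (:- x) := :- (s :* x)) refl s x)

    τ-scale : ∀ v x → TwoWay.τ (λ x → d (s * x)) (v * x) ≡ τ (v * (s * x))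
    τ-scale v x = trans (τ-scale′ (v * x)) (cong τ (solve 3 (λ s v x → s :* (v :* x) := v :* (s :* x)) refl s v x))

  scaling : ∀ {s} → s ≢ 0# → ∀ {n} → Fin n ↔ F → Fin n ↔ F
  scaling {s} s≢0 f = mk↔ₛ′ (λ x → inv s * Inverse.to f x) (λ y → Inverse.from f (s * y))
    (λ y → trans (cong (inv s *_) (Inverse.strictlyInverseˡ f (s * y))) (inv-cancelˡ y s≢0))
    (λ x → trans (cong (Inverse.from f) (inv-cancelʳ (Inverse.to f x) s≢0)) (Inverse.strictlyInverseʳ f x))

  module _ {n : ℕ} (adj : Fin n → Fin n → Bool) (f : Fin n ↔ F) (d : F → ℕ) (isSkew : TwoWay.IsSkew d)
    (arc : ∀ x y → (adj x y ≡ true) ⇔ (d (Inverse.to f y - Inverse.to f x) ≡ 1)) where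

    open SkewDistance d isSkew

    private
      transfer : ∀ {R : F → F → Set} → (∀ x y → K (y - x) ⇔ R x y) → IsoTo adj p R
      transfer {R} h = f , λ x y → mk⇔ (λ a → Equivalence.to (h _ _) (d≡1⇒K (Equivalence.to (arc x y) a)))
        (λ r → Equivalence.from (arc x y) (K⇒d≡1 (Equivalence.from (h _ _) r)))

    circuit : (∀ u → K u → u ≡ 1#) → IsoTo adj p (CircuitArc p)
    circuit h = transfer {R = CircuitArc p} λ x y → mk⇔ (λ Ku → Equivalence.from (circuit⇔ x y) (h (y - x) Ku))
      (λ c → subst K (sym (Equivalence.to (circuit⇔ x y) c)) K1)

    module _ (cover : ∀ x → x ≡ 0# ⊎ K x ⊎ K (- x)) where
      open PrimitiveRoot p pr using (_^_; ⟦^⟧; primitive-root)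
      open PrimeConverse p pr using (Square; paley⇔)

      K-neg⇒¬K : ∀ {x} → K x → ¬ K (- x)
      K-neg⇒¬K Kx K-x = skew (K⇒≢0 Kx) (trans (K⇒d≡1 Kx) (sym (K⇒d≡1 K-x)))

      p≡1+2k : p ≡ suc (k ℕ.+ k)
      p≡1+2k = begin
        p                                                  ≡⟨ count-⊤ p ⟨
        count {p} (λ _ → yes tt)                           ≡⟨ count-remove (λ _ → yes tt) 0# tt ⟩
        suc (count (λ x → yes tt ×-dec ¬? (x ≟F 0#)))      ≡⟨ cong suc (count-split (λ x → yes tt ×-dec ¬? (x ≟F 0#)) K?) ⟩
        suc (count (λ x → (yes tt ×-dec ¬? (x ≟F 0#)) ×-dec K? x) ℕ.+ count (λ x → (yes tt ×-dec ¬? (x ≟F 0#)) ×-dec ¬? (K? x)))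
          ≡⟨ cong suc (cong₂ ℕ._+_ (count-cong (λ x → (yes tt ×-dec ¬? (x ≟F 0#)) ×-dec K? x) K? (λ x (_ , Kx) → Kx) (λ x Kx → (tt , K⇒≢0 Kx) , Kx))
               (trans (count-cong (λ x → (yes tt ×-dec ¬? (x ≟F 0#)) ×-dec ¬? (K? x)) (λ x → K? (- x))
                  (λ x ((_ , x≢0) , ¬Kx) → negative x≢0 ¬Kx (cover x))
                  (λ x K-x → (tt , λ e → K⇒≢0 K-x (trans (cong (λ v → - v) e) -0≡0)) , λ Kx → K-neg⇒¬K Kx K-x))
                (count-bij K? (λ v → - v) (λ v → - v) neg-neg neg-neg))) ⟩
        suc (k ℕ.+ k) ∎
        where
        open ≡-Reasoning
        negative : ∀ {x} → x ≢ 0# → ¬ K x → x ≡ 0# ⊎ K x ⊎ K (- x) → K (- x)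
        negative x≢0 ¬Kx (inj₁ e) = contradiction e x≢0
        negative x≢0 ¬Kx (inj₂ (inj₁ h)) = contradiction h ¬Kx
        negative x≢0 ¬Kx (inj₂ (inj₂ h)) = h

      p%4≡3 : p % 4 ≡ 3
      p%4≡3 = go k-odd
        where
        go : (∃ λ j → k ≡ 1 ℕ.+ (j ℕ.+ j)) → p % 4 ≡ 3
        go (j , e) = trans (cong (_% 4) (trans p≡1+2k (trans (cong (λ k → suc (k ℕ.+ k)) e)
          (solveℕ 1 (λ j → conℕ 1 :+ℕ ((conℕ 1 :+ℕ (j :+ℕ j)) :+ℕ (conℕ 1 :+ℕ (j :+ℕ j))) :=ℕ conℕ 3 :+ℕ j :*ℕ conℕ 4) refl j)))) ([m+kn]%n≡m%n 3 j 4)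

      paley : ∃ λ α → IsPrimitiveElement p α × IsoTo adj p (PaleyArc p α)
      paley = go primitive-root
        where
        go : (∃ λ α → α ≢ 0# × (∀ x → x ≢ 0# → ∃ λ k → α ^ k ≡ x)) → ∃ λ α → IsPrimitiveElement p α × IsoTo adj p (PaleyArc p α)
        go (α , α≢0 , powers) = toℕ α , isPrimitive , transfer {R = PaleyArc p (toℕ α)} λ x y → mk⇔
            (λ Kd → Equivalence.from (paley⇔ p%4≡3 (toℕ α) isPrimitive x y) (K⇒Square Kd))
            (λ a → Square⇒K (Equivalence.to (paley⇔ p%4≡3 (toℕ α) isPrimitive x y) a))
          where
          isPrimitive : IsPrimitiveElement p (toℕ α)
          isPrimitive = (λ c → α≢0 (Equivalence.to (Cong-0 α) c)) , λ x x≢0 → power x (powers x (λ e → x≢0 (Equivalence.from (Cong-0 x) e)))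
            where
            power : ∀ x → (∃ λ k → α ^ k ≡ x) → ∃ λ k → Cong p (toℕ α ℕ.^ k) (toℕ x)
            power x (k , e) = k , ⟦⟧-cong⁻ (trans (⟦^⟧ (toℕ α) k) (trans (cong (_^ k) (⟦toℕ⟧ α)) (trans e (sym (⟦toℕ⟧ x)))))
          Square⇒K : ∀ {z} → Square p%4≡3 z → K z
          Square⇒K (w , w≢0 , refl) = split (cover w)
            where
            split : w ≡ 0# ⊎ K w ⊎ K (- w) → K (w * w)
            split (inj₁ e) = contradiction e w≢0
            split (inj₂ (inj₁ h)) = K-* h h
            split (inj₂ (inj₂ h)) = subst K (solve 1 (λ w → (:- w) :* (:- w) := w :* w) refl w) (K-* h h)
          K⇒Square : ∀ {z} → K z → Square p%4≡3 z
          K⇒Square {z} Kz = split (PrimeConverse.cover p pr p%4≡3 (toℕ α) isPrimitive z (K⇒≢0 Kz))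
            where
            split : Square p%4≡3 z ⊎ Square p%4≡3 (- z) → Square p%4≡3 z
            split (inj₁ sq) = sq
            split (inj₂ sq) = contradiction (Square⇒K sq) (K-neg⇒¬K Kz)

    listed : Listed adj
    listed = go classification
      where
      go : (∀ u → K u → u ≡ 1#) ⊎ (∀ x → x ≡ 0# ⊎ K x ⊎ K (- x)) ⊎
        (p ≡ 13 × (∀ t → K t → t * (t * t) ≡ 1#) × ∃ λ u → K u × u ≢ 1#) → Listed adj
      go (inj₁ h) = inj₂ (inj₁ (p , pr , circuit h))
      go (inj₂ (inj₁ h)) = inj₁ (p , pr , p%4≡3 h , paley h)
      go (inj₂ (inj₂ (p≡13 , cube , nontrivial))) = inj₂ (inj₂ (thirteen adj p≡13 pr f K transfer K1 K-* cube nontrivial))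

module CirculantForward (m : ℕ) .{{_ : NonZero m}} {n : ℕ} (adj : Fin n → Fin n → Bool)
  (wdr : WeaklyDistanceRegular adj) (prim : Primitive adj) (T : Subset m) (isCayleySet : IsCayleySet m T)
  (f : Fin n ↔ Fin m) (iso : ∀ x y → (adj x y ≡ true) ⇔ CayArc m T (Inverse.to f x) (Inverse.to f y)) where
  open ZMod m
  open Cayley m
  open Distance m
  open CommutativeRing commutativeRing using (-‿inverseʳ)

  sc = proj₁ wdr
  as = proj₂ wdr
  s = proj₁ (proj₂ (proj₂ isCayleySet))
  s∈T = proj₁ (proj₂ (proj₂ (proj₂ isCayleySet)))

  arc : ∀ x y → (adj x y ≡ true) ⇔ ((Inverse.to f y - Inverse.to f x) ∈ T)
  arc x y = mk⇔ (Equivalence.to (CayArc⇔ T _ _) ∘ Equivalence.to (iso x y)) (Equivalence.from (iso x y) ∘ Equivalence.from (CayArc⇔ T _ _))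

  open Transport adj f (_∈ T) arc
  open IsDistance (dist-isDistance sc) using (d0; d≡0; d≡1⇒S; S⇒d≡1)

  ¬T0 : ¬ 0# ∈ T
  ¬T0 h = proj₁ isCayleySet 0# h (Equivalence.from (Cong-0 0#) refl)

  isScheme : TwoWay.IsScheme (dist sc)
  isScheme = record { d0 = d0 ; d≡0 = d≡0 ; scheme = dist-scheme sc as }

  ds : dist sc s ≡ 1
  ds = S⇒d≡1 s ¬T0 s∈T

  d-s : dist sc (- s) ≢ 1
  d-s e = proj₂ (proj₂ (proj₂ (proj₂ isCayleySet))) (- s) (d≡1⇒S (- s) e) (Equivalence.from (Cong-sum-0 s (- s)) (-‿inverseʳ s))

  s≢0 : s ≢ 0#
  s≢0 e = ¬T0 (subst (_∈ T) e s∈T)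

  prime : Prime m
  prime = go (factors) isFactorisation factorsPrime
    where
    open PrimeFactorisation (factorise m)
    go : ∀ qs → m ≡ product qs → All Prime qs → Prime m
    go [] m≡1 _ = contradiction (trans (sym (⟦toℕ⟧ s)) (cong ⟦_⟧ (ℕ.n<1⇒n≡0 (subst (toℕ s <_) m≡1 (toℕ<n s))))) s≢0
    go (q ∷ []) m≡q (prq ∷ _) = subst Prime (sym (trans m≡q (ℕ.*-identityʳ q))) prq
    go (q ∷ r ∷ rs) m≡ (prq ∷ prr ∷ prrs) = ⊥-elim (SchurRing.composite-impossible m (dist sc) isScheme (dist-primitive sc as prim)
        s ds d-s q (r ℕ.* product rs) prq
        (ℕ.≤-trans (ℕ.nonTrivial⇒n>1 r {{prime⇒nonTrivial prr}}) (ℕ.m≤m*n r (product rs) {{product≢0 (All.map prime⇒nonZero prrs)}})) m≡)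

prime-circulant : ∀ (p : ℕ) (pr : Prime p) {n} (adj : Fin n → Fin n → Bool) → WeaklyDistanceRegular adj → Primitive adj →
  ∀ T → IsCayleySet p T → IsoTo adj p (CayArc p T) → Listed adj
prime-circulant p pr adj wdr prim T isCayleySet (f , iso) =
    PrimeForward.listed p pr adj (PrimeForward.scaling p pr s≢0 f) (λ x → dist sc (s * x))
      (PrimeForward.rescale p pr (dist-isDistance sc) isScheme ¬T0 ds d-s) scaled-arc
  where
  open PrimeField p pr using (p≢0; F; _*_; _-_; inv; inv-inverseʳ; solve; _:=_; _:*_; _:-_; *-identityʳ)
  open Distance p
  open CirculantForward p adj wdr prim T isCayleySet f iso
  open Transport adj f (_∈ T) arc
  open IsDistance (dist-isDistance sc) using (d≡1⇒S; S⇒d≡1)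
  unscale : ∀ x y → s * (inv s * y - inv s * x) ≡ y - x
  unscale x y = trans (solve 4 (λ s i x y → s :* (i :* y :- i :* x) := (y :- x) :* (s :* i)) refl s (inv s) x y)
    (trans (cong ((y - x) *_) (inv-inverseʳ s≢0)) (*-identityʳ (y - x)))
  scaled-arc : ∀ x y → (adj x y ≡ true) ⇔ (dist sc (s * (inv s * Inverse.to f y - inv s * Inverse.to f x)) ≡ 1)
  scaled-arc x y = mk⇔
    (λ a → trans (cong (dist sc) (unscale _ _)) (S⇒d≡1 _ ¬T0 (Equivalence.to (arc x y) a)))
    (λ e → Equivalence.from (arc x y) (d≡1⇒S _ (trans (cong (dist sc) (sym (unscale _ _))) e)))

forward : ∀ {n} {adj : Fin n → Fin n → Bool} → IsDigraph n adj → WeaklyDistanceRegular adj × Primitive adj × Circulant adj → Listed adj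
forward {adj = adj} (_ , x₀ , _) (wdr , prim , m , T , isCayleySet , f , iso) =
  prime-circulant m (CirculantForward.prime m {{ℕ.>-nonZero (ℕ.≤-<-trans z≤n (toℕ<n (Inverse.to f x₀)))}} adj wdr prim T isCayleySet f iso)
    adj wdr prim T isCayleySet (f , iso)

backward : ∀ {n} {adj : Fin n → Fin n → Bool} → IsDigraph n adj → Listed adj → WeaklyDistanceRegular adj × Primitive adj × Circulant adj
backward {adj = adj} _ (inj₁ (p , pr , p%4≡3 , α , isPrimitive , iso)) = PrimeConverse.paley-case p pr p%4≡3 α isPrimitive adj iso
backward {adj = adj} isDigraph (inj₂ (inj₁ (p , pr , iso))) = PrimeConverse.circuit-case p pr adj isDigraph iso
backward {adj = adj} _ (inj₂ (inj₂ iso)) = Order13.thirteen-case adj iso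

theorem1p2 : (n : ℕ) (adj : Fin n → Fin n → Bool) → IsDigraph n adj →
    (WeaklyDistanceRegular adj × Primitive adj × Circulant adj)
    ⇔
    ((∃ λ p → Prime p × p % 4 ≡ 3 ×
    (∃ λ α → IsPrimitiveElement p α × IsoTo adj p (PaleyArc p α)))
    ⊎ (∃ λ p → Prime p × IsoTo adj p (CircuitArc p))
    ⊎ IsoTo adj 13 (CayArc 13 S13))
theorem1p2 n adj isDigraph = mk⇔ (forward isDigraph) (backward isDigraph)
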